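{- For each integer $q \geq 3$ there is a function $\epsilon_q:\{2,3,\ldots\}\to\mathbb{R}$ with $\epsilon_q(d)\to 0$ as $d\to\infty$ such that for all integers $d \geq 2$ and $n \geq d+1$ and every $G \in \mathcal{G}(n,d)$, $$ c_q(G) \leq \eta^{\frac{n}{2}}\, m^{\frac{n(1+\epsilon_q(d))}{2d}}. $$
   Context: Graphs are simple, finite and loopless. For a positive integer $q$, a proper $q$-coloring of a graph $G$ is a function $f: V(G)\to\{1,\ldots,q\}$ such that adjacent vertices receive different values; $c_q(G)$ denotes the number of proper $q$-colorings of $G$. $\mathcal{G}(n,d)$ denotes the family of $n$-vertex $d$-regular graphs. Define $\eta=\eta(q)=q^2/4$ if $q$ is even and $\eta=\lfloor q/2\rfloor\lceil q/2\rceil=(q^2-1)/4$ if $q$ is odd; define $m=m(q)=\binom{q}{q/2}$ if $q$ is even and $m=\binom{q}{\lfloor q/2\rfloor}+\binom{q}{\lceil q/2\rceil}=\binom{q+1}{(q+1)/2}$ if $q$ is odd. (In the paper this is written $c_q(G)\le \eta^{n/2}m^{n(1+o(1))/(2d)}$ with $o(1)\to0$ as $d\to\infty$.) -}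

module Defs where

open import Data.Nat using (ℕ; zero; suc; _+_; _*_; _∸_; _^_; _≤_; _/_; _%_; _≡ᵇ_)
open import Data.Nat.Combinatorics using (_C_)
open import Data.Bool using (Bool; true; false; if_then_else_; not; _∨_; _∧_; T)
open import Data.Fin using (Fin; _≟_)
open import Data.Vec using (Vec; []; _∷_; lookup)
open import Data.List using (List; [_]; map; concatMap; allFin; filterᵇ; length)
open import Data.Bool.ListAction using (and)
open import Data.Integer using (+_; -[1+_])
open import Data.Rational using (ℚ; ↥_; ↧ₙ_)
open import Relation.Nullary.Decidable using (⌊_⌋)
open import Relation.Binary.PropositionalEquality using (_≡_)

record Graph (n : ℕ) : Set where
  field
    adj   : Fin n → Fin n → Bool
    sym   : ∀ u v → adj u v ≡ adj v u
    loopless : ∀ v → adj v v ≡ false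
open Graph public

degree : ∀ {n} → Graph n → Fin n → ℕ
degree {n} G v = length (filterᵇ (adj G v) (allFin n))

Regular : ∀ {n} → ℕ → Graph n → Set
Regular d G = ∀ v → degree G v ≡ d

allColourings : (q n : ℕ) → List (Vec (Fin q) n)
allColourings q zero = [ [] ]
allColourings q (suc n) = concatMap (λ x → map (x ∷_) (allColourings q n)) (allFin q)

isProper : ∀ {n q} → Graph n → Vec (Fin q) n → Bool
isProper {n} G f =
  and (map (λ u → and (map (λ v → not (adj G u v) ∨ not ⌊ lookup f u ≟ lookup f v ⌋)
                           (allFin n)))
           (allFin n))

c : ∀ {n} → (q : ℕ) → Graph n → ℕ
c {n} q G = length (filterᵇ (isProper G) (allColourings q n))

η : ℕ → ℕ
η q = (q / 2) * (q ∸ q / 2)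

m : ℕ → ℕ
m q = if (q % 2) ≡ᵇ 0 then q C (q / 2) else (q C (q / 2) + q C (q ∸ q / 2))

-- Bound q d n x ε  ⇔  (as real numbers)  x ≤ η^(n/2) · m^(n(1+ε)/(2d)),
-- stated after raising both sides to the power 2·d·s, where ε = num/s.
-- For num ≥ 0:  x^(2ds) ≤ η^(nds) · m^(n(s+num));
-- for num = -(b+1):  x^(2ds) · m^(n(b+1)) ≤ η^(nds) · m^(ns).
Bound : (q d n x : ℕ) → ℚ → Set
Bound q d n x ε with ↥ ε
... | + a     = x ^ (2 * d * ↧ₙ ε) ≤ η q ^ (n * d * ↧ₙ ε) * m q ^ (n * (↧ₙ ε + a))
... | -[1+ b ] = x ^ (2 * d * ↧ₙ ε) * m q ^ (n * suc b) ≤ η q ^ (n * d * ↧ₙ ε) * m q ^ (n * ↧ₙ ε)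

{-# OPTIONS --safe #-}
module Submission where

open import Defs
open import Data.Nat using (ℕ; _≤_; _+_)
open import Data.Rational using (ℚ; 0ℚ; ∣_∣) renaming (_<_ to _<ℚ_; _≤_ to _≤ℚ_)
open import Data.Product using (Σ; _×_; ∃)

import Data.Bool as Bool
import Data.Bool.Properties as Bool
import Data.Integer as ℤ
import Data.Integer.Properties as ℤ
import Data.List as List
import Data.Nat.Coprimality as Coprimality
import Data.Rational.Properties as ℚ
open import Data.Bool using (Bool; true; false; if_then_else_; not; _∨_; _∧_)
open import Data.Bool.ListAction using (and)
open import Data.Empty using (⊥; ⊥-elim)
open import Data.Fin using (Fin; zero; suc; _≟_; fromℕ<)
open import Data.Fin.Properties using (any?)
open import Data.List using (List; []; _∷_; map; length; _++_; allFin; concatMap; filterᵇ)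
open import Data.List.Membership.Propositional using (_∈_)
open import Data.List.Membership.Propositional.Properties using (∈-++⁺ˡ; ∈-++⁺ʳ; ∈-map⁺; ∈-allFin)
open import Data.List.Properties using (map-tabulate; length-tabulate; length-++; length-map; length-replicate)
open import Data.List.Relation.Binary.Permutation.Propositional as Perm using (_↭_; ↭⇒↭ₛ; ↭-sym; ↭-trans)
open import Data.List.Relation.Binary.Permutation.Propositional.Properties using (shift; map⁺; ↭-length)
open import Data.List.Relation.Binary.Permutation.Setoid.Properties using (Unique-resp-↭)
open import Data.List.Relation.Unary.All using (All; []; _∷_)
open import Data.List.Relation.Unary.AllPairs using ([]; _∷_)
open import Data.List.Relation.Unary.Any using (here; there)
open import Data.List.Relation.Unary.Unique.Propositional using (Unique)
open import Data.List.Relation.Unary.Unique.Propositional.Properties using (allFin⁺)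
open import Data.Nat hiding (_≟_)
open import Data.Nat.Combinatorics using (_C_; nCn≡1; nCk≡nC[n∸k]; k>n⇒nCk≡0; nCk+nC[k+1]≡[n+1]C[k+1])
open import Data.Nat.Coprimality using (1-coprimeTo)
open import Data.Nat.DivMod using (m≡m%n+[m/n]*n; m%n<n; m/n*n≤m)
open import Data.Nat.ListAction using (sum; product)
open import Data.Nat.ListAction.Properties using (sum-↭)
open import Data.Nat.Properties hiding (_≟_)
open import Data.Nat.Tactic.RingSolver using (solve-∀)
open import Data.Product using (_,_; proj₁; proj₂)
open import Data.Rational using (mkℚ; *≤*; *<*)
open import Data.Sum using (_⊎_; inj₁; inj₂)
open import Data.Vec using (Vec; []; _∷_; lookup; _[_]≔_; tabulate; replicate)
open import Data.Vec.Properties using ([]≔-commutes; lookup∘updateAt; lookup∘updateAt′; lookup∘tabulate)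
open import Function using (_∘_; id)
open import Relation.Binary.Definitions using (tri<; tri≈; tri>)
open import Relation.Binary.PropositionalEquality renaming (sym to ≡-sym)
open import Relation.Nullary using (yes; no)
open import Relation.Nullary.Decidable using (⌊_⌋; _×-dec_)

-- Two estimates are combined.
-- (1) Order the vertices and sum the indicator of proper colourings one vertex at a time, starting from the last.
-- Hölder's inequality gives c_q(G)^d ≤ Π_v K(p(v)), where p(v) is the number of earlier neighbours of v, K(0) = 1
-- and K(p) = Σ_{A ⊆ [q]} (|A| (q - |A|))^p ≈ m η^p. If G has an independent set of size ≥ (1 - 1/e) n/2, put it
-- first: it contributes nothing, while all but n/e of the remaining vertices have many earlier neighbours, so the
-- product is about η^{nd/2} m^{n/2}.
-- (2) Otherwise c_q(G)² ≤ η^n. Count colourings from lists A_v ⊆ [q]. Branching on vertices that have many neighbours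
-- sharing one of their colours costs a factor (1 + o(1))^n and leaves lists with Σ |A_v| ≤ (1 + o(1)) qn/2; branching on
-- single conflicts then either saves a factor (1 - 1/q²)^{Ω(n)} or ends with lists in which every colour class
-- {v : i ∈ A_v} is independent, hence small, so that Σ |A_v| ≤ (1 - 1/e) qn/2. In both cases concavity of log
-- turns the bound on Σ |A_v| into one on Π |A_v|.

-- The obstacle is the 2 in the exponent n(1+ε)/(2d) of m. A vertex with many earlier neighbours
-- costs a factor m, so a bound that charges every vertex gives m^(n/d). Halving the exponent
-- requires about half of the vertices to be free, and this is what K(0) = 1 provides on an
-- independent set of nearly n/2 vertices. Without such a set no power of m is needed: the savings
-- in (2) are exponential in n at a rate fixed by q and e, and they beat all losses once the
-- branching parameters, and then d, are large enough in terms of q and e. The two cases are tied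
-- together by the choice e = 4S(q+1) for the error term ε = 1/S. Real powers and roots are avoided
-- throughout. Inequalities are raised to common multiples of the exponents, a factor (1 + 1/t)^k
-- appears as `suc t ^ k` against `t ^ k`, and where a bound needs a name of its own, `integer-root`
-- replaces the real root.

private variable
  X Y : Set
  n q : ℕ

-- Powers and exponential growth

^-distribʳ-* : ∀ a b k → (a * b) ^ k ≡ a ^ k * b ^ k
^-distribʳ-* a b zero    = refl
^-distribʳ-* a b (suc k) rewrite ^-distribʳ-* a b k = lemma a b (a ^ k) (b ^ k)
  where
  lemma : ∀ a b x y → a * b * (x * y) ≡ a * x * (b * y)
  lemma = solve-∀

0^k≡0 : ∀ k .{{_ : NonZero k}} → 0 ^ k ≡ 0
0^k≡0 (suc k) = refl

^-swap : ∀ a k l → (a ^ k) ^ l ≡ (a ^ l) ^ k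
^-swap a k l = begin
  (a ^ k) ^ l ≡⟨ ^-*-assoc a k l ⟩
  a ^ (k * l) ≡⟨ cong (a ^_) (*-comm k l) ⟩
  a ^ (l * k) ≡⟨ ^-*-assoc a l k ⟨
  (a ^ l) ^ k ∎
  where open ≡-Reasoning

1≤^ : ∀ {a} k → 1 ≤ a → 1 ≤ a ^ k
1≤^ {a} k 1≤a = m^n>0 a {{>-nonZero 1≤a}} k

^-cancelʳ-≤ : ∀ k {a b} .{{_ : NonZero k}} → a ^ k ≤ b ^ k → a ≤ b
^-cancelʳ-≤ k {a} {b} h with a ≤? b
... | yes a≤b = a≤b
... | no a≰b  = ⊥-elim (<⇒≱ (^-monoˡ-< k (≰⇒> a≰b)) h)

2mn≤m²+n² : ∀ m n → 2 * (m * n) ≤ m * m + n * n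
2mn≤m²+n² m n with ≤-total m n
... | inj₁ m≤n = subst (λ n → 2 * (m * n) ≤ m * m + n * n) (m+[n∸m]≡n m≤n)
                   (subst (2 * (m * (m + k)) ≤_) (≡-sym (square m k)) (m≤m+n _ _))
  where
  k = n ∸ m
  square : ∀ m k → m * m + (m + k) * (m + k) ≡ 2 * (m * (m + k)) + k * k
  square = solve-∀
... | inj₂ n≤m = subst (λ m → 2 * (m * n) ≤ m * m + n * n) (m+[n∸m]≡n n≤m)
                   (subst (2 * ((n + k) * n) ≤_) (≡-sym (square n k)) (m≤m+n _ _))
  where
  k = m ∸ n
  square : ∀ n k → (n + k) * (n + k) + n * n ≡ 2 * ((n + k) * n) + k * k
  square = solve-∀

-- Bernoulli's inequality (1 + 1/a)^k ≥ 1 + k/a, multiplied by a^(k+1); in this form it survives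
-- `a = 0`.
bernoulli : ∀ a k → a ^ k * (a + k) ≤ suc a ^ k * a
bernoulli a zero    = ≤-reflexive (cong (1 *_) (+-identityʳ a))
bernoulli a (suc k) = begin
  a * a ^ k * (a + suc k)                 ≤⟨ m≤m+n _ (a ^ k * k) ⟩
  a * a ^ k * (a + suc k) + a ^ k * k     ≡⟨ lemma a k (a ^ k) ⟩
  suc a * (a ^ k * (a + k))               ≤⟨ *-monoʳ-≤ (suc a) (bernoulli a k) ⟩
  suc a * (suc a ^ k * a)                 ≡⟨ *-assoc (suc a) (suc a ^ k) a ⟨
  suc a * suc a ^ k * a                   ∎
  where
  open ≤-Reasoning
  lemma : ∀ a k x → a * x * (a + (1 + k)) + x * k ≡ (1 + a) * (x * (a + k))
  lemma = solve-∀

-- (1 + 1/a)^k ≥ 1 + k/a ≥ x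
power-growth : ∀ a k x .{{_ : NonZero a}} → x * a ≤ a + k → x * a ^ k ≤ suc a ^ k
power-growth a k x h = *-cancelʳ-≤ _ _ a (begin
  x * a ^ k * a    ≡⟨ lemma x (a ^ k) a ⟩
  a ^ k * (x * a)  ≤⟨ *-monoʳ-≤ (a ^ k) h ⟩
  a ^ k * (a + k)  ≤⟨ bernoulli a k ⟩
  suc a ^ k * a    ∎)
  where
  open ≤-Reasoning
  lemma : ∀ x y a → x * y * a ≡ y * (x * a)
  lemma = solve-∀

-- (1 + 1/t)^k (1 - k/t) ≤ 1
bernoulli-upper : ∀ k u → suc (k + u) ^ k * u ≤ (k + u) ^ k * (k + u)
bernoulli-upper k u = go k u (k + u) refl
  where
  open ≤-Reasoning
  expand : ∀ k u → (2 + k + u) * u + (1 + k) ≡ (1 + u) * (1 + k + u)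
  expand = solve-∀
  go : ∀ k u t → k + u ≡ t → suc t ^ k * u ≤ t ^ k * t
  go zero    u t refl = ≤-refl
  go (suc k) u t refl = begin
    suc t * suc t ^ k * u         ≡⟨ lemma₁ (suc t) (suc t ^ k) u ⟩
    suc t ^ k * (suc t * u)       ≤⟨ *-monoʳ-≤ (suc t ^ k) (≤-trans (m≤m+n _ (1 + k)) (≤-reflexive (expand k u))) ⟩
    suc t ^ k * (suc u * t)       ≡⟨ *-assoc (suc t ^ k) _ t ⟨
    suc t ^ k * suc u * t         ≤⟨ *-monoˡ-≤ t (go k (suc u) t (+-suc k u)) ⟩
    t ^ k * t * t                 ≡⟨ cong (_* t) (*-comm (t ^ k) t) ⟩
    t * t ^ k * t                 ∎
    where
    lemma₁ : ∀ x y z → x * y * z ≡ y * (x * z)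
    lemma₁ = solve-∀

-- With u = t - k, `bernoulli-upper` gives (1 + 1/t)^k ≤ t/u, and t ≤ 2u because k is at most half
-- of t.
power-growth≤2 : ∀ t k .{{_ : NonZero t}} → 2 * k ≤ t → suc t ^ k ≤ 2 * t ^ k
power-growth≤2 t k h = *-cancelʳ-≤ _ _ t (begin
  suc t ^ k * t        ≤⟨ *-monoʳ-≤ (suc t ^ k) t≤2u ⟩
  suc t ^ k * (2 * u)  ≡⟨ lemma (suc t ^ k) u ⟩
  2 * (suc t ^ k * u)  ≤⟨ *-monoʳ-≤ 2 (subst (λ t → suc t ^ k * u ≤ t ^ k * t) k+u≡t (bernoulli-upper k u)) ⟩
  2 * (t ^ k * t)      ≡⟨ *-assoc 2 (t ^ k) t ⟨
  2 * t ^ k * t        ∎)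
  where
  open ≤-Reasoning
  u = t ∸ k
  k+u≡t : k + u ≡ t
  k+u≡t = m+[n∸m]≡n (≤-trans (m≤m+n k (k + 0)) h)
  t≤2u : t ≤ 2 * u
  t≤2u = +-cancelˡ-≤ (2 * k) _ _ (begin
    2 * k + t       ≤⟨ +-monoˡ-≤ t h ⟩
    t + t           ≡⟨ cong (λ t → t + t) k+u≡t ⟨
    (k + u) + (k + u) ≡⟨ lemma₂ k u ⟩
    2 * k + 2 * u   ∎)
    where
    lemma₂ : ∀ k u → (k + u) + (k + u) ≡ 2 * k + 2 * u
    lemma₂ = solve-∀
  lemma : ∀ x u → x * (2 * u) ≡ 2 * (x * u)
  lemma = solve-∀

-- By concavity, log lies at every integer on or below the line through its values at h and h + 1.
log-chord : ∀ h a → a * (h ^ a * suc h ^ h) ≤ h * h ^ h * suc h ^ a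
log-chord h a with ≤-total h a
... | inj₁ h≤a = subst (λ a → a * (h ^ a * suc h ^ h) ≤ h * h ^ h * suc h ^ a) (m+[n∸m]≡n h≤a) (above (a ∸ h))
  where
  open ≤-Reasoning
  above : ∀ k → (h + k) * (h ^ (h + k) * suc h ^ h) ≤ h * h ^ h * suc h ^ (h + k)
  above k = begin
    (h + k) * (h ^ (h + k) * suc h ^ h)    ≡⟨ cong (λ z → (h + k) * (z * suc h ^ h)) (^-distribˡ-+-* h h k) ⟩
    (h + k) * (h ^ h * h ^ k * suc h ^ h)  ≡⟨ lemma (h + k) (h ^ h) (h ^ k) (suc h ^ h) ⟩
    h ^ k * (h + k) * (h ^ h * suc h ^ h)  ≤⟨ *-monoˡ-≤ _ (bernoulli h k) ⟩
    suc h ^ k * h * (h ^ h * suc h ^ h)    ≡⟨ lemma′ (suc h ^ k) h (h ^ h) (suc h ^ h) ⟩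
    h * h ^ h * (suc h ^ h * suc h ^ k)    ≡⟨ cong (h * h ^ h *_) (^-distribˡ-+-* (suc h) h k) ⟨
    h * h ^ h * suc h ^ (h + k)            ∎
    where
    lemma : ∀ a b c d → a * (b * c * d) ≡ c * a * (b * d)
    lemma = solve-∀
    lemma′ : ∀ a b c d → a * b * (c * d) ≡ b * c * (d * a)
    lemma′ = solve-∀
... | inj₂ a≤h = go (h ∸ a) (m∸n+n≡m a≤h)
  where
  open ≤-Reasoning
  go : ∀ k → k + a ≡ h → a * (h ^ a * suc h ^ h) ≤ h * h ^ h * suc h ^ a
  go k refl = begin
    a * (h′ ^ a * suc h′ ^ (k + a))                  ≡⟨ cong (λ z → a * (h′ ^ a * z)) (^-distribˡ-+-* (suc h′) k a) ⟩
    a * (h′ ^ a * (suc h′ ^ k * suc h′ ^ a))         ≡⟨ lemma a (h′ ^ a) (suc h′ ^ k) (suc h′ ^ a) ⟩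
    suc h′ ^ k * a * (h′ ^ a * suc h′ ^ a)           ≤⟨ *-monoˡ-≤ _ (bernoulli-upper k a) ⟩
    h′ ^ k * h′ * (h′ ^ a * suc h′ ^ a)              ≡⟨ lemma′ (h′ ^ k) h′ (h′ ^ a) (suc h′ ^ a) ⟩
    h′ * (h′ ^ k * h′ ^ a) * suc h′ ^ a              ≡⟨ cong (λ z → h′ * z * suc h′ ^ a) (^-distribˡ-+-* h′ k a) ⟨
    h′ * h′ ^ (k + a) * suc h′ ^ a                   ∎
    where
    h′ = k + a
    lemma : ∀ a b c d → a * (b * (c * d)) ≡ c * a * (b * d)
    lemma = solve-∀
    lemma′ : ∀ a b c d → a * b * (c * d) ≡ b * (a * c) * d
    lemma′ = solve-∀

-- A stand-in for the real number (x/y)^(1/k). Rounding down loses nothing, since only natural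
-- numbers are ever compared with it.
integer-root : ∀ k x y .{{_ : NonZero k}} .{{_ : NonZero y}} →
  ∃ λ b → b ^ k * y ≤ x × (∀ a → a ^ k * y ≤ x → a ≤ b)
integer-root k@(suc k-1) x y = go (suc x) λ a h → ≤-trans (≤-trans (a≤a^k a) (m≤m*n (a ^ k) y)) (m≤n⇒m≤1+n h)
  where
  a≤a^k : ∀ a → a ≤ a ^ k
  a≤a^k zero    = z≤n
  a≤a^k (suc a) = m≤m*n (suc a) (suc a ^ k-1) {{m^n≢0 (suc a) k-1}}
  go : ∀ B → (∀ a → a ^ k * y ≤ x → a ≤ B) → ∃ λ b → b ^ k * y ≤ x × (∀ a → a ^ k * y ≤ x → a ≤ b)
  go zero    bound = 0 , z≤n , bound
  go (suc B) bound with suc B ^ k * y ≤? x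
  ... | yes p = suc B , p , bound
  ... | no ¬p = go B λ a h → ≤-pred (≤∧≢⇒< (bound a h) λ { refl → ¬p h })

-- Indicators, finite sums and finite products.

ind : Bool → ℕ
ind b = if b then 1 else 0

ind≤1 : ∀ b → ind b ≤ 1
ind≤1 false = z≤n
ind≤1 true  = s≤s z≤n

∑ : List X → (X → ℕ) → ℕ
∑ xs f = sum (map f xs)

∏ : List X → (X → ℕ) → ℕ
∏ xs f = product (map f xs)

∑-cong : ∀ (xs : List X) {f g} → (∀ x → f x ≡ g x) → ∑ xs f ≡ ∑ xs g
∑-cong []       h = refl
∑-cong (x ∷ xs) h = cong₂ _+_ (h x) (∑-cong xs h)

∏-cong : ∀ (xs : List X) {f g} → (∀ x → f x ≡ g x) → ∏ xs f ≡ ∏ xs g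
∏-cong []       h = refl
∏-cong (x ∷ xs) h = cong₂ _*_ (h x) (∏-cong xs h)

∑-mono : ∀ (xs : List X) {f g} → (∀ x → f x ≤ g x) → ∑ xs f ≤ ∑ xs g
∑-mono []       h = z≤n
∑-mono (x ∷ xs) h = +-mono-≤ (h x) (∑-mono xs h)

∏-mono : ∀ (xs : List X) {f g} → (∀ x → f x ≤ g x) → ∏ xs f ≤ ∏ xs g
∏-mono []       h = ≤-refl
∏-mono (x ∷ xs) h = *-mono-≤ (h x) (∏-mono xs h)

∑-zero : ∀ (xs : List X) → ∑ xs (λ _ → 0) ≡ 0
∑-zero []       = refl
∑-zero (x ∷ xs) = ∑-zero xs

∑-const : ∀ (xs : List X) a → ∑ xs (λ _ → a) ≡ length xs * a
∑-const []       a = refl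
∑-const (x ∷ xs) a = cong (a +_) (∑-const xs a)

∏-const : ∀ (xs : List X) a → ∏ xs (λ _ → a) ≡ a ^ length xs
∏-const []       a = refl
∏-const (x ∷ xs) a = cong (a *_) (∏-const xs a)

∑-+ : ∀ (xs : List X) f g → ∑ xs (λ x → f x + g x) ≡ ∑ xs f + ∑ xs g
∑-+ []       f g = refl
∑-+ (x ∷ xs) f g rewrite ∑-+ xs f g = lemma (f x) (g x) _ _
  where
  lemma : ∀ a b c d → a + b + (c + d) ≡ a + c + (b + d)
  lemma = solve-∀

∏-* : ∀ (xs : List X) f g → ∏ xs (λ x → f x * g x) ≡ ∏ xs f * ∏ xs g
∏-* []       f g = refl
∏-* (x ∷ xs) f g rewrite ∏-* xs f g = lemma (f x) (g x) (∏ xs f) (∏ xs g)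
  where
  lemma : ∀ a b c d → a * b * (c * d) ≡ a * c * (b * d)
  lemma = solve-∀

∑-*ˡ : ∀ (xs : List X) a f → ∑ xs (λ x → a * f x) ≡ a * ∑ xs f
∑-*ˡ []       a f = ≡-sym (*-zeroʳ a)
∑-*ˡ (x ∷ xs) a f rewrite ∑-*ˡ xs a f = ≡-sym (*-distribˡ-+ a (f x) (∑ xs f))

∑-*ʳ : ∀ (xs : List X) f a → ∑ xs (λ x → f x * a) ≡ ∑ xs f * a
∑-*ʳ xs f a = trans (∑-cong xs λ x → *-comm (f x) a) (trans (∑-*ˡ xs a f) (*-comm a _))

∏-^ : ∀ (xs : List X) f k → ∏ xs (λ x → f x ^ k) ≡ ∏ xs f ^ k
∏-^ []       f k = ≡-sym (^-zeroˡ k)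
∏-^ (x ∷ xs) f k rewrite ∏-^ xs f k = ≡-sym (^-distribʳ-* (f x) (∏ xs f) k)

∏-exp : ∀ (xs : List X) a f → ∏ xs (λ x → a ^ f x) ≡ a ^ ∑ xs f
∏-exp []       a f = refl
∏-exp (x ∷ xs) a f rewrite ∏-exp xs a f = ≡-sym (^-distribˡ-+-* a (f x) (∑ xs f))

∑-++ : ∀ (xs ys : List X) f → ∑ (xs ++ ys) f ≡ ∑ xs f + ∑ ys f
∑-++ []       ys f = refl
∑-++ (x ∷ xs) ys f rewrite ∑-++ xs ys f = ≡-sym (+-assoc (f x) _ _)

∑-map : ∀ (h : Y → X) ys f → ∑ (map h ys) f ≡ ∑ ys (f ∘ h)
∑-map h []       f = refl
∑-map h (y ∷ ys) f = cong (f (h y) +_) (∑-map h ys f)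

∏-map : ∀ (h : Y → X) ys f → ∏ (map h ys) f ≡ ∏ ys (f ∘ h)
∏-map h []       f = refl
∏-map h (y ∷ ys) f = cong (f (h y) *_) (∏-map h ys f)

∑-swap : ∀ (xs : List X) (ys : List Y) (f : X → Y → ℕ) → ∑ xs (λ x → ∑ ys (f x)) ≡ ∑ ys (λ y → ∑ xs λ x → f x y)
∑-swap []       ys f = ≡-sym (∑-zero ys)
∑-swap (x ∷ xs) ys f rewrite ∑-swap xs ys f = ≡-sym (∑-+ ys (f x) _)

∈⇒≤∑ : ∀ {xs : List X} {x} f → x ∈ xs → f x ≤ ∑ xs f
∈⇒≤∑ f (here refl) = m≤m+n _ _
∈⇒≤∑ f (there h)   = ≤-trans (∈⇒≤∑ f h) (m≤n+m _ _)

-- Hölder's inequality over ℕ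

-- AM-GM for z^(k+1) and k copies of y^(k+1). In the induction step, adding k z y^(k+1) to both
-- sides completes the left side to (k+1) y^k times 2zy, where 2zy ≤ z² + y² applies.
young : ∀ k z y → suc k * (z * y ^ k) ≤ z * z ^ k + k * (y * y ^ k)
young zero    z y = ≤-reflexive (lemma z)
  where
  lemma : ∀ z → 1 * (z * 1) ≡ z * 1 + 0
  lemma = solve-∀
young (suc k) z y = +-cancelʳ-≤ (k * (z * (y * yᵏ)) ) _ _ (begin
  (2 + k) * (z * (y * yᵏ)) + k * (z * (y * yᵏ))         ≡⟨ lemma₁ k z y yᵏ ⟩
  (1 + k) * yᵏ * (2 * (z * y))                        ≤⟨ *-monoʳ-≤ ((1 + k) * yᵏ) (2mn≤m²+n² z y) ⟩
  (1 + k) * yᵏ * (z * z + y * y)                      ≡⟨ lemma₂ k z y yᵏ ⟩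
  z * ((1 + k) * (z * yᵏ)) + (1 + k) * (y * (y * yᵏ))   ≤⟨ +-monoˡ-≤ _ (*-monoʳ-≤ z (young k z y)) ⟩
  z * (z * zᵏ + k * (y * yᵏ)) + (1 + k) * (y * (y * yᵏ)) ≡⟨ lemma₃ k z y yᵏ zᵏ ⟩
  z * (z * zᵏ) + (1 + k) * (y * (y * yᵏ)) + k * (z * (y * yᵏ)) ∎)
  where
  open ≤-Reasoning
  zᵏ = z ^ k
  yᵏ = y ^ k
  lemma₁ : ∀ k z y u → (2 + k) * (z * (y * u)) + k * (z * (y * u)) ≡ (1 + k) * u * (2 * (z * y))
  lemma₁ = solve-∀
  lemma₂ : ∀ k z y u → (1 + k) * u * (z * z + y * y) ≡ z * ((1 + k) * (z * u)) + (1 + k) * (y * (y * u))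
  lemma₂ = solve-∀
  lemma₃ : ∀ k z y u v → z * (z * v + k * (y * u)) + (1 + k) * (y * (y * u)) ≡ z * (z * v) + (1 + k) * (y * (y * u)) + k * (z * (y * u))
  lemma₃ = solve-∀

-- AM-GM for x and k copies of s/k. It is `young` at z = k(s+x), y = (k+1)s: cancelling k y^(k+1)
-- leaves the claim multiplied by k, whence the separate case `k = 0`.
weighted-amgm : ∀ k s x → suc k ^ suc k * (s ^ k * x) ≤ k ^ k * (s + x) ^ suc k
weighted-amgm zero    s x = ≤-trans (≤-reflexive (lemma x)) (≤-trans (m≤n+m x s) (≤-reflexive (lemma′ s x)))
  where
  lemma : ∀ x → 1 * (1 * x) ≡ x
  lemma = solve-∀
  lemma′ : ∀ s x → s + x ≡ 1 * ((s + x) * 1)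
  lemma′ = solve-∀
weighted-amgm k@(suc _) s x = *-cancelʳ-≤ _ _ k (+-cancelʳ-≤ (k * (y * y ^ k)) _ _ (begin
  suc k ^ suc k * (s ^ k * x) * k + k * (y * y ^ k)             ≡⟨ cong (λ w → suc k ^ suc k * (s ^ k * x) * k + k * (y * w)) (^-distribʳ-* (suc k) s k) ⟩
  suc k ^ suc k * (s ^ k * x) * k + k * (y * (suc k ^ k * s ^ k)) ≡⟨ lemma k s x (suc k ^ k) (s ^ k) ⟩
  suc k * (z * (suc k ^ k * s ^ k))                             ≡⟨ cong (λ w → suc k * (z * w)) (^-distribʳ-* (suc k) s k) ⟨
  suc k * (z * y ^ k)                                           ≤⟨ young k z y ⟩
  z * z ^ k + k * (y * y ^ k)                                   ≡⟨ cong (λ w → z * w + k * (y * y ^ k)) (^-distribʳ-* k (s + x) k) ⟩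
  z * (k ^ k * (s + x) ^ k) + k * (y * y ^ k)                   ≡⟨ cong (_+ k * (y * y ^ k)) (lemma′ k (s + x) (k ^ k) ((s + x) ^ k)) ⟩
  k ^ k * (s + x) ^ suc k * k + k * (y * y ^ k)                 ∎))
  where
  open ≤-Reasoning
  z = k * (s + x)
  y = suc k * s
  lemma : ∀ k s x u v → (1 + k) * u * (v * x) * k + k * ((1 + k) * s * (u * v)) ≡ (1 + k) * (k * (s + x) * (u * v))
  lemma = solve-∀
  lemma′ : ∀ k a u v → k * a * (u * v) ≡ u * (a * v) * k
  lemma′ = solve-∀

-- Σᵢ aᵢ Πⱼ≠ᵢ cⱼ, the numerator of Σᵢ aᵢ / cᵢ.
ratioSum : List X → (a c : X → ℕ) → ℕ
ratioSum []       a c = 0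
ratioSum (x ∷ xs) a c = a x * ∏ xs c + c x * ratioSum xs a c

-- AM-GM for the ratios aᵢ / cᵢ, cleared of denominators.
amgm : ∀ (xs : List X) a c → let N = length xs in
  N ^ N * (∏ xs a * ∏ xs c ^ N) ≤ ratioSum xs a c ^ N * ∏ xs c
amgm []       a c = ≤-refl
amgm (x ∷ xs) a c = *-cancelˡ-≤ (N ^ N) {{N^N≢0 N}} (begin
  N ^ N * (suc N ^ suc N * (a x * α * (c x * π) ^ suc N))     ≡⟨ cong (λ w → N ^ N * (suc N ^ suc N * (a x * α * (c x * π * w)))) (^-distribʳ-* (c x) π N) ⟩
  N ^ N * (suc N ^ suc N * (a x * α * (c x * π * (c x ^ N * π ^ N)))) ≡⟨ lemma₁ (N ^ N) (suc N ^ suc N) (a x) α (c x) π (c x ^ N) (π ^ N) ⟩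
  suc N ^ suc N * (a x * c x * c x ^ N * π) * (N ^ N * (α * π ^ N)) ≤⟨ *-monoʳ-≤ (suc N ^ suc N * (a x * c x * c x ^ N * π)) (amgm xs a c) ⟩
  suc N ^ suc N * (a x * c x * c x ^ N * π) * (R ^ N * π)     ≡⟨ lemma₂ (suc N ^ suc N) (a x) (c x) (c x ^ N) π (R ^ N) ⟩
  suc N ^ suc N * (c x ^ N * R ^ N * (a x * π)) * (c x * π)   ≡⟨ cong (λ w → suc N ^ suc N * (w * (a x * π)) * (c x * π)) (^-distribʳ-* (c x) R N) ⟨
  suc N ^ suc N * ((c x * R) ^ N * (a x * π)) * (c x * π)     ≤⟨ *-monoˡ-≤ (c x * π) (weighted-amgm N (c x * R) (a x * π)) ⟩
  N ^ N * (c x * R + a x * π) ^ suc N * (c x * π)             ≡⟨ cong (λ w → N ^ N * w ^ suc N * (c x * π)) (+-comm (c x * R) (a x * π)) ⟩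
  N ^ N * (a x * π + c x * R) ^ suc N * (c x * π)             ≡⟨ *-assoc (N ^ N) _ (c x * π) ⟩
  N ^ N * ((a x * π + c x * R) ^ suc N * (c x * π))           ∎)
  where
  open ≤-Reasoning
  N = length xs
  α = ∏ xs a
  π = ∏ xs c
  R = ratioSum xs a c
  N^N≢0 : ∀ N → NonZero (N ^ N)
  N^N≢0 zero    = _
  N^N≢0 (suc N) = m^n≢0 (suc N) (suc N)
  lemma₁ : ∀ n m a α c π cN πN → n * (m * (a * α * (c * π * (cN * πN)))) ≡ m * (a * c * cN * π) * (n * (α * πN))
  lemma₁ = solve-∀
  lemma₂ : ∀ m a c cN π r → m * (a * c * cN * π) * (r * π) ≡ m * (cN * r * (a * π)) * (c * π)
  lemma₂ = solve-∀

-- Each index contributes a/(a+b) + b/(a+b) = 1. With denominators cleared this is true even where a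
-- + b vanishes.
ratioSum-+ : ∀ (xs : List X) a b → let z = λ x → a x + b x in
  ratioSum xs a z + ratioSum xs b z ≡ length xs * ∏ xs z
ratioSum-+ []       a b = refl
ratioSum-+ (x ∷ xs) a b = begin
  a x * π + z * R + (b x * π + z * R′)  ≡⟨ lemma (a x) (b x) π R R′ ⟩
  z * π + z * (R + R′)                  ≡⟨ cong (λ w → z * π + z * w) (ratioSum-+ xs a b) ⟩
  z * π + z * (length xs * π)           ≡⟨ lemma′ z π (length xs) ⟩
  suc (length xs) * (z * π)             ∎
  where
  open ≡-Reasoning
  z  = a x + b x
  π  = ∏ xs λ x → a x + b x
  R  = ratioSum xs a λ x → a x + b x
  R′ = ratioSum xs b λ x → a x + b x
  lemma : ∀ a b π r r′ → a * π + (a + b) * r + (b * π + (a + b) * r′) ≡ (a + b) * π + (a + b) * (r + r′)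
  lemma = solve-∀
  lemma′ : ∀ z π n → z * π + z * (n * π) ≡ (1 + n) * (z * π)
  lemma′ = solve-∀

-- If the inequality failed, AM-GM would bound each of the two halves of Σᵢ (aᵢ + bᵢ)/(aᵢ + bᵢ) = N from
-- below by N times s/(s + t) and t/(s + t), one of them strictly.
mahler : ∀ (xs : List X) a b κ s t .{{_ : NonZero (length xs)}} → let N = length xs in
  s ^ N ≤ κ * ∏ xs a → t ^ N ≤ κ * ∏ xs b → (s + t) ^ N ≤ κ * ∏ xs (λ x → a x + b x)
mahler xs a b κ s t hs ht with (s + t) ^ length xs ≤? κ * ∏ xs (λ x → a x + b x)
... | yes h = h
... | no ¬h = ⊥-elim (absurd (m≤n⇒m<n∨m≡n (z≤n {R + R′})))
  where
  open ≤-Reasoning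
  N  = length xs
  a+b  = λ x → a x + b x
  π  = ∏ xs a+b
  R  = ratioSum xs a a+b
  R′ = ratioSum xs b a+b
  fails : κ * π < (s + t) ^ N
  fails = ≰⇒> ¬h

  bound : ∀ a s → s ^ N ≤ κ * ∏ xs a → N ^ N * (s ^ N * π ^ N) ≤ ratioSum xs a a+b ^ N * (κ * π)
  bound a s h = begin
    N ^ N * (s ^ N * π ^ N)             ≤⟨ *-monoʳ-≤ (N ^ N) (*-monoˡ-≤ (π ^ N) h) ⟩
    N ^ N * (κ * ∏ xs a * π ^ N)        ≡⟨ lemma (N ^ N) κ (∏ xs a) (π ^ N) ⟩
    κ * (N ^ N * (∏ xs a * π ^ N))      ≤⟨ *-monoʳ-≤ κ (amgm xs a a+b) ⟩
    κ * (ratioSum xs a a+b ^ N * π)       ≡⟨ lemma′ κ (ratioSum xs a a+b ^ N) π ⟩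
    ratioSum xs a a+b ^ N * (κ * π)       ∎
    where
    lemma : ∀ n z α p → n * (z * α * p) ≡ z * (n * (α * p))
    lemma = solve-∀
    lemma′ : ∀ z r p → z * (r * p) ≡ r * (z * p)
    lemma′ = solve-∀

  pull : ∀ s → N ^ N * (s ^ N * π ^ N) ≡ (N * (s * π)) ^ N
  pull s = ≡-sym (trans (^-distribʳ-* N (s * π) N) (cong (N ^ N *_) (^-distribʳ-* s π N)))

  lower : ∀ a u → u ^ N ≤ κ * ∏ xs a → N * (u * π) ≤ ratioSum xs a a+b * (s + t)
  lower a u h = ^-cancelʳ-≤ N (begin
    (N * (u * π)) ^ N                    ≡⟨ pull u ⟨
    N ^ N * (u ^ N * π ^ N)              ≤⟨ bound a u h ⟩
    ratioSum xs a a+b ^ N * (κ * π)        ≤⟨ *-monoʳ-≤ (ratioSum xs a a+b ^ N) (<⇒≤ fails) ⟩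
    ratioSum xs a a+b ^ N * (s + t) ^ N    ≡⟨ ^-distribʳ-* (ratioSum xs a a+b) _ N ⟨
    (ratioSum xs a a+b * (s + t)) ^ N      ∎)

  -- The assumed failure is strict, but it enters multiplied by a power of the ratio sum, so
  -- strictness survives only if that sum is positive.
  lower-< : ∀ a u → u ^ N ≤ κ * ∏ xs a → 0 < ratioSum xs a a+b → N * (u * π) < ratioSum xs a a+b * (s + t)
  lower-< a u h 0<R = ≰⇒> λ le → <⇒≱ (begin-strict
    (N * (u * π)) ^ N                   ≡⟨ pull u ⟨
    N ^ N * (u ^ N * π ^ N)             ≤⟨ bound a u h ⟩
    ratioSum xs a a+b ^ N * (κ * π)        <⟨ *-monoʳ-< (ratioSum xs a a+b ^ N) {{m^n≢0 _ N {{>-nonZero 0<R}}}} fails ⟩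
    ratioSum xs a a+b ^ N * (s + t) ^ N    ≡⟨ ^-distribʳ-* (ratioSum xs a a+b) _ N ⟨
    (ratioSum xs a a+b * (s + t)) ^ N      ∎) (^-monoˡ-≤ N le)

  total : R * (s + t) + R′ * (s + t) ≡ N * (s * π) + N * (t * π)
  total = begin-equality
    R * (s + t) + R′ * (s + t)     ≡⟨ *-distribʳ-+ (s + t) R R′ ⟨
    (R + R′) * (s + t)             ≡⟨ cong (_* (s + t)) (ratioSum-+ xs a b) ⟩
    N * π * (s + t)                ≡⟨ lemma N π s t ⟩
    N * (s * π) + N * (t * π)      ∎
    where
    lemma : ∀ n p s t → n * p * (s + t) ≡ n * (s * p) + n * (t * p)
    lemma = solve-∀

  absurd : 0 < R + R′ ⊎ 0 ≡ R + R′ → ⊥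
  -- Degenerate case: if both ratio sums vanish then `π` is 0, which forces s = t = 0, and the
  -- assumed failure would put a natural number below 0.
  absurd (inj₂ 0≡) = n≮0 (subst (κ * π <_) s+t≡0 fails)
    where
    π≡0 : π ≡ 0
    π≡0 = m*n≡0⇒n≡0 N (≡-sym (trans 0≡ (ratioSum-+ xs a b)))
      where
      m*n≡0⇒n≡0 : ∀ k {m} .{{_ : NonZero k}} → k * m ≡ 0 → m ≡ 0
      m*n≡0⇒n≡0 (suc k) {zero} _ = refl
    vanish : ∀ a′ s → s ^ N ≤ κ * ∏ xs a′ → (∀ x → a′ x ≤ a+b x) → s ≡ 0
    vanish a′ s h le = m^n≡0⇒m≡0 s N (n≤0⇒n≡0 (begin
      s ^ N         ≤⟨ h ⟩
      κ * ∏ xs a′   ≤⟨ *-monoʳ-≤ κ (∏-mono xs le) ⟩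
      κ * π         ≡⟨ trans (cong (κ *_) π≡0) (*-zeroʳ κ) ⟩
      0             ∎))
    s+t≡0 : (s + t) ^ N ≡ 0
    s+t≡0 rewrite vanish a s hs (λ x → m≤m+n _ _) | vanish b t ht (λ x → m≤n+m _ _) = 0^k≡0 N
  absurd (inj₁ pos) with m≤n⇒m<n∨m≡n (z≤n {R})
  ... | inj₁ 0<R = <-irrefl (≡-sym total) (+-mono-<-≤ (lower-< a s hs 0<R) (lower b t ht))
  ... | inj₂ 0≡R = <-irrefl (≡-sym total) (+-mono-≤-< (lower a s hs) (lower-< b t ht (subst (λ R → 0 < R + R′) (≡-sym 0≡R) pos)))

-- Induction on the points: `mahler` is superadditivity of the geometric mean, applied to the values
-- at the first point and the sums over the others.
holder : ∀ (fs : List (X → ℕ)) (xs : List X) κ F .{{_ : NonZero (length fs)}} →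
  (∀ x → F x ^ length fs ≤ κ * ∏ fs (λ f → f x)) → ∑ xs F ^ length fs ≤ κ * ∏ fs (∑ xs)
holder (f ∷ fs) []       κ F h = z≤n
holder fs       (x ∷ xs) κ F h =
  mahler fs (λ f → f x) (∑ xs) κ (F x) (∑ xs F) (h x) (holder fs xs κ F h)

count : (X → Bool) → List X → ℕ
count b xs = ∑ xs (ind ∘ b)

-- Factors that do not vary with the summation variable move into the constant `κ`. The varying ones
-- alone are too few for Hölder with exponent `d`; `p` copies of `o` make up the difference.
holder-partial : ∀ (es : List Y) (varies : Y → Bool) (g : Y → X → ℕ) (g′ : Y → ℕ) (xs : List X) (o : X → ℕ) p d κ F .{{_ : NonZero d}} →
  d ≡ count varies es + p →
  (∀ e → varies e ≡ true → ∑ xs (g e) ≤ g′ e) →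
  (∀ e → varies e ≡ false → ∀ x → g e x ≤ g′ e) →
  (∀ x → F x ^ d ≤ κ * (o x ^ p * ∏ es (λ e → g e x))) →
  ∑ xs F ^ d ≤ κ * (∑ xs o ^ p * ∏ es g′)
holder-partial {Y} {X} es varies g g′ xs o p d κ F d≡ var const h =
  subst (λ w → ∑ xs F ^ d ≤ κ * (w * ∏ es g′)) (∏-replicate p)
    (go es (List.replicate p o) κ (trans d≡ (cong (count varies es +_) (≡-sym (length-replicate p))))
        λ x → subst (λ w → F x ^ d ≤ κ * (w * ∏ es (λ e → g e x))) (≡-sym (∏-replicate p)) (h x))
  where
  open ≤-Reasoning
  ∏-replicate : ∀ p {φ : (X → ℕ) → ℕ} → ∏ (List.replicate p o) φ ≡ φ o ^ p
  ∏-replicate zero    = refl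
  ∏-replicate (suc p) {φ} = cong (φ o *_) (∏-replicate p)
  go : ∀ es fs κ → d ≡ count varies es + length fs →
    (∀ x → F x ^ d ≤ κ * (∏ fs (λ f → f x) * ∏ es (λ e → g e x))) →
    ∑ xs F ^ d ≤ κ * (∏ fs (∑ xs) * ∏ es g′)
  go [] fs κ refl h = subst (λ w → ∑ xs F ^ d ≤ κ * w) (≡-sym (*-identityʳ _))
    (holder fs xs κ F λ x → subst (λ w → F x ^ d ≤ κ * w) (*-identityʳ _) (h x))
  go (e ∷ es) fs κ d≡ h with varies e in eq
  ... | true  = begin
    ∑ xs F ^ d                                      ≤⟨ go es (g e ∷ fs) κ (trans d≡ (≡-sym (+-suc _ _))) (λ x → ≤-trans (h x) (≤-reflexive (cong (κ *_) (lemma (∏ fs (λ f → f x)) (g e x) _)))) ⟩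
    κ * (∑ xs (g e) * ∏ fs (∑ xs) * ∏ es g′)        ≤⟨ *-monoʳ-≤ κ (*-monoˡ-≤ (∏ es g′) (*-monoˡ-≤ (∏ fs (∑ xs)) (var e eq))) ⟩
    κ * (g′ e * ∏ fs (∑ xs) * ∏ es g′)              ≡⟨ cong (κ *_) (lemma (∏ fs (∑ xs)) (g′ e) _) ⟨
    κ * (∏ fs (∑ xs) * (g′ e * ∏ es g′))            ∎
    where
    lemma : ∀ a b c → a * (b * c) ≡ b * a * c
    lemma = solve-∀
  ... | false = begin
    ∑ xs F ^ d                                      ≤⟨ go es fs (κ * g′ e) d≡ (λ x → ≤-trans (h x) (≤-trans (*-monoʳ-≤ κ (*-monoʳ-≤ (∏ fs (λ f → f x)) (*-monoˡ-≤ (∏ es (λ e → g e x)) (const e eq x)))) (≤-reflexive (lemma κ (∏ fs (λ f → f x)) (g′ e) _)))) ⟩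
    κ * g′ e * (∏ fs (∑ xs) * ∏ es g′)              ≡⟨ lemma κ (∏ fs (∑ xs)) (g′ e) _ ⟨
    κ * (∏ fs (∑ xs) * (g′ e * ∏ es g′))            ∎
    where
    lemma : ∀ c a b z → c * (a * (b * z)) ≡ c * b * (a * z)
    lemma = solve-∀

-- The ordered product bound

length-filterᵇ : ∀ (b : X → Bool) xs → length (filterᵇ b xs) ≡ count b xs
length-filterᵇ b []       = refl
length-filterᵇ b (x ∷ xs) with b x
... | true  = cong suc (length-filterᵇ b xs)
... | false = length-filterᵇ b xs

∑-concatMap : ∀ (h : Y → List X) ys f → ∑ (concatMap h ys) f ≡ ∑ ys (λ y → ∑ (h y) f)
∑-concatMap h []       f = refl
∑-concatMap h (y ∷ ys) f = trans (∑-++ (h y) _ f) (cong (∑ (h y) f +_) (∑-concatMap h ys f))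

∑-allFin : ∀ n (f : Fin (suc n) → ℕ) → ∑ (allFin (suc n)) f ≡ f zero + ∑ (allFin n) (f ∘ suc)
∑-allFin n f = cong (f zero +_) (trans (cong (λ xs → ∑ xs f) (≡-sym (map-tabulate id suc))) (∑-map suc (allFin n) f))

∏-allFin : ∀ n (f : Fin (suc n) → ℕ) → ∏ (allFin (suc n)) f ≡ f zero * ∏ (allFin n) (f ∘ suc)
∏-allFin n f = cong (f zero *_) (trans (cong (λ xs → ∏ xs f) (≡-sym (map-tabulate id suc))) (∏-map suc (allFin n) f))

∑-allColourings : ∀ q n F → ∑ (allColourings q (suc n)) F ≡ ∑ (allFin q) (λ x → ∑ (allColourings q n) (F ∘ (x ∷_)))
∑-allColourings q n F = trans (∑-concatMap (λ x → map (x ∷_) (allColourings q n)) (allFin q) F)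
  (∑-cong (allFin q) λ x → ∑-map (x ∷_) (allColourings q n) F)

-- The head is summed out first, while the colours of the tail are still fixed. Lists therefore
-- carry the vertex order backwards, and the earlier neighbours of a vertex are its neighbours in
-- the tail.
sumOver : List (Fin n) → (Vec (Fin q) n → ℕ) → Vec (Fin q) n → ℕ
sumOver         []      F ρ = F ρ
sumOver {q = q} (k ∷ L) F ρ = sumOver L (λ σ → ∑ (allFin q) λ x → F (σ [ k ]≔ x)) ρ

sumOver-cong : ∀ (L : List (Fin n)) {F G : Vec (Fin q) n → ℕ} → (∀ σ → F σ ≡ G σ) → ∀ ρ → sumOver L F ρ ≡ sumOver L G ρ
sumOver-cong         []      h ρ = h ρ
sumOver-cong {q = q} (k ∷ L) h ρ = sumOver-cong L (λ σ → ∑-cong (allFin q) λ x → h _) ρ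

sumOver-map-suc : ∀ (L : List (Fin n)) F (y : Fin q) ρ → sumOver (map suc L) F (y ∷ ρ) ≡ sumOver L (F ∘ (y ∷_)) ρ
sumOver-map-suc []      F y ρ = refl
sumOver-map-suc (k ∷ L) F y ρ = sumOver-map-suc L _ y ρ

sumOver-allFin : ∀ n F (ρ : Vec (Fin q) n) → sumOver (allFin n) F ρ ≡ ∑ (allColourings q n) F
sumOver-allFin zero    F []      = ≡-sym (+-identityʳ _)
sumOver-allFin {q} (suc n) F (y ∷ ρ) = begin
  sumOver (List.tabulate suc) F₀ (y ∷ ρ)                ≡⟨ cong (λ L → sumOver L F₀ (y ∷ ρ)) (map-tabulate id suc) ⟨
  sumOver (map suc (allFin n)) F₀ (y ∷ ρ)                    ≡⟨ sumOver-map-suc (allFin n) F₀ y ρ ⟩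
  sumOver (allFin n) (λ σ → ∑ (allFin q) λ x → F (x ∷ σ)) ρ  ≡⟨ sumOver-allFin n _ ρ ⟩
  ∑ (allColourings q n) (λ σ → ∑ (allFin q) λ x → F (x ∷ σ)) ≡⟨ ∑-swap (allColourings q n) (allFin q) (λ σ x → F (x ∷ σ)) ⟩
  ∑ (allFin q) (λ x → ∑ (allColourings q n) (F ∘ (x ∷_)))    ≡⟨ ∑-allColourings q n F ⟨
  ∑ (allColourings q (suc n)) F                              ∎
  where
  open ≡-Reasoning
  F₀ : Vec (Fin q) (suc n) → ℕ
  F₀ σ = ∑ (allFin q) λ x → F (σ [ zero ]≔ x)

sumOver-↭ : ∀ {L L′ : List (Fin n)} → Unique L → L ↭ L′ → ∀ F (ρ : Vec (Fin q) n) → sumOver L F ρ ≡ sumOver L′ F ρ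
sumOver-↭ u       Perm.refl       F ρ = refl
sumOver-↭ (_ ∷ u) (Perm.prep x p) F ρ = sumOver-↭ u p _ ρ
sumOver-↭ {q = q} {L = _ ∷ _ ∷ L} ((j≢k ∷ _) ∷ (_ ∷ u)) (Perm.swap j k p) F ρ = trans
  (sumOver-cong L (λ σ → trans (∑-swap (allFin q) (allFin q) λ y x → F ((σ [ k ]≔ y) [ j ]≔ x))
                    (∑-cong (allFin q) λ x → ∑-cong (allFin q) λ y → cong F ([]≔-commutes σ k j (j≢k ∘ ≡-sym)))) ρ)
  (sumOver-↭ u p _ ρ)
sumOver-↭ u (Perm.trans p p′) F ρ = trans (sumOver-↭ u p F ρ) (sumOver-↭ (Unique-resp-↭ (setoid _) (↭⇒↭ₛ p) u) p′ F ρ)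

size : Vec Bool q → ℕ
size {q} A = ∑ (allFin q) (ind ∘ lookup A)

subsets : ∀ q → List (Vec Bool q)
subsets zero    = [] ∷ []
subsets (suc q) = map (false ∷_) (subsets q) ++ map (true ∷_) (subsets q)

∈-subsets : ∀ (A : Vec Bool q) → A ∈ subsets q
∈-subsets []          = here refl
∈-subsets (false ∷ A) = ∈-++⁺ˡ (∈-map⁺ _ (∈-subsets A))
∈-subsets {suc q} (true ∷ A)  = ∈-++⁺ʳ (map (false ∷_) (subsets q)) (∈-map⁺ _ (∈-subsets A))

⌊≟⌋-refl : ∀ (x : Fin n) → ⌊ x ≟ x ⌋ ≡ true
⌊≟⌋-refl x with x ≟ x
... | yes _ = refl
... | no ¬p = ⊥-elim (¬p refl)

infix 5 _⊃_
_⊃_ : Bool → ℕ → ℕ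
b ⊃ y = if b then y else 1

∏-ignores-update : ∀ (φ : Fin n → Fin q → ℕ) k L x ρ → All (k ≢_) L →
  ∏ L (λ u → φ u (lookup (ρ [ k ]≔ x) u)) ≡ ∏ L (λ u → φ u (lookup ρ u))
∏-ignores-update φ k []      x ρ []        = refl
∏-ignores-update φ k (u ∷ L) x ρ (k≢u ∷ h) =
  cong₂ _*_ (cong (φ u) (lookup∘updateAt′ u k (k≢u ∘ ≡-sym) ρ)) (∏-ignores-update φ k L x ρ h)

∏-⊃-none : ∀ b (φ : X → ℕ) L → count b L ≡ 0 → ∏ L (λ u → b u ⊃ φ u) ≡ 1
∏-⊃-none b φ []      h = refl
∏-⊃-none b φ (u ∷ L) h with b u
... | false = trans (+-identityʳ _) (∏-⊃-none b φ L h)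
... | true  with () ← h

∏-⊃-≡1 : ∀ (b : X → Bool) (φ : X → ℕ) L → (∀ u → u ∈ L → b u ≡ true → φ u ≡ 1) → ∏ L (λ u → b u ⊃ φ u) ≡ 1
∏-⊃-≡1 b φ []      h = refl
∏-⊃-≡1 b φ (u ∷ L) h with b u in eq
... | false = trans (+-identityʳ _) (∏-⊃-≡1 b φ L λ v v∈ → h v (there v∈))
... | true rewrite h u (here refl) eq = trans (+-identityʳ _) (∏-⊃-≡1 b φ L λ v v∈ → h v (there v∈))

∏-⊃-≡0 : ∀ (b : X → Bool) (φ : X → ℕ) L {u} → u ∈ L → b u ≡ true → φ u ≡ 0 → ∏ L (λ u → b u ⊃ φ u) ≡ 0
∏-⊃-≡0 b φ (u ∷ L) (here refl) bu φu rewrite bu | φu = refl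
∏-⊃-≡0 b φ (v ∷ L) (there u∈) bu φu = trans (cong ((b v ⊃ φ v) *_) (∏-⊃-≡0 b φ L u∈ bu φu)) (*-zeroʳ (b v ⊃ φ v))

≤1⇒≤^ : ∀ {y} p → y ≤ 1 → y ≤ y ^ p
≤1⇒≤^ p z≤n       = z≤n
≤1⇒≤^ p (s≤s z≤n) = ≤-reflexive (≡-sym (^-zeroˡ p))

∏≤1 : ∀ (xs : List X) {f} → (∀ x → f x ≤ 1) → ∏ xs f ≤ 1
∏≤1 xs h = ≤-trans (∏-mono xs h) (≤-reflexive (trans (∏-const xs 1) (^-zeroˡ (length xs))))

⊃-ind≤1 : ∀ b b′ → (b ⊃ ind b′) ≤ 1
⊃-ind≤1 false b′ = ≤-refl
⊃-ind≤1 true  b′ = ind≤1 b′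

-- For p ≥ 1, each term counts the colourings of K_{p,p} whose sides use only colours in A and only colours outside A.
K : (q p : ℕ) → ℕ
K q zero      = 1
K q p@(suc _) = ∑ (subsets q) λ A → (q ∸ size A) ^ p * size A ^ p

∑-complement : ∀ q (f g : Fin q → ℕ) → (∀ x → f x + g x ≡ 1) → ∑ (allFin q) f + ∑ (allFin q) g ≡ q
∑-complement q f g h = begin
  ∑ (allFin q) f + ∑ (allFin q) g       ≡⟨ ∑-+ (allFin q) f g ⟨
  ∑ (allFin q) (λ x → f x + g x)        ≡⟨ ∑-cong (allFin q) h ⟩
  ∑ (allFin q) (λ _ → 1)                ≡⟨ ∑-const (allFin q) 1 ⟩
  length (allFin q) * 1                 ≡⟨ *-identityʳ _ ⟩
  length (allFin q)                     ≡⟨ length-tabulate id ⟩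
  q                                     ∎
  where
  open ≡-Reasoning

module _ {n : ℕ} (q : ℕ) (G : Graph n) where

  private
    E : Fin n → Fin n → Bool
    E = adj G

  -- A factor Σ_{A ∈ family} weight A · Π_{u ∈ L, u ∼ vertex} [ρ u ∈ A] of the majorant of the partially
  -- summed colouring indicator; summing over the colour of u turns the indicator [ρ u ∈ A] into |A|.
  record Factor : Set where
    constructor factor
    field
      vertex : Fin n
      family : List (Vec Bool q)
      weight : Vec Bool q → ℕ
  open Factor

  value : Factor → List (Fin n) → Vec (Fin q) n → ℕ
  value (factor v 𝒜 w) L ρ = ∑ 𝒜 λ A → w A * ∏ L λ u → E v u ⊃ ind (lookup A (lookup ρ u))

  total : Factor → List (Fin n) → ℕ
  total (factor v 𝒜 w) L = ∑ 𝒜 λ A → w A * size A ^ count (E v) L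

  absorb : Fin n → Factor → Factor
  absorb k (factor v 𝒜 w) = factor v 𝒜 λ A → w A * (E v k ⊃ size A)

  allowed : Fin n → List (Fin n) → Vec (Fin q) n → Fin q → ℕ
  allowed k L ρ x = ∏ L λ u → E k u ⊃ ind (not ⌊ x ≟ lookup ρ u ⌋)

  properOn : List (Fin n) → Vec (Fin q) n → ℕ
  properOn []      ρ = 1
  properOn (k ∷ L) ρ = allowed k L ρ (lookup ρ k) * properOn L ρ

  -- `A` plays the set of colours forbidden to `k`, and the weight accounts for the `q ∸ size A`
  -- allowed ones. With no earlier neighbours, the sum over all subsets would be 2^q; a one-member
  -- family keeps it at `K q 0 = 1`.
  newFactor : Fin n → ℕ → Factor
  newFactor k zero      = factor k (replicate q false ∷ []) λ _ → 1
  newFactor k p@(suc _) = factor k (subsets q) λ A → (q ∸ size A) ^ p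

  backDegreeProduct : List (Fin n) → ℕ
  backDegreeProduct []      = 1
  backDegreeProduct (k ∷ L) = K q (count (E k) L) * backDegreeProduct L

  allowed≤1 : ∀ k L ρ x → allowed k L ρ x ≤ 1
  allowed≤1 k L ρ x = ∏≤1 L λ u → ⊃-ind≤1 (E k u) _

  properOn-update : ∀ k L ρ x → All (k ≢_) L → Unique L → properOn L (ρ [ k ]≔ x) ≡ properOn L ρ
  properOn-update k []      ρ x h u = refl
  properOn-update k (j ∷ L) ρ x (k≢j ∷ h) (_ ∷ u) = cong₂ _*_
    (trans (∏-ignores-update (λ u y → E j u ⊃ ind (not ⌊ lookup (ρ [ k ]≔ x) j ≟ y ⌋)) k L x ρ h)
             (cong (allowed j L ρ) (lookup∘updateAt′ j k (k≢j ∘ ≡-sym) ρ)))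
    (properOn-update k L ρ x h u)

  total-absorb : ∀ k L e → total (absorb k e) L ≡ total e (k ∷ L)
  total-absorb k L (factor v 𝒜 w) = ∑-cong 𝒜 λ A → pointwise (E v k) (w A) (size A)
    where
    pointwise : ∀ b w s → w * (b ⊃ s) * s ^ count (E v) L ≡ w * s ^ (ind b + count (E v) L)
    pointwise false w s = cong (_* s ^ count (E v) L) (*-identityʳ w)
    pointwise true  w s = *-assoc w s _

  total-new : ∀ k L → total (newFactor k (count (E k) L)) L ≡ K q (count (E k) L)
  total-new k L with count (E k) L in eq
  ... | zero  rewrite eq = refl
  ... | suc p rewrite eq = refl

  value-nonadjacent : ∀ k L e ρ x → All (k ≢_) L → E (vertex e) k ≡ false →
    value e (k ∷ L) (ρ [ k ]≔ x) ≡ value (absorb k e) L ρ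
  value-nonadjacent k L (factor v 𝒜 w) ρ x h nonadj rewrite nonadj = ∑-cong 𝒜 λ A →
    trans (cong (w A *_) (trans (+-identityʳ _) (∏-ignores-update (λ u y → E v u ⊃ ind (lookup A y)) k L x ρ h)))
            (cong (_* ∏ L λ u → E v u ⊃ ind (lookup A (lookup ρ u))) (≡-sym (*-identityʳ (w A))))

  value-adjacent : ∀ k L e ρ → All (k ≢_) L → E (vertex e) k ≡ true →
    ∑ (allFin q) (λ x → value e (k ∷ L) (ρ [ k ]≔ x)) ≡ value (absorb k e) L ρ
  value-adjacent k L (factor v 𝒜 w) ρ h isadj rewrite isadj = begin
    ∑ (allFin q) (λ x → ∑ 𝒜 λ A → w A * (ind (lookup A (lookup (ρ [ k ]≔ x) k)) * _))
      ≡⟨ ∑-cong (allFin q) (λ x → ∑-cong 𝒜 λ A → cong (w A *_) (cong₂ (λ y P → ind (lookup A y) * P)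
           (lookup∘updateAt k ρ) (∏-ignores-update (λ u y → E v u ⊃ ind (lookup A y)) k L x ρ h))) ⟩
    ∑ (allFin q) (λ x → ∑ 𝒜 λ A → w A * (ind (lookup A x) * P A))
      ≡⟨ ∑-swap (allFin q) 𝒜 (λ x A → w A * (ind (lookup A x) * P A)) ⟩
    ∑ 𝒜 (λ A → ∑ (allFin q) λ x → w A * (ind (lookup A x) * P A))
      ≡⟨ ∑-cong 𝒜 (λ A → trans (∑-*ˡ (allFin q) (w A) _) (trans (cong (w A *_) (∑-*ʳ (allFin q) (ind ∘ lookup A) (P A)))
           (≡-sym (*-assoc (w A) (size A) (P A))))) ⟩
    ∑ 𝒜 (λ A → w A * size A * P A) ∎
    where
    open ≡-Reasoning
    P : Vec Bool q → ℕ
    P A = ∏ L λ u → E v u ⊃ ind (lookup A (lookup ρ u))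

  -- One term of the sum suffices: for `A` the set of colours that the earlier neighbours of `k`
  -- actually forbid, all indicators are 1 and `q ∸ size A` bounds the number of allowed colours.
  value-new : ∀ k L ρ → let p = count (E k) L in ∑ (allFin q) (allowed k L ρ) ^ p ≤ value (newFactor k p) L ρ
  value-new k L ρ with count (E k) L in eq
  ... | zero  rewrite ∏-⊃-none (E k) (λ u → ind (lookup (replicate q false) (lookup ρ u))) L eq = ≤-refl
  ... | suc p = begin
    ∑ (allFin q) (allowed k L ρ) ^ suc p             ≤⟨ ^-monoˡ-≤ (suc p) avail≤ ⟩
    (q ∸ size A) ^ suc p                             ≡⟨ *-identityʳ _ ⟨
    (q ∸ size A) ^ suc p * 1                         ≡⟨ cong ((q ∸ size A) ^ suc p *_) (∏-⊃-≡1 (E k) (λ u → ind (lookup A (lookup ρ u))) L used) ⟨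
    (q ∸ size A) ^ suc p * ∏ L (λ u → E k u ⊃ ind (lookup A (lookup ρ u)))
                                                     ≤⟨ ∈⇒≤∑ (λ A → (q ∸ size A) ^ suc p * ∏ L (λ u → E k u ⊃ ind (lookup A (lookup ρ u)))) (∈-subsets A) ⟩
    value (newFactor k (suc p)) L ρ                  ∎
    where
    open ≤-Reasoning
    A : Vec Bool q
    A = tabulate λ x → allowed k L ρ x ≡ᵇ 0
    avail≤ : ∑ (allFin q) (allowed k L ρ) ≤ q ∸ size A
    avail≤ = m+n≤o⇒m≤o∸n _ (≤-reflexive (∑-complement q (allowed k L ρ) (ind ∘ lookup A)
      λ x → trans (cong (λ b → allowed k L ρ x + ind b) (lookup∘tabulate _ x)) (complement (allowed≤1 k L ρ x))))
      where
      complement : ∀ {y} → y ≤ 1 → y + ind (y ≡ᵇ 0) ≡ 1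
      complement z≤n       = refl
      complement (s≤s z≤n) = refl
    used : ∀ u → u ∈ L → E k u ≡ true → ind (lookup A (lookup ρ u)) ≡ 1
    used u u∈L isadj rewrite lookup∘tabulate (λ x → allowed k L ρ x ≡ᵇ 0) (lookup ρ u)
      | ∏-⊃-≡0 (E k) (λ w → ind (not ⌊ lookup ρ u ≟ lookup ρ w ⌋)) L u∈L isadj (cong (ind ∘ not) (⌊≟⌋-refl (lookup ρ u))) = refl

  -- `M` holds one factor for each vertex already summed out. The degree hypothesis is the invariant
  -- that makes Hölder with exponent `d` fit: the colour of u occurs in exactly the factors of its
  -- summed neighbours, and its neighbours in `L` supply the remaining exponent, filled by copies of
  -- the indicator `allowed`, whose sum becomes the new factor.
  ordered-bound : ∀ d .{{_ : NonZero d}} L M F → Unique L →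
    (∀ u → u ∈ L → count (E u ∘ vertex) M + count (E u) L ≡ d) →
    (∀ ρ → F ρ ^ d ≤ properOn L ρ * ∏ M (λ e → value e L ρ)) →
    ∀ ρ → sumOver L F ρ ^ d ≤ ∏ M (λ e → total e L) * backDegreeProduct L
  ordered-bound d [] M F u deg h ρ = ≤-trans (h ρ) (≤-reflexive (*-comm 1 (∏ M λ e → total e [])))
  ordered-bound d (k ∷ L) M F (k∉L ∷ u) deg h ρ = begin
    sumOver L F′ ρ ^ d
      ≤⟨ ordered-bound d L (newFactor k p ∷ map (absorb k) M) F′ u deg′ h′ ρ ⟩
    total (newFactor k p) L * ∏ (map (absorb k) M) (λ e → total e L) * backDegreeProduct L
      ≡⟨ cong (_* backDegreeProduct L) (cong₂ _*_ (total-new k L)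
           (trans (∏-map (absorb k) M (λ e → total e L)) (∏-cong M (total-absorb k L)))) ⟩
    K q p * ∏ M (λ e → total e (k ∷ L)) * backDegreeProduct L
      ≡⟨ lemma (K q p) (∏ M (λ e → total e (k ∷ L))) (backDegreeProduct L) ⟩
    ∏ M (λ e → total e (k ∷ L)) * (K q p * backDegreeProduct L) ∎
    where
    open ≤-Reasoning
    p  = count (E k) L
    F′ : Vec (Fin q) n → ℕ
    F′ σ = ∑ (allFin q) λ x → F (σ [ k ]≔ x)
    lemma : ∀ a b c → a * b * c ≡ b * (a * c)
    lemma = solve-∀
    vertex-newFactor : ∀ p → vertex (newFactor k p) ≡ k
    vertex-newFactor zero    = refl
    vertex-newFactor (suc p) = refl
    deg′ : ∀ u → u ∈ L → count (E u ∘ vertex) (newFactor k p ∷ map (absorb k) M) + count (E u) L ≡ d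
    deg′ u u∈L = trans (cong₂ (λ v c → ind (E u v) + c + count (E u) L) (vertex-newFactor p) (∑-map (absorb k) M _))
      (trans (lemma′ (ind (E u k)) _ _) (deg u (there u∈L)))
      where
      lemma′ : ∀ a b c → a + b + c ≡ b + (a + c)
      lemma′ = solve-∀
    d≡ : d ≡ count (E k ∘ vertex) M + p
    d≡ = trans (≡-sym (deg k (here refl))) (cong (λ b → count (E k ∘ vertex) M + (ind b + p)) (loopless G k))
    h′ : ∀ σ → F′ σ ^ d ≤ properOn L σ * (value (newFactor k p) L σ * ∏ (map (absorb k) M) (λ e → value e L σ))
    h′ σ = begin
      F′ σ ^ d
        ≤⟨ holder-partial M (E k ∘ vertex) (λ e x → value e (k ∷ L) (σ [ k ]≔ x)) (λ e → value (absorb k e) L σ) (allFin q)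
             (allowed k L σ) p d (properOn L σ) (λ x → F (σ [ k ]≔ x)) d≡
             (λ e a → ≤-reflexive (value-adjacent k L e σ k∉L (trans (Graph.sym G (vertex e) k) a)))
             (λ e a x → ≤-reflexive (value-nonadjacent k L e σ x k∉L (trans (Graph.sym G (vertex e) k) a)))
             (λ x → ≤-trans (h (σ [ k ]≔ x)) (rearrange x)) ⟩
      properOn L σ * (∑ (allFin q) (allowed k L σ) ^ p * ∏ M (λ e → value (absorb k e) L σ))
        ≤⟨ *-monoʳ-≤ (properOn L σ) (*-mono-≤ (value-new k L σ) (≤-reflexive (≡-sym (∏-map (absorb k) M λ e → value e L σ)))) ⟩
      properOn L σ * (value (newFactor k p) L σ * ∏ (map (absorb k) M) (λ e → value e L σ)) ∎
      where
      rearrange : ∀ x → properOn (k ∷ L) (σ [ k ]≔ x) * ∏ M (λ e → value e (k ∷ L) (σ [ k ]≔ x)) ≤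
                        properOn L σ * (allowed k L σ x ^ p * ∏ M (λ e → value e (k ∷ L) (σ [ k ]≔ x)))
      rearrange x = begin
        allowed k L τ (lookup τ k) * properOn L τ * V
          ≡⟨ cong₂ (λ a b → a * b * V) (trans (cong (allowed k L τ) (lookup∘updateAt k σ))
               (∏-ignores-update (λ u y → E k u ⊃ ind (not ⌊ x ≟ y ⌋)) k L x σ k∉L)) (properOn-update k L σ x k∉L u) ⟩
        allowed k L σ x * properOn L σ * V
          -- A 0/1 indicator is at most its `p`-th power, so the single copy at hand can serve as
          -- the `p` copies that Hölder asks for.
          ≤⟨ *-monoˡ-≤ V (*-monoˡ-≤ (properOn L σ) (≤1⇒≤^ p (allowed≤1 k L σ x))) ⟩
        allowed k L σ x ^ p * properOn L σ * V
          ≡⟨ lemma (allowed k L σ x ^ p) (properOn L σ) V ⟩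
        properOn L σ * (allowed k L σ x ^ p * V) ∎
        where
        τ = σ [ k ]≔ x
        V = ∏ M (λ e → value e (k ∷ L) τ)

-- Sizes of colour sets

and-map⇒ : ∀ (p : X → Bool) {xs x} → and (map p xs) ≡ true → x ∈ xs → p x ≡ true
and-map⇒ p {x ∷ xs} h (here refl) with p x
... | true  = refl
and-map⇒ p {x ∷ xs} h (there x∈)  with p x
... | true  = and-map⇒ p h x∈

isProper⇒ : ∀ (G : Graph n) (f : Vec (Fin q) n) → isProper G f ≡ true → ∀ u v → adj G u v ≡ true →
  ind (not ⌊ lookup f u ≟ lookup f v ⌋) ≡ 1
isProper⇒ {n} G f h u v adjacent = cong ind (trans (cong (λ b → not b ∨ not ⌊ lookup f u ≟ lookup f v ⌋) (≡-sym adjacent))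
  (and-map⇒ _ (and-map⇒ _ h (∈-allFin u)) (∈-allFin v)))

∑-↭ : ∀ {L L′ : List X} → L ↭ L′ → ∀ f → ∑ L f ≡ ∑ L′ f
∑-↭ p f = sum-↭ (map⁺ f p)

length-allFin : ∀ n → length (allFin n) ≡ n
length-allFin n = length-tabulate id

count-adj : ∀ {n d} (G : Graph n) → Regular d G → ∀ {L} → L ↭ allFin n → ∀ u → count (adj G u) L ≡ d
count-adj G reg p u = trans (∑-↭ p _) (trans (≡-sym (length-filterᵇ (adj G u) (allFin _))) (reg u))

properOn≡1 : ∀ (G : Graph n) (f : Vec (Fin q) n) → isProper G f ≡ true → ∀ L → properOn q G L f ≡ 1
properOn≡1 G f h []      = refl
properOn≡1 G f h (k ∷ L) = cong₂ _*_ (∏-⊃-≡1 (adj G k) _ L λ u _ → isProper⇒ G f h k u) (properOn≡1 G f h L)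

colourings-ordered-bound : ∀ {n} q d .{{_ : NonZero d}} (G : Graph n) → Fin q → Regular d G → ∀ {L} → L ↭ allFin n →
  c q G ^ d ≤ backDegreeProduct q G L
colourings-ordered-bound {n} q d G x₀ reg {L} p = begin
  c q G ^ d                                   ≡⟨ cong (_^ d) (length-filterᵇ (isProper G) (allColourings q n)) ⟩
  ∑ (allColourings q n) F ^ d                 ≡⟨ cong (_^ d) (sumOver-allFin n F ρ) ⟨
  sumOver (allFin n) F ρ ^ d                  ≡⟨ cong (_^ d) (sumOver-↭ (allFin⁺ n) (↭-sym p) F ρ) ⟩
  sumOver L F ρ ^ d                           ≤⟨ ordered-bound q G d L [] F (Unique-resp-↭ (setoid _) (↭⇒↭ₛ (↭-sym p)) (allFin⁺ n))
                                                   (λ u _ → count-adj G reg p u) indicator ρ ⟩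
  1 * backDegreeProduct q G L                 ≡⟨ *-identityˡ _ ⟩
  backDegreeProduct q G L                     ∎
  where
  open ≤-Reasoning
  F : Vec (Fin q) n → ℕ
  F = ind ∘ isProper G
  ρ : Vec (Fin q) n
  ρ = replicate n x₀
  indicator : ∀ σ → F σ ^ d ≤ properOn q G L σ * 1
  indicator σ with isProper G σ in eq
  ... | true  = ≤-reflexive (trans (^-zeroˡ d) (≡-sym (cong (_* 1) (properOn≡1 G σ eq L))))
  ... | false = ≤-trans (≤-reflexive (0^k≡0 d)) z≤n

nC0≡1 : ∀ n → n C 0 ≡ 1
nC0≡1 n = trans (nCk≡nC[n∸k] {0} {n} z≤n) (nCn≡1 n)

k≤n⇒1≤nCk : ∀ n k → k ≤ n → 1 ≤ n C k
k≤n⇒1≤nCk n       zero    _         = ≤-reflexive (≡-sym (nC0≡1 n))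
k≤n⇒1≤nCk (suc n) (suc k) (s≤s k≤n) =
  ≤-trans (k≤n⇒1≤nCk n k k≤n) (≤-trans (m≤m+n _ _) (≤-reflexive (nCk+nC[k+1]≡[n+1]C[k+1] n k)))

2≤nCk : ∀ {n k} → 0 < k → k < n → 2 ≤ n C k
2≤nCk {suc n} {suc k} _ (s≤s k<n) = ≤-trans (+-mono-≤ (k≤n⇒1≤nCk n k (<⇒≤ k<n)) (k≤n⇒1≤nCk n (suc k) k<n))
  (≤-reflexive (nCk+nC[k+1]≡[n+1]C[k+1] n k))

size-∷ : ∀ b (A : Vec Bool q) → size (b ∷ A) ≡ ind b + size A
size-∷ b A = ∑-allFin _ (ind ∘ lookup (b ∷ A))

∑-subsets : ∀ q (f : ℕ → ℕ) → ∑ (subsets (suc q)) (f ∘ size) ≡ ∑ (subsets q) (f ∘ size) + ∑ (subsets q) (f ∘ suc ∘ size)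
∑-subsets q f = trans (∑-++ (map (false ∷_) (subsets q)) _ _) (cong₂ _+_
  (trans (∑-map (false ∷_) (subsets q) _) (∑-cong (subsets q) λ A → cong f (size-∷ false A)))
  (trans (∑-map (true ∷_) (subsets q) _) (∑-cong (subsets q) λ A → cong f (size-∷ true A))))

count-subsets : ∀ q k → ∑ (subsets q) (λ A → ind (size A ≡ᵇ k)) ≡ q C k
count-subsets zero    zero    = refl
count-subsets zero    (suc k) = ≡-sym (k>n⇒nCk≡0 {0} {suc k} (s≤s z≤n))
count-subsets (suc q) zero    = trans (∑-subsets q (λ a → ind (a ≡ᵇ 0))) (trans
  (cong₂ _+_ (trans (count-subsets q 0) (nC0≡1 q)) (∑-zero (subsets q))) (≡-sym (nC0≡1 (suc q))))
count-subsets (suc q) (suc k) = trans (∑-subsets q (λ a → ind (a ≡ᵇ suc k))) (trans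
  (cong₂ _+_ (count-subsets q (suc k)) (count-subsets q k)) (trans (+-comm (q C suc k) _) (nCk+nC[k+1]≡[n+1]C[k+1] q k)))

length-subsets : ∀ q → length (subsets q) ≡ 2 ^ q
length-subsets zero    = refl
length-subsets (suc q) = trans (length-++ (map (false ∷_) (subsets q))) (cong₂ _+_
  (trans (length-map _ (subsets q)) (length-subsets q))
  (trans (length-map _ (subsets q)) (trans (length-subsets q) (≡-sym (+-identityʳ _)))))

size≤ : ∀ (A : Vec Bool q) → size A ≤ q
size≤ {q} A = ≤-trans (∑-mono (allFin q) λ x → ind≤1 (lookup A x))
  (≤-reflexive (trans (∑-const (allFin q) 1) (trans (*-identityʳ _) (length-allFin q))))

data Halves (q : ℕ) : Set where
  even : (q % 2) ≡ 0 → q ≡ q / 2 + q / 2 → q ∸ q / 2 ≡ q / 2 → Halves q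
  odd  : (q % 2) ≡ 1 → q ≡ q / 2 + suc (q / 2) → q ∸ q / 2 ≡ suc (q / 2) → Halves q

halves : ∀ q → Halves q
halves q with q % 2 in eq | m≡m%n+[m/n]*n q 2 | m%n<n q 2
... | 0 | h | _ = even eq q≡ (trans (cong (_∸ q / 2) q≡) (m+n∸m≡n (q / 2) _))
  where
  double : ∀ h → 0 + h * 2 ≡ h + h
  double = solve-∀
  q≡ : q ≡ q / 2 + q / 2
  q≡ = trans h (double (q / 2))
... | 1 | h | _ = odd eq q≡ (trans (cong (_∸ q / 2) q≡) (m+n∸m≡n (q / 2) _))
  where
  double : ∀ h → 1 + h * 2 ≡ h + (1 + h)
  double = solve-∀
  q≡ : q ≡ q / 2 + suc (q / 2)
  q≡ = trans h (double (q / 2))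
... | suc (suc _) | h | lt = ⊥-elim (<⇒≱ (lt) (s≤s (s≤s z≤n)))

1≤q/2 : ∀ {q} → 3 ≤ q → 1 ≤ q / 2
1≤q/2 {q} 3≤q = ≰⇒> λ h≤0 → <⇒≱ 3≤q (small h≤0)
  where
  small : q / 2 ≤ 0 → q ≤ 2
  small h≤0 with halves q
  ... | even _ e _ = ≤-trans (≤-trans (≤-reflexive e) (+-mono-≤ h≤0 h≤0)) z≤n
  ... | odd  _ e _ = ≤-trans (≤-trans (≤-reflexive e) (+-mono-≤ h≤0 (s≤s h≤0))) (s≤s z≤n)

2≤q∸q/2 : ∀ {q} → 3 ≤ q → 2 ≤ q ∸ q / 2
2≤q∸q/2 {q} 3≤q with halves q
... | odd  _ _ e  = ≤-trans (s≤s (1≤q/2 3≤q)) (≤-reflexive (≡-sym e))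
... | even _ e e′ = subst (2 ≤_) (≡-sym e′) (≰⇒> λ h≤1 → <⇒≱ 3≤q (≤-trans (≤-reflexive e) (+-mono-≤ h≤1 h≤1)))

q/2≤q∸q/2 : ∀ q → q / 2 ≤ q ∸ q / 2
q/2≤q∸q/2 q with halves q
... | even _ _ e = ≤-reflexive (≡-sym e)
... | odd  _ _ e = ≤-trans (n≤1+n _) (≤-reflexive (≡-sym e))

q/2<q : ∀ {q} → 3 ≤ q → q / 2 < q
q/2<q {q} 3≤q with q / 2 ≤? q ∸ 1
... | yes h = ≤-trans (s≤s h) (≤-reflexive (m+[n∸m]≡n {1} (≤-trans (s≤s z≤n) 3≤q)))
... | no h  = ⊥-elim (<⇒≱ (2≤q∸q/2 3≤q) (≤-trans (≤-reflexive (m≤n⇒m∸n≡0 q≤)) z≤n))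
  where
  q≤ : q ≤ q / 2
  q≤ = ≤-trans (m≤n+m∸n q 1) (≰⇒> h)

2≤η : ∀ {q} → 3 ≤ q → 2 ≤ η q
2≤η 3≤q = *-mono-≤ (1≤q/2 3≤q) (2≤q∸q/2 3≤q)

2≤m : ∀ {q} → 3 ≤ q → 2 ≤ m q
2≤m {q} 3≤q with (q % 2) ≡ᵇ 0
... | true  = 2≤nCk (1≤q/2 3≤q) (q/2<q 3≤q)
... | false = ≤-trans (2≤nCk (1≤q/2 3≤q) (q/2<q 3≤q)) (m≤m+n _ _)

-- With j = u - x, equal sums give y = v + j, so the products differ by j(v - x).
product-increases : ∀ {x y u v} → x + y ≡ u + v → x < u → u ≤ v → x * y < u * v
product-increases {x} {y} {u} {v} e x<u u≤v = subst₂ (λ y u → x * y < u * v) (≡-sym y≡) u≡ (begin-strict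
  x * (v + j)     ≡⟨ *-distribˡ-+ x v j ⟩
  x * v + x * j   <⟨ +-monoʳ-< (x * v) (*-monoˡ-< j {{>-nonZero (m<n⇒0<n∸m x<u)}} (<-≤-trans x<u u≤v)) ⟩
  x * v + v * j   ≡⟨ lemma x v j ⟩
  (x + j) * v     ∎)
  where
  open ≤-Reasoning
  j = u ∸ x
  u≡ : x + j ≡ u
  u≡ = m+[n∸m]≡n (<⇒≤ x<u)
  y≡ : y ≡ v + j
  y≡ = +-cancelˡ-≡ x _ _ (trans e (trans (cong (_+ v) (≡-sym u≡)) (lemma′ x j v)))
    where
    lemma′ : ∀ x j v → x + j + v ≡ x + (v + j)
    lemma′ = solve-∀
  lemma : ∀ x v j → x * v + v * j ≡ (x + j) * v
  lemma = solve-∀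

ind-≡ᵇ-refl : ∀ a → ind (a ≡ᵇ a) ≡ 1
ind-≡ᵇ-refl zero    = refl
ind-≡ᵇ-refl (suc a) = ind-≡ᵇ-refl a

module _ (q : ℕ) where
  private
    h  = q / 2
    h′ = q ∸ q / 2

    h+h′≡q : h + h′ ≡ q
    h+h′≡q with halves q
    ... | even _ e e′ = trans (cong (h +_) e′) (≡-sym e)
    ... | odd  _ e e′ = trans (cong (h +_) e′) (≡-sym e)

    h′≤1+h : h′ ≤ suc h
    h′≤1+h with halves q
    ... | even _ _ e = ≤-trans (≤-reflexive e) (n≤1+n _)
    ... | odd  _ _ e = ≤-reflexive e

  -- Marks the sizes that maximise a(q - a). For even q the two middle sizes coincide and must be
  -- counted once, as in the definition of `m`.
  multiplicity : ℕ → ℕ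
  multiplicity a = if (q % 2) ≡ᵇ 0 then ind (a ≡ᵇ h) else ind (a ≡ᵇ h) + ind (a ≡ᵇ h′)

  ∑-multiplicity : ∑ (subsets q) (multiplicity ∘ size) ≡ m q
  ∑-multiplicity with (q % 2) ≡ᵇ 0
  ... | true  = count-subsets q h
  ... | false = trans (∑-+ (subsets q) _ _) (cong₂ _+_ (count-subsets q h) (count-subsets q h′))

  split-product : ∀ a → a ≤ q → ((q ∸ a) * a ≡ η q × 1 ≤ multiplicity a) ⊎ (q ∸ a) * a < η q
  split-product a a≤q with <-cmp a h
  ... | tri< a<h _ _ = inj₂ (subst (_< η q) (*-comm a _) (product-increases (trans (m+[n∸m]≡n a≤q) (≡-sym h+h′≡q)) a<h (q/2≤q∸q/2 q)))
  ... | tri≈ _ refl _ = inj₁ (*-comm h′ h , once)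
    where
    once : 1 ≤ multiplicity h
    once with (q % 2) ≡ᵇ 0
    ... | true  = ≤-reflexive (≡-sym (ind-≡ᵇ-refl h))
    ... | false = ≤-trans (≤-reflexive (≡-sym (ind-≡ᵇ-refl h))) (m≤m+n _ _)
  ... | tri> _ _ h<a with m≤n⇒m<n∨m≡n (≤-trans h′≤1+h h<a)
  ...   | inj₁ h′<a = inj₂ (product-increases (trans (m∸n+n≡m a≤q) (≡-sym h+h′≡q)) below (q/2≤q∸q/2 q))
    where
    below : q ∸ a < h
    below = ≤-trans (∸-monoʳ-< h′<a a≤q) (≤-reflexive (trans (cong (_∸ h′) (≡-sym h+h′≡q)) (m+n∸n≡m h h′)))
  ...   | inj₂ refl = inj₁ (cong (_* h′) (trans (cong (_∸ h′) (≡-sym h+h′≡q)) (m+n∸n≡m h h′)) , once)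
    where
    once : 1 ≤ multiplicity h′
    once with halves q
    ... | even _ _ e = ⊥-elim (<-irrefl (≡-sym e) h<a)
    ... | odd  e _ _ rewrite e = ≤-trans (≤-reflexive (≡-sym (ind-≡ᵇ-refl h′))) (m≤n+m _ _)

  split-product≤η : ∀ a → a ≤ q → (q ∸ a) * a ≤ η q
  split-product≤η a a≤q with split-product a a≤q
  ... | inj₁ (e , _) = ≤-reflexive e
  ... | inj₂ lt      = <⇒≤ lt

  K≤2^q*η^p : ∀ p → K q p ≤ 2 ^ q * η q ^ p
  K≤2^q*η^p zero      = ≤-trans (1≤^ {2} q (s≤s z≤n)) (≤-reflexive (≡-sym (*-identityʳ _)))
  K≤2^q*η^p p@(suc _) = begin
    ∑ (subsets q) (λ A → (q ∸ size A) ^ p * size A ^ p)  ≡⟨ ∑-cong (subsets q) (λ A → ^-distribʳ-* (q ∸ size A) (size A) p) ⟨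
    ∑ (subsets q) (λ A → ((q ∸ size A) * size A) ^ p)    ≤⟨ ∑-mono (subsets q) (λ A → ^-monoˡ-≤ p (split-product≤η (size A) (size≤ A))) ⟩
    ∑ (subsets q) (λ _ → η q ^ p)                        ≡⟨ ∑-const (subsets q) (η q ^ p) ⟩
    length (subsets q) * η q ^ p                         ≡⟨ cong (_* η q ^ p) (length-subsets q) ⟩
    2 ^ q * η q ^ p                                      ∎
    where open ≤-Reasoning

  -- For a set that is not balanced, the integer (q - |A|)|A| is at most η - 1, so its `p`-th power
  -- is exponentially smaller than η^p.
  K≤m*η^p+ : ∀ p .{{_ : NonZero p}} → K q p ≤ m q * η q ^ p + 2 ^ q * (η q ∸ 1) ^ p
  K≤m*η^p+ p@(suc _) = begin
    ∑ (subsets q) (λ A → (q ∸ size A) ^ p * size A ^ p)  ≤⟨ ∑-mono (subsets q) (λ A → term (size A) (size≤ A)) ⟩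
    ∑ (subsets q) (λ A → multiplicity (size A) * η q ^ p + (η q ∸ 1) ^ p)
                                                         ≡⟨ ∑-+ (subsets q) _ _ ⟩
    ∑ (subsets q) (λ A → multiplicity (size A) * η q ^ p) + ∑ (subsets q) (λ _ → (η q ∸ 1) ^ p)
                                                         ≡⟨ cong₂ _+_ (trans (∑-*ʳ (subsets q) _ (η q ^ p)) (cong (_* η q ^ p) ∑-multiplicity))
                                                              (trans (∑-const (subsets q) _) (cong (_* (η q ∸ 1) ^ p) (length-subsets q))) ⟩
    m q * η q ^ p + 2 ^ q * (η q ∸ 1) ^ p                ∎
    where
    open ≤-Reasoning
    term : ∀ a → a ≤ q → (q ∸ a) ^ p * a ^ p ≤ multiplicity a * η q ^ p + (η q ∸ 1) ^ p
    term a a≤q with split-product a a≤q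
    ... | inj₁ (e , 1≤) = begin
      (q ∸ a) ^ p * a ^ p                         ≡⟨ ^-distribʳ-* (q ∸ a) a p ⟨
      ((q ∸ a) * a) ^ p                           ≡⟨ cong (_^ p) e ⟩
      η q ^ p                                     ≡⟨ *-identityˡ _ ⟨
      1 * η q ^ p                                 ≤⟨ *-monoˡ-≤ (η q ^ p) 1≤ ⟩
      multiplicity a * η q ^ p                    ≤⟨ m≤m+n _ _ ⟩
      multiplicity a * η q ^ p + (η q ∸ 1) ^ p    ∎
    ... | inj₂ lt = begin
      (q ∸ a) ^ p * a ^ p                         ≡⟨ ^-distribʳ-* (q ∸ a) a p ⟨
      ((q ∸ a) * a) ^ p                           ≤⟨ ^-monoˡ-≤ p (m+n≤o⇒m≤o∸n ((q ∸ a) * a) {1} (≤-trans (≤-reflexive (+-comm ((q ∸ a) * a) 1)) lt)) ⟩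
      (η q ∸ 1) ^ p                               ≤⟨ m≤n+m _ _ ⟩
      multiplicity a * η q ^ p + (η q ∸ 1) ^ p    ∎

-- Graphs with a large independent set

^-normalize : ∀ a k l o → k * l ≡ o → (a ^ k) ^ l ≡ a ^ o
^-normalize a k l o e = trans (^-*-assoc a k l) (cong (a ^_) e)

^-monoʳ : ∀ {a} → 1 ≤ a → ∀ {k l} → k ≤ l → a ^ k ≤ a ^ l
^-monoʳ {a} 1≤a = ^-monoʳ-≤ a {{>-nonZero 1≤a}}

module _ {q : ℕ} (3≤q : 3 ≤ q) where

  private
    1≤η : 1 ≤ η q
    1≤η = ≤-trans (s≤s z≤n) (2≤η 3≤q)
    1≤m : 1 ≤ m q
    1≤m = ≤-trans (s≤s z≤n) (2≤m 3≤q)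

  -- From this exponent on, Bernoulli makes all unbalanced sets together contribute at most η^p /
  -- (2s) to `K`.
  threshold : ℕ → ℕ
  threshold s = 2 ^ q * (2 * s) * η q

  -- With t = 2s the unbalanced sets add at most η^p / t, so K ≤ (1 + 1/t) m η^p. Raised to the
  -- power s, the error (1 + 1/t)^s is at most 2 ≤ m, which is the extra factor in `m q ^ suc s`.
  K-large : ∀ s p .{{_ : NonZero p}} .{{_ : NonZero s}} → threshold s ≤ p → K q p ^ s ≤ m q ^ suc s * (η q ^ p) ^ s
  K-large s p P≤p = *-cancelˡ-≤ (t ^ s) {{m^n≢0 t s {{t≢0}}}} (begin
    t ^ s * K q p ^ s                        ≡⟨ ^-distribʳ-* t (K q p) s ⟨
    (t * K q p) ^ s                          ≤⟨ ^-monoˡ-≤ s tK≤ ⟩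
    (suc t * (m q * ηp)) ^ s                 ≡⟨ trans (^-distribʳ-* (suc t) _ s) (cong (suc t ^ s *_) (^-distribʳ-* (m q) ηp s)) ⟩
    suc t ^ s * (m q ^ s * ηp ^ s)           ≤⟨ *-monoˡ-≤ _ (≤-trans (power-growth≤2 t s {{t≢0}} ≤-refl) (*-monoˡ-≤ (t ^ s) (2≤m 3≤q))) ⟩
    m q * t ^ s * (m q ^ s * ηp ^ s)         ≡⟨ lemma (m q) (t ^ s) (m q ^ s) (ηp ^ s) ⟩
    t ^ s * (m q ^ suc s * ηp ^ s)           ∎)
    where
    open ≤-Reasoning
    t  = 2 * s
    ηp = η q ^ p
    a  = η q ∸ 1
    t≢0 : NonZero t
    t≢0 = m*n≢0 2 s
    1+a≡η : suc a ≡ η q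
    1+a≡η = m+[n∸m]≡n {1} 1≤η
    a≢0 : NonZero a
    a≢0 = >-nonZero (m+n≤o⇒m≤o∸n 1 {1} (2≤η 3≤q))
    lemma : ∀ m t x y → m * t * (x * y) ≡ t * (m * x * y)
    lemma = solve-∀
    tail≤ : 2 ^ q * t * a ^ p ≤ ηp
    tail≤ = subst (λ b → 2 ^ q * t * a ^ p ≤ b ^ p) 1+a≡η (power-growth a p (2 ^ q * t) {{a≢0}} (begin
      2 ^ q * t * a       ≤⟨ *-monoʳ-≤ (2 ^ q * t) (m∸n≤m (η q) 1) ⟩
      threshold s         ≤⟨ P≤p ⟩
      p                   ≤⟨ m≤n+m p a ⟩
      a + p               ∎))
    tK≤ : t * K q p ≤ suc t * (m q * ηp)
    tK≤ = begin
      t * K q p                                ≤⟨ *-monoʳ-≤ t (K≤m*η^p+ q p) ⟩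
      t * (m q * ηp + 2 ^ q * a ^ p)           ≡⟨ lemma′ t (m q * ηp) (2 ^ q) (a ^ p) ⟩
      2 ^ q * t * a ^ p + t * (m q * ηp)       ≤⟨ +-monoˡ-≤ _ (≤-trans tail≤ (m≤n*m ηp (m q) {{>-nonZero 1≤m}})) ⟩
      suc t * (m q * ηp)                       ∎
      where
      lemma′ : ∀ t x y z → t * (x + y * z) ≡ y * t * z + t * x
      lemma′ = solve-∀

  -- A vertex with few back-neighbours costs up to 2^q instead of m; this is charged to its w forward neighbours.
  K-pointwise : ∀ s d .{{_ : NonZero s}} → 2 * threshold s ≤ d → ∀ p w → p + w ≡ d →
    K q p ^ (s * d) ≤ (η q ^ (s * d)) ^ p * m q ^ (suc s * d) * (m q ^ (2 * (q * s))) ^ w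
  K-pointwise s d 2P≤d p w p+w≡d with threshold s ≤? p
  ... | yes P≤p = begin
    K q p ^ (s * d)                               ≡⟨ ^-*-assoc (K q p) s d ⟨
    (K q p ^ s) ^ d                               ≤⟨ ^-monoˡ-≤ d (K-large s p {{p≢0}} P≤p) ⟩
    (m q ^ suc s * (η q ^ p) ^ s) ^ d             ≡⟨ ^-distribʳ-* (m q ^ suc s) _ d ⟩
    (m q ^ suc s) ^ d * ((η q ^ p) ^ s) ^ d       ≡⟨ cong₂ _*_ (^-*-assoc (m q) (suc s) d) (trans (^-*-assoc (η q ^ p) s d) (^-swap (η q) p (s * d))) ⟩
    m q ^ (suc s * d) * (η q ^ (s * d)) ^ p       ≡⟨ *-comm (m q ^ (suc s * d)) _ ⟩
    (η q ^ (s * d)) ^ p * m q ^ (suc s * d)       ≡⟨ *-identityʳ _ ⟨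
    (η q ^ (s * d)) ^ p * m q ^ (suc s * d) * 1   ≤⟨ *-monoʳ-≤ ((η q ^ (s * d)) ^ p * m q ^ (suc s * d)) (1≤^ w (1≤^ (2 * (q * s)) 1≤m)) ⟩
    _ ∎
    where
    open ≤-Reasoning
    p≢0 : NonZero p
    p≢0 = >-nonZero (≤-trans (*-mono-≤ (*-mono-≤ (1≤^ {2} q (s≤s z≤n)) (>-nonZero⁻¹ (2 * s) {{m*n≢0 2 s}})) 1≤η) P≤p)
  ... | no P≰p = begin
    K q p ^ (s * d)                               ≤⟨ ^-monoˡ-≤ (s * d) (K≤2^q*η^p q p) ⟩
    (2 ^ q * η q ^ p) ^ (s * d)                   ≡⟨ trans (^-distribʳ-* (2 ^ q) _ (s * d)) (cong₂ _*_ (^-*-assoc 2 q (s * d)) (^-swap (η q) p (s * d))) ⟩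
    2 ^ (q * (s * d)) * (η q ^ (s * d)) ^ p       ≤⟨ *-monoˡ-≤ _ (^-monoʳ {2} (s≤s z≤n) (*-monoʳ-≤ q (*-monoʳ-≤ s d≤2w))) ⟩
    2 ^ (q * (s * (2 * w))) * (η q ^ (s * d)) ^ p ≤⟨ *-monoˡ-≤ _ (^-monoˡ-≤ (q * (s * (2 * w))) (2≤m 3≤q)) ⟩
    m q ^ (q * (s * (2 * w))) * (η q ^ (s * d)) ^ p ≡⟨ cong (_* (η q ^ (s * d)) ^ p) (^-normalize (m q) (2 * (q * s)) w _ (exponent q s w)) ⟨
    (m q ^ (2 * (q * s))) ^ w * (η q ^ (s * d)) ^ p ≤⟨ m≤m*n _ (m q ^ (suc s * d)) {{>-nonZero (1≤^ (suc s * d) 1≤m)}} ⟩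
    (m q ^ (2 * (q * s))) ^ w * (η q ^ (s * d)) ^ p * m q ^ (suc s * d) ≡⟨ rotate ((m q ^ (2 * (q * s))) ^ w) _ _ ⟩
    _ ∎
    where
    open ≤-Reasoning
    exponent : ∀ q s w → 2 * (q * s) * w ≡ q * (s * (2 * w))
    exponent = solve-∀
    rotate : ∀ x y z → x * y * z ≡ y * z * x
    rotate = solve-∀
    -- `p` is below the threshold, hence at most half of `d`, so at least half of the neighbours
    -- come later and can carry the charge 2^q.
    d≤2w : d ≤ 2 * w
    d≤2w = +-cancelˡ-≤ d _ _ (begin
      d + d           ≡⟨ cong (λ d → d + d) p+w≡d ⟨
      p + w + (p + w) ≡⟨ double p w ⟩
      2 * p + 2 * w   ≤⟨ +-monoˡ-≤ (2 * w) (≤-trans (*-monoʳ-≤ 2 (<⇒≤ (≰⇒> P≰p))) 2P≤d) ⟩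
      d + 2 * w       ∎)
      where
      double : ∀ p w → p + w + (p + w) ≡ 2 * p + 2 * w
      double = solve-∀

module _ {n : ℕ} (q : ℕ) (G : Graph n) where

  backEdges : List (Fin n) → ℕ
  backEdges []      = 0
  backEdges (k ∷ L) = count (adj G k) L + backEdges L

  handshake : ∀ L → ∑ L (λ u → count (adj G u) L) ≡ 2 * backEdges L
  handshake []      = refl
  handshake (k ∷ L) = begin
    ind (adj G k k) + count (adj G k) L + ∑ L (λ u → ind (adj G u k) + count (adj G u) L)
      ≡⟨ cong₂ (λ b x → ind b + count (adj G k) L + x) (loopless G k) (∑-+ L _ _) ⟩
    count (adj G k) L + (∑ L (λ u → ind (adj G u k)) + ∑ L (λ u → count (adj G u) L))
      ≡⟨ cong₂ (λ x y → count (adj G k) L + (x + y)) (∑-cong L λ u → cong ind (Graph.sym G u k)) (handshake L) ⟩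
    count (adj G k) L + (count (adj G k) L + 2 * backEdges L)
      ≡⟨ lemma (count (adj G k) L) (backEdges L) ⟩
    2 * (count (adj G k) L + backEdges L) ∎
    where
    open ≡-Reasoning
    lemma : ∀ x y → x + (x + 2 * y) ≡ 2 * (x + y)
    lemma = solve-∀

  count-none : ∀ k L → (∀ u → u ∈ L → adj G k u ≡ false) → count (adj G k) L ≡ 0
  count-none k []      h = refl
  count-none k (u ∷ L) h rewrite h u (here refl) = count-none k L λ v v∈ → h v (there v∈)

  independent-tail : ∀ I → (∀ u v → u ∈ I → v ∈ I → adj G u v ≡ false) → backDegreeProduct q G I ≡ 1 × backEdges I ≡ 0
  independent-tail []      h = refl , refl
  independent-tail (k ∷ I) h
    rewrite count-none k I (λ u u∈ → h k u (here refl) (there u∈))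
    with independent-tail I (λ u v u∈ v∈ → h u v (there u∈) (there v∈))
  ... | e , e′ rewrite e = refl , e′

  -- `y` is the sum of the forward degrees d - p over `J`. The independent `I` forms the tail, where
  -- every back-degree is 0 and every factor is `K q 0 = 1`.
  backDegreeProduct-bound : ∀ d e a b r → (∀ p w → p + w ≡ d → K q p ^ e ≤ a ^ p * b * r ^ w) → ∀ J I →
    (∀ u v → u ∈ I → v ∈ I → adj G u v ≡ false) → (∀ u → count (adj G u) (J ++ I) ≤ d) →
    ∃ λ y → y + backEdges (J ++ I) ≡ d * length J ×
      backDegreeProduct q G (J ++ I) ^ e ≤ a ^ backEdges (J ++ I) * b ^ length J * r ^ y
  backDegreeProduct-bound d e a b r h [] I indep deg with independent-tail I indep
  ... | P≡1 , E≡0 rewrite P≡1 | E≡0 = 0 , ≡-sym (*-zeroʳ d) , ≤-reflexive (^-zeroˡ e)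
  backDegreeProduct-bound d e a b r h (k ∷ J) I indep deg
    with backDegreeProduct-bound d e a b r h J I indep (λ u → ≤-trans (m≤n+m _ (ind (adj G u k))) (deg u))
  ... | y , y≡ , le = w + y , w+y≡ , (begin
    (K q p * P) ^ e                                      ≡⟨ ^-distribʳ-* (K q p) P e ⟩
    K q p ^ e * P ^ e                                    ≤⟨ *-mono-≤ (h p w p+w≡d) le ⟩
    a ^ p * b * r ^ w * (a ^ B * b ^ length J * r ^ y)   ≡⟨ lemma (a ^ p) b (r ^ w) (a ^ B) (b ^ length J) (r ^ y) ⟩
    a ^ p * a ^ B * b ^ suc (length J) * (r ^ w * r ^ y) ≡⟨ cong₂ (λ x z → x * b ^ suc (length J) * z) (^-distribˡ-+-* a p B) (^-distribˡ-+-* r w y) ⟨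
    a ^ (p + B) * b ^ suc (length J) * r ^ (w + y)       ∎)
    where
    open ≤-Reasoning
    p = count (adj G k) (J ++ I)
    w = d ∸ p
    P = backDegreeProduct q G (J ++ I)
    B = backEdges (J ++ I)
    p+w≡d : p + w ≡ d
    p+w≡d = m+[n∸m]≡n (≤-trans (m≤n+m _ (ind (adj G k k))) (deg k))
    w+y≡ : w + y + (p + B) ≡ d * suc (length J)
    w+y≡ = trans (shuffle w y p B) (trans (cong₂ _+_ p+w≡d y≡) (≡-sym (*-suc d (length J))))
      where
      shuffle : ∀ w y p b → w + y + (p + b) ≡ p + w + (y + b)
      shuffle = solve-∀
    lemma : ∀ a b c x y z → a * b * c * (x * y * z) ≡ a * x * (b * y) * (c * z)
    lemma = solve-∀

filter-not-++-filter : ∀ (b : X → Bool) xs → filterᵇ (not ∘ b) xs ++ filterᵇ b xs ↭ xs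
filter-not-++-filter b []       = Perm.refl
filter-not-++-filter b (x ∷ xs) with b x
... | false = Perm.prep x (filter-not-++-filter b xs)
... | true  = ↭-trans (shift x (filterᵇ (not ∘ b) xs) _) (Perm.prep x (filter-not-++-filter b xs))

∈-filterᵇ⇒ : ∀ (b : X → Bool) xs {x} → x ∈ filterᵇ b xs → b x ≡ true
∈-filterᵇ⇒ b (x ∷ xs) x∈ with b x in eq
∈-filterᵇ⇒ b (x ∷ xs) (here refl) | true  = eq
∈-filterᵇ⇒ b (x ∷ xs) (there x∈)  | true  = ∈-filterᵇ⇒ b xs x∈
∈-filterᵇ⇒ b (x ∷ xs) x∈          | false = ∈-filterᵇ⇒ b xs x∈

Independent : Graph n → (Fin n → Bool) → Set
Independent G I = ∀ u v → I u ≡ true → I v ≡ true → adj G u v ≡ false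

count-not : ∀ (b : X → Bool) xs → count (not ∘ b) xs + count b xs ≡ length xs
count-not b []       = refl
count-not b (x ∷ xs) with b x
... | false = cong suc (count-not b xs)
... | true  = trans (+-suc _ _) (cong suc (count-not b xs))

module _ {q : ℕ} (3≤q : 3 ≤ q) (S : ℕ) .{{_ : NonZero S}} where

  -- Sized so that `4 * S + 8 * (q * S)`, the loss caused by an independent set that is n / (2 gap)
  -- short of half the vertices, stays below `2 * gap`.
  gap : ℕ
  gap = 4 * S * suc q

  -- All nd/2 edges are back edges of vertices outside `I`, of which there are at most (1 + 1/e)
  -- n/2, so their forward degrees sum to at most nd/(2e). `K-pointwise` is used with 4S in place of
  -- s; the power 4ed clears the denominators.
  large-independent-set : ∀ {n} d .{{_ : NonZero d}} (G : Graph n) → Regular d G → 2 * threshold 3≤q (4 * S) ≤ d →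
    (I : Fin n → Bool) → Independent G I → gap * n ≤ 2 * gap * count I (allFin n) + n →
    c q G ^ (2 * d * S) ≤ η q ^ (n * d * S) * m q ^ (n * suc S)
  large-independent-set {n} d G reg 2P≤d I indep large = ^-cancelʳ-≤ (4 * e * d) {{m*n≢0 (4 * e) d {{m*n≢0 4 e}}}} (begin
    (c q G ^ (2 * d * S)) ^ (4 * e * d)                ≡⟨ ^-normalize (c q G) (2 * d * S) (4 * e * d) _ refl ⟩
    c q G ^ (2 * d * S * (4 * e * d))                  ≡⟨ cong (c q G ^_) (exponent₁ d S e) ⟩
    c q G ^ (d * (4 * S * d * (2 * e)))                ≡⟨ trans (^-*-assoc (c q G ^ d) (4 * S * d) (2 * e)) (^-*-assoc (c q G) d (4 * S * d * (2 * e))) ⟨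
    ((c q G ^ d) ^ (4 * S * d)) ^ (2 * e)              ≤⟨ ^-monoˡ-≤ (2 * e) (≤-trans (^-monoˡ-≤ (4 * S * d) (colourings-ordered-bound q d G x₀ reg L↭)) bdp≤) ⟩
    (a ^ B * b ^ length Out * r ^ y) ^ (2 * e)           ≡⟨ trans (^-distribʳ-* (a ^ B * b ^ length Out) _ (2 * e)) (cong (_* (r ^ y) ^ (2 * e)) (^-distribʳ-* (a ^ B) _ (2 * e))) ⟩
    (a ^ B) ^ (2 * e) * (b ^ length Out) ^ (2 * e) * (r ^ y) ^ (2 * e)
                                                       ≡⟨ cong₂ _*_ (cong₂ _*_ (^-*-assoc a B (2 * e)) (^-*-assoc b (length Out) (2 * e))) (^-*-assoc r y (2 * e)) ⟩
    a ^ (B * (2 * e)) * b ^ (length Out * (2 * e)) * r ^ (y * (2 * e))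
                                                       ≤⟨ *-mono-≤ (*-mono-≤ (≤-reflexive (cong (a ^_) B≡)) (^-monoʳ (1≤^ (suc (4 * S) * d) 1≤m) j≤)) (^-monoʳ (1≤^ (2 * (q * (4 * S))) 1≤m) y≤) ⟩
    a ^ (n * d * e) * b ^ (suc e * n) * r ^ (d * n)    ≡⟨ cong₂ _*_ (cong₂ _*_ (^-*-assoc (η q) (4 * S * d) (n * d * e)) (^-*-assoc (m q) (suc (4 * S) * d) (suc e * n))) (^-*-assoc (m q) (2 * (q * (4 * S))) (d * n)) ⟩
    η q ^ α * m q ^ β * m q ^ γ                        ≡⟨ trans (*-assoc (η q ^ α) _ _) (cong (η q ^ α *_) (≡-sym (^-distribˡ-+-* (m q) β γ))) ⟩
    η q ^ α * m q ^ (β + γ)                            ≤⟨ *-mono-≤ (≤-reflexive (cong (η q ^_) (exponent₂ n d S e))) (^-monoʳ 1≤m m-exponent) ⟩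
    η q ^ (n * d * S * (4 * e * d)) * m q ^ (n * suc S * (4 * e * d))
                                                       ≡⟨ trans (^-distribʳ-* (η q ^ (n * d * S)) _ (4 * e * d)) (cong₂ _*_ (^-*-assoc (η q) (n * d * S) (4 * e * d)) (^-*-assoc (m q) (n * suc S) (4 * e * d))) ⟨
    (η q ^ (n * d * S) * m q ^ (n * suc S)) ^ (4 * e * d) ∎)
    where
    open ≤-Reasoning
    1≤m : 1 ≤ m q
    1≤m = ≤-trans (s≤s z≤n) (2≤m 3≤q)
    e = gap
    instance
      4S≢0 : NonZero (4 * S)
      4S≢0 = m*n≢0 4 S
      e≢0 : NonZero e
      e≢0 = m*n≢0 (4 * S) (suc q)
    x₀ : Fin q
    x₀ = fromℕ< {0} (≤-trans (s≤s z≤n) 3≤q)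
    Out = filterᵇ (not ∘ I) (allFin n)
    In = filterᵇ I (allFin n)
    L↭ : Out ++ In ↭ allFin n
    L↭ = filter-not-++-filter I (allFin n)
    a = η q ^ (4 * S * d)
    b = m q ^ (suc (4 * S) * d)
    r = m q ^ (2 * (q * (4 * S)))
    α = 4 * S * d * (n * d * e)
    β = suc (4 * S) * d * (suc e * n)
    γ = 2 * (q * (4 * S)) * (d * n)
    B = backEdges q G (Out ++ In)
    bdp = backDegreeProduct-bound q G d (4 * S * d) a b r (K-pointwise 3≤q (4 * S) d 2P≤d) Out In
      (λ u v u∈ v∈ → indep u v (∈-filterᵇ⇒ I (allFin n) u∈) (∈-filterᵇ⇒ I (allFin n) v∈))
      (λ u → ≤-reflexive (count-adj G reg L↭ u))
    y = proj₁ bdp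
    y+B≡ : y + B ≡ d * length Out
    y+B≡ = proj₁ (proj₂ bdp)
    bdp≤ : backDegreeProduct q G (Out ++ In) ^ (4 * S * d) ≤ a ^ B * b ^ length Out * r ^ y
    bdp≤ = proj₂ (proj₂ bdp)
    2B≡ : 2 * B ≡ n * d
    2B≡ = trans (≡-sym (handshake q G (Out ++ In))) (trans (∑-cong (Out ++ In) (count-adj G reg L↭))
            (trans (∑-const (Out ++ In) d) (cong (_* d) (trans (↭-length L↭) (length-allFin n)))))
    B≡ : B * (2 * e) ≡ n * d * e
    B≡ = trans (assoc B e) (cong (_* e) 2B≡)
      where
      assoc : ∀ b e → b * (2 * e) ≡ 2 * b * e
      assoc = solve-∀
    j≤ : length Out * (2 * e) ≤ suc e * n
    j≤ = +-cancelʳ-≤ (2 * e * i + n) _ _ (begin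
      length Out * (2 * e) + (2 * e * i + n)   ≡⟨ lemma (length Out) e i n ⟩
      2 * e * (length Out + i) + n             ≡⟨ cong (λ x → 2 * e * x + n) j+i≡n ⟩
      2 * e * n + n                          ≡⟨ lemma′ e n ⟩
      suc e * n + e * n                      ≤⟨ +-monoʳ-≤ (suc e * n) large ⟩
      suc e * n + (2 * e * i + n)            ∎)
      where
      i = count I (allFin n)
      j+i≡n : length Out + i ≡ n
      j+i≡n = trans (cong (_+ i) (length-filterᵇ (not ∘ I) (allFin n))) (trans (count-not I (allFin n)) (length-allFin n))
      lemma : ∀ j e i n → j * (2 * e) + (2 * e * i + n) ≡ 2 * e * (j + i) + n
      lemma = solve-∀
      lemma′ : ∀ e n → 2 * e * n + n ≡ (1 + e) * n + e * n
      lemma′ = solve-∀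
    y≤ : y * (2 * e) ≤ d * n
    y≤ = +-cancelʳ-≤ (n * d * e) _ _ (begin
      y * (2 * e) + n * d * e            ≡⟨ cong (y * (2 * e) +_) B≡ ⟨
      y * (2 * e) + B * (2 * e)          ≡⟨ *-distribʳ-+ (2 * e) y B ⟨
      (y + B) * (2 * e)                  ≡⟨ cong (_* (2 * e)) y+B≡ ⟩
      d * length Out * (2 * e)             ≡⟨ *-assoc d (length Out) (2 * e) ⟩
      d * (length Out * (2 * e))           ≤⟨ *-monoʳ-≤ d j≤ ⟩
      d * (suc e * n)                    ≡⟨ lemma d e n ⟩
      d * n + n * d * e                  ∎)
      where
      lemma : ∀ d e n → d * ((1 + e) * n) ≡ d * n + n * d * e
      lemma = solve-∀
    exponent₁ : ∀ d S e → 2 * d * S * (4 * e * d) ≡ d * (4 * S * d * (2 * e))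
    exponent₁ = solve-∀
    exponent₂ : ∀ n d S e → 4 * S * d * (n * d * e) ≡ n * d * S * (4 * e * d)
    exponent₂ = solve-∀
    m-exponent : β + γ ≤ n * suc S * (4 * e * d)
    m-exponent = begin
      β + γ                                                     ≡⟨ expand n d q S e ⟩
      -- Beyond the main term 4Se: e is the relative error 1/(4S) of `K-large`, 4S + 1 the surplus
      -- of `Out` over n/2, and 8qS the charge for vertices of small back-degree. The budget for all
      -- of these is 4e.
      n * d * (4 * S * e + e + (4 * S + 8 * (q * S)) + 1)       ≤⟨ *-monoʳ-≤ (n * d) (+-mono-≤ (+-monoʳ-≤ (4 * S * e + e) sum≤) (>-nonZero⁻¹ e)) ⟩
      n * d * (4 * S * e + e + 2 * e + e)                       ≡⟨ collect n d S e ⟩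
      n * suc S * (4 * e * d)                                   ∎
      where
      expand : ∀ n d q S e → (1 + 4 * S) * d * ((1 + e) * n) + 2 * (q * (4 * S)) * (d * n) ≡ n * d * (4 * S * e + e + (4 * S + 8 * (q * S)) + 1)
      expand = solve-∀
      collect : ∀ n d S e → n * d * (4 * S * e + e + 2 * e + e) ≡ n * (1 + S) * (4 * e * d)
      collect = solve-∀
      sum≤ : 4 * S + 8 * (q * S) ≤ 2 * e
      sum≤ = ≤-trans (m≤m+n _ (4 * S)) (≤-reflexive (lemma q S))
        where
        lemma : ∀ q S → 4 * S + 8 * (q * S) + 4 * S ≡ 2 * (4 * S * (1 + q))
        lemma = solve-∀

-- List colourings and branching

∏-allFin-≡1 : ∀ n (b : Fin n → Bool) → (∀ v → b v ≡ true) → ∏ (allFin n) (ind ∘ b) ≡ 1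
∏-allFin-≡1 n b h = trans (∏-cong (allFin n) λ v → cong ind (h v)) (trans (∏-const (allFin n) 1) (^-zeroˡ (length (allFin n))))

∏-allFin-ind : ∀ n (b : Fin n → Bool) → (∀ v → b v ≡ true) ⊎ ∏ (allFin n) (ind ∘ b) ≡ 0
∏-allFin-ind zero    b = inj₁ λ ()
∏-allFin-ind (suc n) b = extend (b zero) refl (∏-allFin-ind n (b ∘ suc))
  where
  extend : ∀ x → b zero ≡ x → (∀ v → b (suc v) ≡ true) ⊎ ∏ (allFin n) (ind ∘ b ∘ suc) ≡ 0 →
    (∀ v → b v ≡ true) ⊎ ∏ (allFin (suc n)) (ind ∘ b) ≡ 0
  extend false eq _        = inj₂ (trans (∏-allFin n (ind ∘ b)) (cong (λ x → ind x * ∏ (allFin n) (ind ∘ b ∘ suc)) eq))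
  extend true  eq (inj₁ h) = inj₁ λ { zero → eq ; (suc v) → h v }
  extend true  eq (inj₂ h) = inj₂ (trans (∏-allFin n (ind ∘ b)) (trans (cong (ind (b zero) *_) h) (*-zeroʳ (ind (b zero)))))

∑-∏ : ∀ q n (g : Fin n → Fin q → ℕ) →
  ∑ (allColourings q n) (λ f → ∏ (allFin n) λ v → g v (lookup f v)) ≡ ∏ (allFin n) (λ v → ∑ (allFin q) (g v))
∑-∏ q zero    g = refl
∑-∏ q (suc n) g = begin
  ∑ (allColourings q (suc n)) (λ f → ∏ (allFin (suc n)) λ v → g v (lookup f v))
    ≡⟨ ∑-allColourings q n _ ⟩
  ∑ (allFin q) (λ x → ∑ (allColourings q n) λ f → ∏ (allFin (suc n)) λ v → g v (lookup (x ∷ f) v))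
    ≡⟨ ∑-cong (allFin q) (λ x → trans (∑-cong (allColourings q n) λ f → ∏-allFin n λ v → g v (lookup (x ∷ f) v))
         (∑-*ˡ (allColourings q n) (g zero x) λ f → ∏ (allFin n) λ v → g (suc v) (lookup f v))) ⟩
  ∑ (allFin q) (λ x → g zero x * ∑ (allColourings q n) (λ f → ∏ (allFin n) λ v → g (suc v) (lookup f v)))
    ≡⟨ ∑-*ʳ (allFin q) (g zero) _ ⟩
  ∑ (allFin q) (g zero) * ∑ (allColourings q n) (λ f → ∏ (allFin n) λ v → g (suc v) (lookup f v))
    ≡⟨ cong (∑ (allFin q) (g zero) *_) (∑-∏ q n (g ∘ suc)) ⟩
  ∑ (allFin q) (g zero) * ∏ (allFin n) (λ v → ∑ (allFin q) (g (suc v)))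
    ≡⟨ ∏-allFin n (λ v → ∑ (allFin q) (g v)) ⟨
  ∏ (allFin (suc n)) (λ v → ∑ (allFin q) (g v)) ∎
  where open ≡-Reasoning

⌊suc≟suc⌋ : ∀ (x y : Fin n) → ⌊ suc x ≟ suc y ⌋ ≡ ⌊ x ≟ y ⌋
⌊suc≟suc⌋ x y with x ≟ y
... | yes _ = refl
... | no  _ = refl

⌊≟⌋-≢ : ∀ {x y : Fin n} → x ≢ y → ⌊ x ≟ y ⌋ ≡ false
⌊≟⌋-≢ {x = x} {y} x≢y with x ≟ y
... | yes p = ⊥-elim (x≢y p)
... | no  _ = refl

∑-delta : ∀ (i : Fin n) (g : Fin n → ℕ) → ∑ (allFin n) (λ x → ind ⌊ x ≟ i ⌋ * g x) ≡ g i
∑-delta {suc n} zero    g = trans (∑-allFin n λ x → ind ⌊ x ≟ zero ⌋ * g x)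
  (trans (cong₂ _+_ (+-identityʳ (g zero)) (∑-zero (allFin n))) (+-identityʳ (g zero)))
∑-delta {suc n} (suc i) g = trans (∑-allFin n λ x → ind ⌊ x ≟ suc i ⌋ * g x)
  (trans (∑-cong (allFin n) λ x → cong (λ b → ind b * g (suc x)) (⌊suc≟suc⌋ x i)) (∑-delta i (g ∘ suc)))

_except_ : (Fin n → ℕ) → Fin n → Fin n → ℕ
(g except u) w = if ⌊ w ≟ u ⌋ then 1 else g w

∏-extract : ∀ (g : Fin n → ℕ) u → ∏ (allFin n) g ≡ g u * ∏ (allFin n) (g except u)
∏-extract {suc n} g zero = trans (∏-allFin n g) (cong (g zero *_) (≡-sym (trans (∏-allFin n (g except zero)) (+-identityʳ _))))
∏-extract {suc n} g (suc u) = begin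
  ∏ (allFin (suc n)) g                                             ≡⟨ ∏-allFin n g ⟩
  g zero * ∏ (allFin n) (g ∘ suc)                                  ≡⟨ cong (g zero *_) (∏-extract (g ∘ suc) u) ⟩
  g zero * (g (suc u) * ∏ (allFin n) ((g ∘ suc) except u))         ≡⟨ lemma (g zero) (g (suc u)) _ ⟩
  g (suc u) * (g zero * ∏ (allFin n) ((g ∘ suc) except u))         ≡⟨ cong (λ P → g (suc u) * (g zero * P)) (∏-cong (allFin n) λ w → cong (λ b → if b then 1 else g (suc w)) (⌊suc≟suc⌋ w u)) ⟨
  g (suc u) * (g zero * ∏ (allFin n) ((g except suc u) ∘ suc))     ≡⟨ cong (g (suc u) *_) (∏-allFin n (g except suc u)) ⟨
  g (suc u) * ∏ (allFin (suc n)) (g except suc u)                  ∎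
  where
  open ≡-Reasoning
  lemma : ∀ a b c → a * (b * c) ≡ b * (a * c)
  lemma = solve-∀

∏-extract₂ : ∀ (g : Fin n → ℕ) {u v} → v ≢ u → ∏ (allFin n) g ≡ g u * (g v * ∏ (allFin n) ((g except u) except v))
∏-extract₂ {n} g {u} {v} v≢u = trans (∏-extract g u) (cong (g u *_) (trans (∏-extract (g except u) v)
  (cong (λ b → (if b then 1 else g v) * ∏ (allFin n) ((g except u) except v)) (⌊≟⌋-≢ v≢u))))

ind-∧ : ∀ a b → ind (a ∧ b) ≡ ind a * ind b
ind-∧ false b = refl
ind-∧ true  b = ≡-sym (+-identityʳ _)

ind-split : ∀ a b → ind (a ∧ not b) + ind b * ind a ≡ ind a
ind-split false false = refl
ind-split false true  = refl
ind-split true  false = refl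
ind-split true  true  = refl

module _ {n : ℕ} (q : ℕ) (G : Graph n) where

  ColourLists : Set
  ColourLists = Fin n → Fin q → Bool

  listColourings : ColourLists → ℕ
  listColourings A = ∑ (allColourings q n) λ f → ind (isProper G f) * ∏ (allFin n) λ v → ind (A v (lookup f v))

  listSize : ColourLists → Fin n → ℕ
  listSize A v = ∑ (allFin q) (ind ∘ A v)

  sizeSum sizeProduct : ColourLists → ℕ
  sizeSum     A = ∑ (allFin n) (listSize A)
  sizeProduct A = ∏ (allFin n) (listSize A)

  listColourings≤sizeProduct : ∀ A → listColourings A ≤ sizeProduct A
  listColourings≤sizeProduct A = ≤-trans
    (∑-mono (allColourings q n) λ f → ≤-trans (*-monoˡ-≤ _ (ind≤1 (isProper G f))) (≤-reflexive (*-identityˡ _)))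
    (≤-reflexive (∑-∏ q n λ v x → ind (A v x)))

  listColourings-branch : ∀ A A₁ A₂ →
    (∀ f → isProper G f ≡ true → (∀ v → A v (lookup f v) ≡ true) →
      (∀ v → A₁ v (lookup f v) ≡ true) ⊎ (∀ v → A₂ v (lookup f v) ≡ true)) →
    listColourings A ≤ listColourings A₁ + listColourings A₂
  listColourings-branch A A₁ A₂ h = ≤-trans (∑-mono (allColourings q n) pointwise) (≤-reflexive (∑-+ (allColourings q n) _ _))
    where
    open ≤-Reasoning
    adm : ColourLists → Vec (Fin q) n → ℕ
    adm A f = ∏ (allFin n) λ v → ind (A v (lookup f v))
    pointwise : ∀ f → ind (isProper G f) * adm A f ≤ ind (isProper G f) * adm A₁ f + ind (isProper G f) * adm A₂ f
    pointwise f with isProper G f in proper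
    ... | false = z≤n
    ... | true with ∏-allFin-ind n (λ v → A v (lookup f v))
    ...   | inj₂ ≡0 = ≤-trans (≤-reflexive (trans (+-identityʳ _) ≡0)) z≤n
    ...   | inj₁ all with h f proper all
    ...     | inj₁ h₁ = ≤-trans (≤-reflexive (cong (1 *_) (trans (∏-allFin-≡1 n _ all) (≡-sym (∏-allFin-≡1 n _ h₁))))) (m≤m+n (1 * adm A₁ f) (1 * adm A₂ f))
    ...     | inj₂ h₂ = ≤-trans (≤-reflexive (cong (1 *_) (trans (∏-allFin-≡1 n _ all) (≡-sym (∏-allFin-≡1 n _ h₂))))) (m≤n+m (1 * adm A₂ f) (1 * adm A₁ f))

  -- One operation for both kinds of branch: `P` is a single vertex that avoids `i`, or the
  -- neighbourhood of a vertex coloured `i`.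
  remove : (Fin n → Bool) → Fin q → ColourLists → ColourLists
  remove P i A u x = A u x ∧ not (P u ∧ ⌊ x ≟ i ⌋)

  listSize-remove : ∀ P i A u → listSize (remove P i A) u + ind (P u ∧ A u i) ≡ listSize A u
  listSize-remove P i A u with P u
  ... | false = trans (+-identityʳ _) (∑-cong (allFin q) λ x → cong ind (Bool.∧-identityʳ (A u x)))
  ... | true  = begin
    ∑ (allFin q) (λ x → ind (A u x ∧ not ⌊ x ≟ i ⌋)) + ind (A u i)
      ≡⟨ cong (∑ (allFin q) (λ x → ind (A u x ∧ not ⌊ x ≟ i ⌋)) +_) (∑-delta i (ind ∘ A u)) ⟨
    ∑ (allFin q) (λ x → ind (A u x ∧ not ⌊ x ≟ i ⌋)) + ∑ (allFin q) (λ x → ind ⌊ x ≟ i ⌋ * ind (A u x))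
      ≡⟨ ∑-+ (allFin q) _ _ ⟨
    ∑ (allFin q) (λ x → ind (A u x ∧ not ⌊ x ≟ i ⌋) + ind ⌊ x ≟ i ⌋ * ind (A u x))
      ≡⟨ ∑-cong (allFin q) (λ x → ind-split (A u x) ⌊ x ≟ i ⌋) ⟩
    listSize A u ∎
    where open ≡-Reasoning

  sizeSum-remove : ∀ P i A → sizeSum (remove P i A) + count (λ u → P u ∧ A u i) (allFin n) ≡ sizeSum A
  sizeSum-remove P i A = trans (≡-sym (∑-+ (allFin n) _ _)) (∑-cong (allFin n) (listSize-remove P i A))

  is : Fin n → Fin n → Bool
  is v u = ⌊ u ≟ v ⌋

  count-is : ∀ v i (A : ColourLists) → A v i ≡ true → count (λ u → is v u ∧ A u i) (allFin n) ≡ 1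
  count-is v i A Avi = trans (∑-cong (allFin n) λ u → ind-∧ (is v u) (A u i)) (trans (∑-delta v λ u → ind (A u i)) (cong ind Avi))

  remove-keeps : ∀ P i A u x → A u x ≡ true → (P u ≡ true → x ≢ i) → remove P i A u x ≡ true
  remove-keeps P i A u x Aux h rewrite Aux with P u
  ... | false = refl
  ... | true rewrite ⌊≟⌋-≢ (h refl) = refl

  proper⇒≢ : ∀ (f : Vec (Fin q) n) → isProper G f ≡ true → ∀ {u v} → adj G u v ≡ true → lookup f u ≢ lookup f v
  proper⇒≢ f proper {u} {v} uv e with isProper⇒ G f proper u v uv
  ... | eq rewrite e | ⌊≟⌋-refl (lookup f v) with () ← eq

  Sparse : ℕ → ColourLists → Set
  Sparse φ A = ∀ v i → A v i ≡ true → count (λ u → adj G v u ∧ A u i) (allFin n) < φ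

  -- While some colour i in the list of v lies in the lists of many neighbours of v, either v is not coloured i or
  -- all of these lists shrink; the lopsided recursion has growth rate (t + 1)/t per unit of total list size.
  sparsify : ∀ t ψ B → t ^ suc ψ ≤ suc t ^ ψ → (∀ A → Sparse (suc ψ) A → listColourings A ≤ B) →
    ∀ A → listColourings A * t ^ sizeSum A ≤ suc t ^ sizeSum A * B
  sparsify t ψ B t^≤ leaf A = go (sizeSum A) (sizeSum A) ≤-refl A ≤-refl
    where
    open ≤-Reasoning
    dense? : ∀ A → _
    dense? A = any? λ v → any? λ i → (A v i Bool.≟ true) ×-dec (suc ψ ≤? count (λ u → adj G v u ∧ A u i) (allFin n))

    -- `M` only drives termination. `N` bounds the total list size and falls by 1 in one branch and
    -- by `suc ψ` in the other.
    go : ∀ M N → N ≤ M → ∀ A → sizeSum A ≤ N → listColourings A * t ^ N ≤ suc t ^ N * B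
    go M N N≤M A Φ≤N with dense? A
    ... | no sparse = begin
      listColourings A * t ^ N  ≤⟨ *-mono-≤ (leaf A λ v i Avi → ≰⇒> λ le → sparse (v , i , Avi , le)) (^-monoˡ-≤ N (n≤1+n t)) ⟩
      B * suc t ^ N             ≡⟨ *-comm B _ ⟩
      suc t ^ N * B             ∎
    ... | yes (v , i , Avi , dense) = descend M N N≤M Φ≤N
      where
      A₁ = remove (is v) i A
      A₂ = remove (adj G v) i A
      Φ₂ : sizeSum A₂ + suc ψ ≤ sizeSum A
      Φ₂ = ≤-trans (+-monoʳ-≤ (sizeSum A₂) dense) (≤-reflexive (sizeSum-remove (adj G v) i A))
      Φ₁ : suc (sizeSum A₁) ≡ sizeSum A
      Φ₁ = trans (+-comm 1 _) (trans (cong (sizeSum A₁ +_) (≡-sym (count-is v i A Avi))) (sizeSum-remove (is v) i A))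
      branch : listColourings A ≤ listColourings A₁ + listColourings A₂
      branch = listColourings-branch A A₁ A₂ λ f proper all → split f proper all (lookup f v ≟ i)
        where
        split : ∀ f → isProper G f ≡ true → (∀ w → A w (lookup f w) ≡ true) → _ →
          (∀ w → A₁ w (lookup f w) ≡ true) ⊎ (∀ w → A₂ w (lookup f w) ≡ true)
        split f proper all (yes refl) = inj₂ λ w → remove-keeps (adj G v) i A w (lookup f w) (all w)
          λ vw e → proper⇒≢ f proper vw (≡-sym e)
        split f proper all (no fv≢i) = inj₁ λ w → remove-keeps (is v) i A w (lookup f w) (all w) (other w)
          where
          other : ∀ w → is v w ≡ true → lookup f w ≢ i
          other w h with w ≟ v
          ... | yes refl = fv≢i
      descend : ∀ M N → N ≤ M → sizeSum A ≤ N → listColourings A * t ^ N ≤ suc t ^ N * B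
      descend M       zero      N≤M       Φ≤N = ⊥-elim (<⇒≱ (≤-trans (m≤n+m _ (sizeSum A₂)) (≤-trans Φ₂ Φ≤N)) z≤n)
      descend (suc M) (suc N) (s≤s N≤M) Φ≤N = begin
        listColourings A * t ^ suc N                        ≤⟨ *-monoˡ-≤ (t ^ suc N) branch ⟩
        (listColourings A₁ + listColourings A₂) * t ^ suc N ≡⟨ *-distribʳ-+ (t ^ suc N) (listColourings A₁) _ ⟩
        listColourings A₁ * t ^ suc N + listColourings A₂ * t ^ suc N
                                                            ≤⟨ +-mono-≤ first second ⟩
        t * (suc t ^ N * B) + suc t ^ N * B                 ≡⟨ lemma t (suc t ^ N) B ⟩
        suc t ^ suc N * B                                   ∎
        where
        lemma : ∀ t x b → t * (x * b) + x * b ≡ (1 + t) * x * b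
        lemma = solve-∀
        swap : ∀ a b c → a * (b * c) ≡ b * (a * c)
        swap = solve-∀
        first : listColourings A₁ * t ^ suc N ≤ t * (suc t ^ N * B)
        first = ≤-trans (≤-reflexive (swap (listColourings A₁) t (t ^ N)))
          (*-monoʳ-≤ t (go M N N≤M A₁ (≤-pred (≤-trans (≤-reflexive Φ₁) Φ≤N))))
        N₂ = N ∸ ψ
        ψ+N₂≡N : ψ + N₂ ≡ N
        ψ+N₂≡N = m+[n∸m]≡n (≤-pred (≤-trans (m≤n+m _ (sizeSum A₂)) (≤-trans Φ₂ Φ≤N)))
        -- The first branch may use t/(t+1) of the budget and this one 1/(t+1). The hypothesis
        -- t^(ψ+1) ≤ (t+1)^ψ says precisely that a drop of `suc ψ` pays for so small a share.
        second : listColourings A₂ * t ^ suc N ≤ suc t ^ N * B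
        second = subst (λ N → listColourings A₂ * t ^ suc N ≤ suc t ^ N * B) ψ+N₂≡N (begin
          listColourings A₂ * t ^ (suc ψ + N₂)         ≡⟨ cong (listColourings A₂ *_) (^-distribˡ-+-* t (suc ψ) N₂) ⟩
          listColourings A₂ * (t ^ suc ψ * t ^ N₂)     ≡⟨ swap (listColourings A₂) (t ^ suc ψ) (t ^ N₂) ⟩
          t ^ suc ψ * (listColourings A₂ * t ^ N₂)     ≤⟨ *-mono-≤ t^≤ (go M N₂ (≤-trans (m∸n≤m N ψ) N≤M) A₂ Φ₂≤) ⟩
          suc t ^ ψ * (suc t ^ N₂ * B)                 ≡⟨ *-assoc (suc t ^ ψ) _ B ⟨
          suc t ^ ψ * suc t ^ N₂ * B                   ≡⟨ cong (_* B) (^-distribˡ-+-* (suc t) ψ N₂) ⟨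
          suc t ^ (ψ + N₂) * B                         ∎)
          where
          Φ₂≤ : sizeSum A₂ ≤ N₂
          Φ₂≤ = m+n≤o⇒m≤o∸n (sizeSum A₂) (≤-pred (≤-trans (≤-reflexive (≡-sym (+-suc (sizeSum A₂) ψ))) (≤-trans Φ₂ Φ≤N)))

  Disjoint : ColourLists → Set
  Disjoint A = ∀ u v i → adj G u v ≡ true → A u i ≡ true → A v i ≡ true → ⊥

  fix : Fin n → Fin q → ColourLists → ColourLists
  fix u i A w x = A w x ∧ (not (is u w) ∨ ⌊ x ≟ i ⌋)

  listSize-fix-self : ∀ u i A → A u i ≡ true → listSize (fix u i A) u ≡ 1
  listSize-fix-self u i A Aui rewrite ⌊≟⌋-refl u = begin
    ∑ (allFin q) (λ x → ind (A u x ∧ ⌊ x ≟ i ⌋))        ≡⟨ ∑-cong (allFin q) (λ x → trans (ind-∧ (A u x) ⌊ x ≟ i ⌋) (*-comm (ind (A u x)) _)) ⟩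
    ∑ (allFin q) (λ x → ind ⌊ x ≟ i ⌋ * ind (A u x))    ≡⟨ ∑-delta i (ind ∘ A u) ⟩
    ind (A u i)                                         ≡⟨ cong ind Aui ⟩
    1                                                   ∎
    where open ≡-Reasoning

  listSize-fix-other : ∀ u i A w → w ≢ u → listSize (fix u i A) w ≡ listSize A w
  listSize-fix-other u i A w w≢u rewrite ⌊≟⌋-≢ w≢u = ∑-cong (allFin q) λ x → cong ind (Bool.∧-identityʳ (A w x))

  listSize-remove-other : ∀ v i A w → w ≢ v → listSize (remove (is v) i A) w ≡ listSize A w
  listSize-remove-other v i A w w≢v = trans (≡-sym (+-identityʳ _))
    (trans (cong (λ b → listSize (remove (is v) i A) w + ind (b ∧ A w i)) (≡-sym (⌊≟⌋-≢ w≢v))) (listSize-remove (is v) i A w))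

  listSize-remove-self : ∀ v i A → A v i ≡ true → suc (listSize (remove (is v) i A) v) ≡ listSize A v
  listSize-remove-self v i A Avi = trans (+-comm 1 _) (trans
    (cong (λ b → listSize (remove (is v) i A) v + ind b) (≡-sym (cong₂ _∧_ (⌊≟⌋-refl v) Avi))) (listSize-remove (is v) i A v))

  listSize≤q : ∀ A v → listSize A v ≤ q
  listSize≤q A v = ≤-trans (∑-mono (allFin q) λ x → ind≤1 (A v x))
    (≤-reflexive (trans (∑-const (allFin q) 1) (trans (*-identityʳ _) (length-allFin q))))

  module _ {u v i} (A : ColourLists) (uv : adj G u v ≡ true) (Aui : A u i ≡ true) (Avi : A v i ≡ true) where

    private
      A₁ = remove (is u) i A
      A₂ = remove (is v) i (fix u i A)

      v≢u : v ≢ u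
      v≢u refl with () ← trans (≡-sym uv) (loopless G v)

    conflict-branch : listColourings A ≤ listColourings A₁ + listColourings A₂
    conflict-branch = listColourings-branch A A₁ A₂ λ f proper all → split f proper all (lookup f u ≟ i)
      where
      split : ∀ f → isProper G f ≡ true → (∀ w → A w (lookup f w) ≡ true) → _ →
        (∀ w → A₁ w (lookup f w) ≡ true) ⊎ (∀ w → A₂ w (lookup f w) ≡ true)
      split f proper all (no fu≢i) = inj₁ λ w → remove-keeps (is u) i A w (lookup f w) (all w) (other w)
        where
        other : ∀ w → is u w ≡ true → lookup f w ≢ i
        other w h with w ≟ u
        ... | yes refl = fu≢i
      split f proper all (yes refl) = inj₂ λ w → remove-keeps (is v) i (fix u i A) w (lookup f w) (kept w) (other w)
        where
        kept : ∀ w → fix u i A w (lookup f w) ≡ true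
        kept w rewrite all w with w ≟ u
        ... | yes refl = ⌊≟⌋-refl (lookup f u)
        ... | no _     = refl
        other : ∀ w → is v w ≡ true → lookup f w ≢ i
        other w h e with w ≟ v
        ... | yes refl = proper⇒≢ f proper uv (≡-sym e)

    -- If a and b are the list sizes at u and v, the branches leave (a-1)b and b-1 choices there, in
    -- total ab - 1 instead of ab, and ab ≤ q².
    conflict-sizes : ∀ Q → q * q ≡ suc Q → suc Q * (sizeProduct A₁ + sizeProduct A₂) ≤ Q * sizeProduct A
    conflict-sizes Q q²≡ = +-cancelʳ-≤ (sizeProduct A) _ _ (begin
      suc Q * (sizeProduct A₁ + sizeProduct A₂) + sizeProduct A   ≡⟨ cong₂ (λ x y → suc Q * x + y) (cong₂ _+_ P₁ P₂) P ⟩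
      suc Q * (a₁ * (suc b₂ * M) + 1 * (b₂ * M)) + suc a₁ * (suc b₂ * M) ≤⟨ +-monoʳ-≤ (suc Q * (a₁ * (suc b₂ * M) + 1 * (b₂ * M))) ab≤ ⟩
      suc Q * (a₁ * (suc b₂ * M) + 1 * (b₂ * M)) + suc Q * M      ≡⟨ lemma Q a₁ b₂ M ⟩
      Q * (suc a₁ * (suc b₂ * M)) + suc a₁ * (suc b₂ * M)         ≡⟨ cong (λ x → Q * x + x) P ⟨
      Q * sizeProduct A + sizeProduct A                           ∎)
      where
      open ≤-Reasoning
      others : ColourLists → ℕ
      others A = ∏ (allFin n) ((listSize A except u) except v)
      M  = others A
      a₁ = listSize A₁ u
      b₂ = listSize A₂ v
      others-cong : ∀ A′ → (∀ w → w ≢ u → w ≢ v → listSize A′ w ≡ listSize A w) → others A′ ≡ M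
      others-cong A′ h = ∏-cong (allFin n) pointwise
        where
        pointwise : ∀ w → ((listSize A′ except u) except v) w ≡ ((listSize A except u) except v) w
        pointwise w with w ≟ v | w ≟ u
        ... | yes _ | _     = refl
        ... | no _  | yes _ = refl
        ... | no wv | no wu = h w wu wv
      a≡ : suc a₁ ≡ listSize A u
      a≡ = listSize-remove-self u i A Aui
      b≡ : suc b₂ ≡ listSize A v
      b≡ = trans (listSize-remove-self v i (fix u i A) Fvi) (listSize-fix-other u i A v v≢u)
        where
        Fvi : fix u i A v i ≡ true
        Fvi rewrite Avi | ⌊≟⌋-≢ v≢u = refl
      P : sizeProduct A ≡ suc a₁ * (suc b₂ * M)
      P = trans (∏-extract₂ (listSize A) v≢u) (cong₂ (λ a b → a * (b * M)) (≡-sym a≡) (≡-sym b≡))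
      P₁ : sizeProduct A₁ ≡ a₁ * (suc b₂ * M)
      P₁ = trans (∏-extract₂ (listSize A₁) v≢u) (cong₂ (λ b M → a₁ * (b * M))
        (trans (listSize-remove-other u i A v v≢u) (≡-sym b≡)) (others-cong A₁ λ w w≢u _ → listSize-remove-other u i A w w≢u))
      P₂ : sizeProduct A₂ ≡ 1 * (b₂ * M)
      P₂ = trans (∏-extract₂ (listSize A₂) v≢u) (cong₂ (λ a M → a * (b₂ * M))
        (trans (listSize-remove-other v i (fix u i A) u (v≢u ∘ ≡-sym)) (listSize-fix-self u i A Aui))
        (others-cong A₂ λ w w≢u w≢v → trans (listSize-remove-other v i (fix u i A) w w≢v) (listSize-fix-other u i A w w≢u)))
      ab≤ : suc a₁ * (suc b₂ * M) ≤ suc Q * M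
      ab≤ = ≤-trans (≤-reflexive (≡-sym (*-assoc (suc a₁) (suc b₂) M))) (*-monoˡ-≤ M (≤-trans
        (*-mono-≤ (≤-trans (≤-reflexive a≡) (listSize≤q A u)) (≤-trans (≤-reflexive b≡) (listSize≤q A v))) (≤-reflexive q²≡)))
      lemma : ∀ Q a b M → (1 + Q) * (a * ((1 + b) * M) + 1 * (b * M)) + (1 + Q) * M ≡ Q * ((1 + a) * ((1 + b) * M)) + (1 + a) * ((1 + b) * M)
      lemma = solve-∀

  -- Branching on a colour common to the lists of two adjacent vertices multiplies the product of the list
  -- sizes, summed over both branches, by at most 1 - 1/q².
  disjointify : ∀ Q → q * q ≡ suc Q → ∀ B → (∀ A → Disjoint A → listColourings A ≤ B) → ∀ k A →
    listColourings A * suc Q ^ k ≤ Q ^ k * sizeProduct A + 2 ^ k * (suc Q ^ k * B)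
  disjointify Q q²≡ B leaf zero A = begin
    listColourings A * 1                 ≤⟨ *-monoˡ-≤ 1 (listColourings≤sizeProduct A) ⟩
    sizeProduct A * 1                    ≡⟨ *-comm _ 1 ⟩
    1 * sizeProduct A                    ≤⟨ m≤m+n _ _ ⟩
    1 * sizeProduct A + 1 * (1 * B)      ∎
    where open ≤-Reasoning
  disjointify Q q²≡ B leaf (suc k) A
    with any? (λ u → any? λ v → any? λ i → (adj G u v Bool.≟ true) ×-dec ((A u i Bool.≟ true) ×-dec (A v i Bool.≟ true)))
  ... | no disjoint = begin
    listColourings A * suc Q ^ suc k                ≤⟨ *-monoˡ-≤ (suc Q ^ suc k) (leaf A λ u v i uv Aui Avi → disjoint (u , v , i , uv , Aui , Avi)) ⟩
    B * suc Q ^ suc k                               ≡⟨ *-comm B _ ⟩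
    suc Q ^ suc k * B                               ≤⟨ m≤n*m _ (2 ^ suc k) {{m^n≢0 2 (suc k)}} ⟩
    2 ^ suc k * (suc Q ^ suc k * B)                 ≤⟨ m≤n+m _ _ ⟩
    _                                               ∎
    where open ≤-Reasoning
  ... | yes (u , v , i , uv , Aui , Avi) = begin
    listColourings A * suc Q ^ suc k
      ≤⟨ *-monoˡ-≤ (suc Q ^ suc k) (conflict-branch A uv Aui Avi) ⟩
    (listColourings A₁ + listColourings A₂) * suc Q ^ suc k
      ≡⟨ distribute (listColourings A₁) (listColourings A₂) (suc Q) (suc Q ^ k) ⟩
    suc Q * (listColourings A₁ * suc Q ^ k + listColourings A₂ * suc Q ^ k)
      ≤⟨ *-monoʳ-≤ (suc Q) (+-mono-≤ (disjointify Q q²≡ B leaf k A₁) (disjointify Q q²≡ B leaf k A₂)) ⟩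
    suc Q * (Q ^ k * sizeProduct A₁ + R + (Q ^ k * sizeProduct A₂ + R))
      ≡⟨ collect (suc Q) (Q ^ k) (sizeProduct A₁) (sizeProduct A₂) (2 ^ k) (suc Q ^ k) B ⟩
    Q ^ k * (suc Q * (sizeProduct A₁ + sizeProduct A₂)) + 2 ^ suc k * (suc Q ^ suc k * B)
      ≤⟨ +-monoˡ-≤ _ (*-monoʳ-≤ (Q ^ k) (conflict-sizes A uv Aui Avi Q q²≡)) ⟩
    Q ^ k * (Q * sizeProduct A) + 2 ^ suc k * (suc Q ^ suc k * B)
      ≡⟨ cong (_+ 2 ^ suc k * (suc Q ^ suc k * B)) (rotate (Q ^ k) Q (sizeProduct A)) ⟩
    Q ^ suc k * sizeProduct A + 2 ^ suc k * (suc Q ^ suc k * B) ∎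
    where
    open ≤-Reasoning
    A₁ = remove (is u) i A
    A₂ = remove (is v) i (fix u i A)
    R  = 2 ^ k * (suc Q ^ k * B)
    distribute : ∀ x y q p → (x + y) * (q * p) ≡ q * (x * p + y * p)
    distribute = solve-∀
    collect : ∀ Q p x y t s b → Q * (p * x + t * (s * b) + (p * y + t * (s * b))) ≡ p * (Q * (x + y)) + 2 * t * (Q * s * b)
    collect = solve-∀
    rotate : ∀ p q x → p * (q * x) ≡ q * p * x
    rotate = solve-∀

-- List sizes of sparse and of disjoint lists

-- In other words a² ≤ η (1 + 1/h)^(2a - q): the chord of log through h and h+1 takes the value (log
-- η)/2 at q/2, for either parity of q.
chord-η : ∀ q a → let h = q / 2 in a ^ 2 * (h ^ (2 * a) * suc h ^ q) ≤ η q * (suc h ^ (2 * a) * h ^ q)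
chord-η q a = by-parity (halves q)
  where
  open ≤-Reasoning
  h = q / 2
  H = suc h
  squared : a ^ 2 * (h ^ (2 * a) * (H ^ h * H ^ h)) ≤ h * h * (H ^ (2 * a) * (h ^ h * h ^ h))
  squared = begin
    a ^ 2 * (h ^ (2 * a) * (H ^ h * H ^ h))              ≡⟨ cong (λ x → a ^ 2 * (x * (H ^ h * H ^ h))) (power-double h a) ⟩
    a ^ 2 * (h ^ a * h ^ a * (H ^ h * H ^ h))            ≡⟨ lemma₁ a (h ^ a) (H ^ h) ⟩
    a * (h ^ a * H ^ h) * (a * (h ^ a * H ^ h))          ≤⟨ *-mono-≤ (log-chord h a) (log-chord h a) ⟩
    h * h ^ h * H ^ a * (h * h ^ h * H ^ a)              ≡⟨ lemma₂ h (h ^ h) (H ^ a) ⟩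
    h * h * (H ^ a * H ^ a * (h ^ h * h ^ h))            ≡⟨ cong (λ x → h * h * (x * (h ^ h * h ^ h))) (power-double H a) ⟨
    h * h * (H ^ (2 * a) * (h ^ h * h ^ h))              ∎
    where
    power-double : ∀ x a → x ^ (2 * a) ≡ x ^ a * x ^ a
    power-double x a = trans (^-distribˡ-+-* x a (a + 0)) (cong (λ k → x ^ a * x ^ k) (+-identityʳ a))
    lemma₁ : ∀ a x y → a * (a * 1) * (x * x * (y * y)) ≡ a * (x * y) * (a * (x * y))
    lemma₁ = solve-∀
    lemma₂ : ∀ h x y → h * x * y * (h * x * y) ≡ h * h * (y * y * (x * x))
    lemma₂ = solve-∀
  by-parity : Halves q → a ^ 2 * (h ^ (2 * a) * H ^ q) ≤ η q * (H ^ (2 * a) * h ^ q)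
  by-parity (even _ q≡ e) = begin
    a ^ 2 * (h ^ (2 * a) * H ^ q)                    ≡⟨ cong (λ x → a ^ 2 * (h ^ (2 * a) * x)) (trans (cong (H ^_) q≡) (^-distribˡ-+-* H h h)) ⟩
    a ^ 2 * (h ^ (2 * a) * (H ^ h * H ^ h))          ≤⟨ squared ⟩
    h * h * (H ^ (2 * a) * (h ^ h * h ^ h))          ≡⟨ cong₂ (λ y x → h * y * (H ^ (2 * a) * x)) e (trans (cong (h ^_) q≡) (^-distribˡ-+-* h h h)) ⟨
    η q * (H ^ (2 * a) * h ^ q)                      ∎
  by-parity (odd _ q≡ e) = begin
    a ^ 2 * (h ^ (2 * a) * H ^ q)                    ≡⟨ cong (λ x → a ^ 2 * (h ^ (2 * a) * x)) (trans (cong (H ^_) q≡) (^-distribˡ-+-* H h H)) ⟩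
    a ^ 2 * (h ^ (2 * a) * (H ^ h * (H * H ^ h)))    ≡⟨ lemma₁ (a ^ 2) (h ^ (2 * a)) (H ^ h) H ⟩
    H * (a ^ 2 * (h ^ (2 * a) * (H ^ h * H ^ h)))    ≤⟨ *-monoʳ-≤ H squared ⟩
    H * (h * h * (H ^ (2 * a) * (h ^ h * h ^ h)))    ≡⟨ lemma₂ H h (H ^ (2 * a)) (h ^ h) ⟩
    h * H * (H ^ (2 * a) * (h ^ h * (h * h ^ h)))    ≡⟨ cong₂ (λ y x → h * y * (H ^ (2 * a) * x)) e (trans (cong (h ^_) q≡) (^-distribˡ-+-* h h H)) ⟨
    η q * (H ^ (2 * a) * h ^ q)                      ∎
    where
    lemma₁ : ∀ a x y z → a * (x * (y * (z * y))) ≡ z * (a * (x * (y * y)))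
    lemma₁ = solve-∀
    lemma₂ : ∀ H h x y → H * (h * h * (x * (y * y))) ≡ h * H * (x * (y * (h * y)))
    lemma₂ = solve-∀

-- (1 + 1/h)^h ≥ 2 and q ≥ 2h. The 4 will absorb two losses of 2^n in `independence-saving`.
4*[q/2]^q≤ : ∀ {q} → 3 ≤ q → 4 * (q / 2) ^ q ≤ suc (q / 2) ^ q
4*[q/2]^q≤ {q} 3≤q = by-parity (halves q)
  where
  open ≤-Reasoning
  h = q / 2
  H = suc h
  doubled : 4 * (h ^ h * h ^ h) ≤ H ^ h * H ^ h
  doubled = ≤-trans (≤-reflexive (lemma (h ^ h))) (*-mono-≤ growth growth)
    where
    lemma : ∀ x → 4 * (x * x) ≡ 2 * x * (2 * x)
    lemma = solve-∀
    growth : 2 * h ^ h ≤ H ^ h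
    growth = power-growth h h 2 {{>-nonZero (1≤q/2 3≤q)}} (≤-reflexive (cong (h +_) (+-identityʳ h)))
  by-parity : Halves q → 4 * h ^ q ≤ H ^ q
  by-parity (even _ q≡ _) = subst (λ q → 4 * h ^ q ≤ H ^ q) (≡-sym q≡)
    (subst₂ (λ x y → 4 * x ≤ y) (≡-sym (^-distribˡ-+-* h h h)) (≡-sym (^-distribˡ-+-* H h h)) doubled)
  by-parity (odd _ q≡ _) = subst (λ q → 4 * h ^ q ≤ H ^ q) (≡-sym q≡) (begin
    4 * h ^ (h + suc h)           ≡⟨ cong (4 *_) (^-distribˡ-+-* h h H) ⟩
    4 * (h ^ h * (h * h ^ h))     ≡⟨ lemma h (h ^ h) ⟩
    h * (4 * (h ^ h * h ^ h))     ≤⟨ *-mono-≤ (n≤1+n h) doubled ⟩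
    H * (H ^ h * H ^ h)           ≡⟨ lemma′ H (H ^ h) ⟩
    H ^ h * (H * H ^ h)           ≡⟨ ^-distribˡ-+-* H h H ⟨
    H ^ (h + suc h)               ∎)
    where
    lemma : ∀ h x → 4 * (x * (h * x)) ≡ h * (4 * (x * x))
    lemma = solve-∀
    lemma′ : ∀ h x → h * (x * x) ≡ x * (h * x)
    lemma′ = solve-∀

-- The hypothesis reads x ≤ y (1 + 1/h)^(E - N), written so that no exponent is negative; here E - N
-- is at most M, and in `chord-deficit` at most -M.
chord-excess : ∀ h E N M x y .{{_ : NonZero h}} → E ≤ N + M →
  x * (h ^ E * suc h ^ N) ≤ y * (suc h ^ E * h ^ N) → x * h ^ M ≤ y * suc h ^ M
chord-excess h E N M x y E≤ hyp = *-cancelʳ-≤ _ _ (h ^ N * H ^ N) {{m*n≢0 _ _ {{m^n≢0 h N}} {{m^n≢0 H N}}}} (begin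
  x * h ^ M * (h ^ N * H ^ N)         ≡⟨ lemma₁ x (h ^ M) (h ^ N) (H ^ N) ⟩
  x * (h ^ N * h ^ M * H ^ N)         ≡⟨ cong (λ w → x * (w * H ^ N)) (split h) ⟨
  x * (h ^ E * h ^ k * H ^ N)         ≡⟨ lemma₂ x (h ^ E) (h ^ k) (H ^ N) ⟩
  x * (h ^ E * H ^ N) * h ^ k         ≤⟨ *-mono-≤ hyp (^-monoˡ-≤ k (n≤1+n h)) ⟩
  y * (H ^ E * h ^ N) * H ^ k         ≡⟨ lemma₂ y (H ^ E) (H ^ k) (h ^ N) ⟨
  y * (H ^ E * H ^ k * h ^ N)         ≡⟨ cong (λ w → y * (w * h ^ N)) (split H) ⟩
  y * (H ^ N * H ^ M * h ^ N)         ≡⟨ lemma₃ y (H ^ M) (h ^ N) (H ^ N) ⟨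
  y * H ^ M * (h ^ N * H ^ N)         ∎)
  where
  open ≤-Reasoning
  H = suc h
  k = N + M ∸ E
  split : ∀ z → z ^ E * z ^ k ≡ z ^ N * z ^ M
  split z = trans (≡-sym (^-distribˡ-+-* z E k)) (trans (cong (z ^_) (m+[n∸m]≡n E≤)) (^-distribˡ-+-* z N M))
  lemma₁ : ∀ x a b c → x * a * (b * c) ≡ x * (b * a * c)
  lemma₁ = solve-∀
  lemma₂ : ∀ x a b c → x * (a * b * c) ≡ x * (a * c) * b
  lemma₂ = solve-∀
  lemma₃ : ∀ x a b c → x * a * (b * c) ≡ x * (c * a * b)
  lemma₃ = solve-∀

chord-deficit : ∀ h E N M x y .{{_ : NonZero h}} → E + M ≤ N →
  x * (h ^ E * suc h ^ N) ≤ y * (suc h ^ E * h ^ N) → x * suc h ^ M ≤ y * h ^ M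
chord-deficit h E N M x y E+M≤ hyp =
  *-cancelʳ-≤ _ _ (h ^ k * (h ^ E * H ^ E)) {{m*n≢0 _ _ {{m^n≢0 h k}} {{m*n≢0 _ _ {{m^n≢0 h E}} {{m^n≢0 H E}}}}}} (begin
  x * H ^ M * (h ^ k * (h ^ E * H ^ E))    ≤⟨ *-monoʳ-≤ (x * H ^ M) (*-monoˡ-≤ (h ^ E * H ^ E) (^-monoˡ-≤ k (n≤1+n h))) ⟩
  x * H ^ M * (H ^ k * (h ^ E * H ^ E))    ≡⟨ lemma₁ x (H ^ M) (H ^ k) (h ^ E) (H ^ E) ⟩
  x * (h ^ E * (H ^ E * H ^ M * H ^ k))    ≡⟨ cong (λ w → x * (h ^ E * w)) (split H) ⟨
  x * (h ^ E * H ^ N)                      ≤⟨ hyp ⟩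
  y * (H ^ E * h ^ N)                      ≡⟨ cong (λ w → y * (H ^ E * w)) (split h) ⟩
  y * (H ^ E * (h ^ E * h ^ M * h ^ k))    ≡⟨ lemma₂ y (h ^ M) (h ^ k) (h ^ E) (H ^ E) ⟨
  y * h ^ M * (h ^ k * (h ^ E * H ^ E))    ∎)
  where
  open ≤-Reasoning
  H = suc h
  k = N ∸ (E + M)
  split : ∀ z → z ^ N ≡ z ^ E * z ^ M * z ^ k
  split z = trans (cong (z ^_) (≡-sym (m+[n∸m]≡n E+M≤))) (trans (^-distribˡ-+-* z (E + M) k) (cong (_* z ^ k) (^-distribˡ-+-* z E M)))
  lemma₁ : ∀ x m k a b → x * m * (k * (a * b)) ≡ x * (a * (b * m * k))
  lemma₁ = solve-∀
  lemma₂ : ∀ x m k a b → x * m * (k * (a * b)) ≡ x * (b * (a * m * k))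
  lemma₂ = solve-∀

module _ {n : ℕ} {q : ℕ} (3≤q : 3 ≤ q) (G : Graph n) where

  private
    h H : ℕ
    h = q / 2
    H = suc h
    instance
      h≢0 : NonZero h
      h≢0 = >-nonZero (1≤q/2 3≤q)
    Lists = ColourLists q G
    Φ μ : Lists → ℕ
    Φ = sizeSum q G
    μ = sizeProduct q G

  -- This is where a bound on the sum of the list sizes becomes one on their product: over all
  -- vertices the exponents 2a - q of `chord-η` add up to `2 * Φ A` - qn. The power `k` clears the
  -- denominator in the later bounds on `Φ A`.
  sizeProduct-chord : ∀ A k → μ A ^ (2 * k) * (h ^ (2 * Φ A * k) * H ^ (q * n * k)) ≤ η q ^ (n * k) * (H ^ (2 * Φ A * k) * h ^ (q * n * k))
  sizeProduct-chord A k = subst₂ _≤_ (raise (μ A) 2 (h ^ (2 * Φ A)) (H ^ (q * n)) (^-*-assoc h (2 * Φ A) k) (^-*-assoc H (q * n) k))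
                                     (raise (η q) n (H ^ (2 * Φ A)) (h ^ (q * n)) (^-*-assoc H (2 * Φ A) k) (^-*-assoc h (q * n) k))
                                     (^-monoˡ-≤ k base)
    where
    raise : ∀ a l x y {x′ y′} → x ^ k ≡ x′ → y ^ k ≡ y′ → (a ^ l * (x * y)) ^ k ≡ a ^ (l * k) * (x′ * y′)
    raise a l x y refl refl = trans (^-distribʳ-* (a ^ l) (x * y) k) (cong₂ _*_ (^-*-assoc a l k) (^-distribʳ-* x y k))
    s = listSize q G A
    ∏-factors : ∀ (f : Fin n → ℕ) z w → ∏ (allFin n) (λ v → f v * (z ^ (2 * s v) * w ^ q)) ≡ ∏ (allFin n) f * (z ^ (2 * Φ A) * w ^ (q * n))
    ∏-factors f z w = trans (∏-* (allFin n) f _) (cong (∏ (allFin n) f *_) (trans (∏-* (allFin n) _ _) (cong₂ _*_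
      (trans (∏-exp (allFin n) z λ v → 2 * s v) (cong (z ^_) (∑-*ˡ (allFin n) 2 s)))
      (trans (∏-const (allFin n) (w ^ q)) (trans (cong ((w ^ q) ^_) (length-allFin n)) (^-*-assoc w q n))))))
    base : μ A ^ 2 * (h ^ (2 * Φ A) * H ^ (q * n)) ≤ η q ^ n * (H ^ (2 * Φ A) * h ^ (q * n))
    base = subst₂ _≤_ (trans (∏-factors (λ v → s v ^ 2) h H) (cong (_* (h ^ (2 * Φ A) * H ^ (q * n))) (∏-^ (allFin n) s 2)))
                      (trans (∏-factors (λ _ → η q) H h) (cong (_* (H ^ (2 * Φ A) * h ^ (q * n))) (trans (∏-const (allFin n) (η q)) (cong (η q ^_) (length-allFin n)))))
                      (∏-mono (allFin n) λ v → chord-η q (s v))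

  sizeSum-by-colour : ∀ A → Φ A ≡ ∑ (allFin q) (λ i → count (λ v → A v i) (allFin n))
  sizeSum-by-colour A = ∑-swap (allFin n) (allFin q) (λ v i → ind (A v i))

  -- Double counting for each colour: the class sends out |class| d adjacencies, a vertex inside the
  -- class receives fewer than φ of them and one outside at most d. So a class exceeds n/2 by at
  -- most nφ/(2d).
  sparse⇒sizeSum≤ : ∀ {d φ} → Regular d G → ∀ A → Sparse q G φ A → 2 * Φ A * d ≤ q * (n * (φ + d))
  sparse⇒sizeSum≤ {d} {φ} reg A sparse = begin
    2 * Φ A * d                                                          ≡⟨ cong (λ x → 2 * x * d) (sizeSum-by-colour A) ⟩
    2 * ∑ (allFin q) class * d                                               ≡⟨ trans (∑-*ʳ (allFin q) (λ i → 2 * class i) d) (cong (_* d) (∑-*ˡ (allFin q) 2 class)) ⟨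
    ∑ (allFin q) (λ i → 2 * class i * d)                                     ≤⟨ ∑-mono (allFin q) class≤ ⟩
    ∑ (allFin q) (λ _ → n * (φ + d))                                     ≡⟨ trans (∑-const (allFin q) _) (cong (_* (n * (φ + d))) (length-allFin q)) ⟩
    q * (n * (φ + d))                                                    ∎
    where
    open ≤-Reasoning
    class : Fin q → ℕ
    class i = count (λ v → A v i) (allFin n)
    class≤ : ∀ i → 2 * class i * d ≤ n * (φ + d)
    class≤ i = begin
      2 * class i * d                                                        ≡⟨ lemma (class i) d ⟩
      class i * d + d * class i                                                  ≡⟨ cong₂ _+_ edges (∑-*ˡ (allFin n) d λ u → ind (A u i)) ⟨
      ∑ (allFin n) near + ∑ (allFin n) (λ u → d * ind (A u i))           ≡⟨ ∑-+ (allFin n) near _ ⟨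
      ∑ (allFin n) (λ u → near u + d * ind (A u i))                      ≤⟨ ∑-mono (allFin n) pointwise ⟩
      ∑ (allFin n) (λ _ → φ + d)                                         ≡⟨ trans (∑-const (allFin n) _) (cong (_* (φ + d)) (length-allFin n)) ⟩
      n * (φ + d)                                                        ∎
      where
      lemma : ∀ c d → 2 * c * d ≡ c * d + d * c
      lemma = solve-∀
      near : Fin n → ℕ
      near u = count (λ w → adj G u w ∧ A w i) (allFin n)
      pointwise : ∀ u → near u + d * ind (A u i) ≤ φ + d
      pointwise u with A u i in Aui
      ... | true  = +-mono-≤ (<⇒≤ (sparse u i Aui)) (≤-reflexive (*-identityʳ d))
      ... | false = ≤-trans (≤-reflexive (trans (cong (near u +_) (*-zeroʳ d)) (+-identityʳ _))) (≤-trans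
        (≤-trans (∑-mono (allFin n) λ w → ≤-trans (≤-reflexive (ind-∧ (adj G u w) (A w i)))
                   (≤-trans (*-monoʳ-≤ (ind (adj G u w)) (ind≤1 (A w i))) (≤-reflexive (*-identityʳ _))))
                 (≤-reflexive (count-adj G reg Perm.refl u))) (m≤n+m d φ))
      edges : ∑ (allFin n) near ≡ class i * d
      edges = trans (∑-swap (allFin n) (allFin n) λ u w → ind (adj G u w ∧ A w i))
        (trans (∑-cong (allFin n) λ w → trans (∑-cong (allFin n) λ u → trans (ind-∧ (adj G u w) (A w i))
                   (trans (*-comm (ind (adj G u w)) _) (cong (λ b → ind (A w i) * ind b) (Graph.sym G u w))))
                 (trans (∑-*ˡ (allFin n) (ind (A w i)) λ u → ind (adj G w u)) (cong (ind (A w i) *_) (count-adj G reg Perm.refl w))))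
          (∑-*ʳ (allFin n) (λ w → ind (A w i)) d))

  sparse⇒sizeProduct≤ : ∀ {d φ} → Regular d G → ∀ A → Sparse q G φ A → μ A ^ (2 * d) ≤ η q ^ (n * d) * 2 ^ (q * n * φ)
  sparse⇒sizeProduct≤ {d} {φ} reg A sparse = *-cancelʳ-≤ _ _ (h ^ M) {{m^n≢0 h M}} (begin
    μ A ^ (2 * d) * h ^ M                  ≤⟨ chord-excess h (2 * Φ A * d) (q * n * d) M (μ A ^ (2 * d)) (η q ^ (n * d)) (≤-trans (sparse⇒sizeSum≤ reg A sparse) (≤-reflexive (lemma q n φ d))) (sizeProduct-chord A d) ⟩
    η q ^ (n * d) * H ^ M                  ≤⟨ *-monoʳ-≤ (η q ^ (n * d)) (^-monoˡ-≤ M H≤2h) ⟩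
    η q ^ (n * d) * (2 * h) ^ M            ≡⟨ cong (η q ^ (n * d) *_) (^-distribʳ-* 2 h M) ⟩
    η q ^ (n * d) * (2 ^ M * h ^ M)        ≡⟨ *-assoc (η q ^ (n * d)) _ _ ⟨
    η q ^ (n * d) * 2 ^ M * h ^ M          ∎)
    where
    open ≤-Reasoning
    M = q * n * φ
    lemma : ∀ q n φ d → q * (n * (φ + d)) ≡ q * n * d + q * n * φ
    lemma = solve-∀
    H≤2h : H ≤ 2 * h
    H≤2h = ≤-trans (+-monoˡ-≤ h (1≤q/2 3≤q)) (≤-reflexive (cong (h +_) (≡-sym (+-identityʳ h))))

  disjoint⇒sizeProduct≤ : ∀ e → (∀ I → Independent G I → 2 * e * count I (allFin n) + n < e * n) →
    ∀ A → Disjoint q G A → μ A ^ (2 * e) * H ^ (q * n) ≤ η q ^ (n * e) * h ^ (q * n)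
  disjoint⇒sizeProduct≤ e small A disjoint =
    chord-deficit h (2 * Φ A * e) (q * n * e) (q * n) (μ A ^ (2 * e)) (η q ^ (n * e)) sizes (sizeProduct-chord A e)
    where
    open ≤-Reasoning
    class : Fin q → ℕ
    class i = count (λ v → A v i) (allFin n)
    sizes : 2 * Φ A * e + q * n ≤ q * n * e
    sizes = begin
      2 * Φ A * e + q * n                            ≡⟨ cong (_+ q * n) (trans (cong (λ x → 2 * x * e) (sizeSum-by-colour A)) (lemma (∑ (allFin q) class) e)) ⟩
      2 * e * ∑ (allFin q) class + q * n                 ≡⟨ cong₂ _+_ (∑-*ˡ (allFin q) (2 * e) class) (trans (∑-const (allFin q) n) (cong (_* n) (length-allFin q))) ⟨
      ∑ (allFin q) (λ i → 2 * e * class i) + ∑ (allFin q) (λ _ → n)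
                                                     ≡⟨ ∑-+ (allFin q) _ _ ⟨
      ∑ (allFin q) (λ i → 2 * e * class i + n)           ≤⟨ ∑-mono (allFin q) (λ i → <⇒≤ (small (λ v → A v i) λ u v Aui Avi → nonadjacent u v i Aui Avi)) ⟩
      ∑ (allFin q) (λ _ → e * n)                     ≡⟨ trans (∑-const (allFin q) (e * n)) (cong (_* (e * n)) (length-allFin q)) ⟩
      q * (e * n)                                    ≡⟨ lemma′ q n e ⟩
      q * n * e                                      ∎
      where
      lemma : ∀ c e → 2 * c * e ≡ 2 * e * c
      lemma = solve-∀
      lemma′ : ∀ q n e → q * (e * n) ≡ q * n * e
      lemma′ = solve-∀
      nonadjacent : ∀ u v i → A u i ≡ true → A v i ≡ true → adj G u v ≡ false
      nonadjacent u v i Aui Avi with adj G u v in uv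
      ... | false = refl
      ... | true  = ⊥-elim (disjoint u v i uv Aui Avi)

-- Exponential savings against losses.

-- The case in which `k` branchings dominate. At the power E = dgL, the factor 2, the excess of
-- sparse list sizes and the cost of sparsification are at most 2^(nd) each, while the branchings
-- save at least 9^(nd), more than the 8^(nd) required.
conflict-saving : ∀ {T μ N n d k g L q φ t Q} .{{_ : NonZero d}} .{{_ : NonZero g}} .{{_ : NonZero L}} →
  T * suc Q ^ k ≤ 2 * (Q ^ k * μ) → μ ^ (2 * d) ≤ N ^ (n * d) * 2 ^ (q * n * φ) → n ≤ k * g →
  2 * (g * L) ≤ n → q * φ * (g * L) ≤ d → 9 * Q ^ (2 * L) ≤ suc Q ^ (2 * L) →
  suc t ^ (2 * (q * (g * L))) ≤ 2 * t ^ (2 * (q * (g * L))) →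
  T ^ 2 * suc t ^ (2 * (q * n)) ≤ N ^ n * t ^ (2 * (q * n))
conflict-saving {T} {μ} {N} {n} {d} {k} {g} {L} {q} {φ} {t} {Q} T≤ μ≤ n≤kg n-large d-large Q-growth t-growth =
  ^-cancelʳ-≤ E {{E≢0}} (begin
    (T ^ 2 * suc t ^ (2 * (q * n))) ^ E               ≡⟨ ^-distribʳ-* (T ^ 2) _ E ⟩
    (T ^ 2) ^ E * (suc t ^ (2 * (q * n))) ^ E         ≡⟨ cong₂ _*_ (^-*-assoc T 2 E) (regroup (suc t)) ⟩
    T ^ (2 * E) * (suc t ^ (2 * (q * (g * L)))) ^ (n * d) ≤⟨ *-monoʳ-≤ (T ^ (2 * E)) (^-monoˡ-≤ (n * d) t-growth) ⟩
    T ^ (2 * E) * (2 * t ^ (2 * (q * (g * L)))) ^ (n * d) ≡⟨ cong (T ^ (2 * E) *_) (trans (^-distribʳ-* 2 _ (n * d)) (cong (2 ^ (n * d) *_) (≡-sym (regroup t)))) ⟩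
    T ^ (2 * E) * (2 ^ (n * d) * (t ^ (2 * (q * n))) ^ E) ≡⟨ *-assoc (T ^ (2 * E)) _ _ ⟨
    T ^ (2 * E) * 2 ^ (n * d) * (t ^ (2 * (q * n))) ^ E   ≤⟨ *-monoˡ-≤ _ core ⟩
    N ^ (n * E) * (t ^ (2 * (q * n))) ^ E             ≡⟨ cong (_* (t ^ (2 * (q * n))) ^ E) (^-*-assoc N n E) ⟨
    (N ^ n) ^ E * (t ^ (2 * (q * n))) ^ E             ≡⟨ ^-distribʳ-* (N ^ n) _ E ⟨
    (N ^ n * t ^ (2 * (q * n))) ^ E                   ∎)
  where
  open ≤-Reasoning
  E = d * (g * L)
  E≢0 : NonZero E
  E≢0 = m*n≢0 d (g * L)
    where instance
      gL≢0 : NonZero (g * L)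
      gL≢0 = m*n≢0 g L
  Z = 2 ^ (n * d)
  regroup : ∀ x → (x ^ (2 * (q * n))) ^ E ≡ (x ^ (2 * (q * (g * L)))) ^ (n * d)
  regroup x = trans (^-normalize x (2 * (q * n)) E _ (lemma n d q (g * L))) (≡-sym (^-*-assoc x (2 * (q * (g * L))) (n * d)))
    where
    lemma : ∀ n d q gL → 2 * (q * n) * (d * gL) ≡ 2 * (q * gL) * (n * d)
    lemma = solve-∀
  μ-power : μ ^ (2 * E) ≤ N ^ (n * E) * Z
  μ-power = begin
    μ ^ (2 * E)                                       ≡⟨ ^-normalize μ (2 * d) (g * L) _ (*-assoc 2 d (g * L)) ⟨
    (μ ^ (2 * d)) ^ (g * L)                           ≤⟨ ^-monoˡ-≤ (g * L) μ≤ ⟩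
    (N ^ (n * d) * 2 ^ (q * n * φ)) ^ (g * L)         ≡⟨ trans (^-distribʳ-* (N ^ (n * d)) _ (g * L)) (cong₂ _*_ (^-normalize N (n * d) (g * L) _ (*-assoc n d (g * L))) (^-*-assoc 2 (q * n * φ) (g * L))) ⟩
    N ^ (n * E) * 2 ^ (q * n * φ * (g * L))           ≤⟨ *-monoʳ-≤ (N ^ (n * E)) (^-monoʳ {2} (s≤s z≤n) (≤-trans (≤-reflexive (lemma q n φ (g * L))) (*-monoʳ-≤ n d-large))) ⟩
    N ^ (n * E) * Z                                   ∎
    where
    lemma : ∀ q n φ x → q * n * φ * x ≡ n * (q * φ * x)
    lemma = solve-∀
  Q-power : 9 ^ (n * d) * Q ^ (k * (2 * E)) ≤ suc Q ^ (k * (2 * E))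
  Q-power = begin
    9 ^ (n * d) * Q ^ (k * (2 * E))                   ≡⟨ cong (9 ^ (n * d) *_) (split Q) ⟩
    9 ^ (n * d) * ((Q ^ (2 * L)) ^ (n * d) * Q ^ w)   ≡⟨ *-assoc (9 ^ (n * d)) _ _ ⟨
    9 ^ (n * d) * (Q ^ (2 * L)) ^ (n * d) * Q ^ w     ≡⟨ cong (_* Q ^ w) (^-distribʳ-* 9 _ (n * d)) ⟨
    (9 * Q ^ (2 * L)) ^ (n * d) * Q ^ w               ≤⟨ *-mono-≤ (^-monoˡ-≤ (n * d) Q-growth) (^-monoˡ-≤ w (n≤1+n Q)) ⟩
    (suc Q ^ (2 * L)) ^ (n * d) * suc Q ^ w           ≡⟨ split (suc Q) ⟨
    suc Q ^ (k * (2 * E))                             ∎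
    where
    -- Rounding `k` up makes `k * g` overshoot `n`; `w` is the surplus in the exponent, where only Q
    -- ≤ Q + 1 is used.
    w = 2 * (L * d) * (k * g ∸ n)
    exponent : 2 * L * (n * d) + w ≡ k * (2 * E)
    exponent = begin-equality
      2 * L * (n * d) + 2 * (L * d) * (k * g ∸ n)     ≡⟨ lemma L n d (k * g ∸ n) ⟩
      2 * (L * d) * (n + (k * g ∸ n))                 ≡⟨ cong (2 * (L * d) *_) (m+[n∸m]≡n n≤kg) ⟩
      2 * (L * d) * (k * g)                           ≡⟨ lemma′ L d k g ⟩
      k * (2 * E)                                     ∎
      where
      lemma : ∀ L n d x → 2 * L * (n * d) + 2 * (L * d) * x ≡ 2 * (L * d) * (n + x)
      lemma = solve-∀
      lemma′ : ∀ L d k g → 2 * (L * d) * (k * g) ≡ k * (2 * (d * (g * L)))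
      lemma′ = solve-∀
    split : ∀ x → x ^ (k * (2 * E)) ≡ (x ^ (2 * L)) ^ (n * d) * x ^ w
    split x = trans (cong (x ^_) (≡-sym exponent)) (trans (^-distribˡ-+-* x (2 * L * (n * d)) w) (cong (_* x ^ w) (≡-sym (^-*-assoc x (2 * L) (n * d)))))
  T-power : T ^ (2 * E) * suc Q ^ (k * (2 * E)) ≤ Z * Z * N ^ (n * E) * Q ^ (k * (2 * E))
  T-power = begin
    T ^ (2 * E) * suc Q ^ (k * (2 * E))               ≡⟨ trans (^-distribʳ-* T _ (2 * E)) (cong (T ^ (2 * E) *_) (^-*-assoc (suc Q) k (2 * E))) ⟨
    (T * suc Q ^ k) ^ (2 * E)                         ≤⟨ ^-monoˡ-≤ (2 * E) T≤ ⟩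
    (2 * (Q ^ k * μ)) ^ (2 * E)                       ≡⟨ trans (^-distribʳ-* 2 _ (2 * E)) (cong (2 ^ (2 * E) *_) (trans (^-distribʳ-* (Q ^ k) μ (2 * E)) (cong (_* μ ^ (2 * E)) (^-*-assoc Q k (2 * E))))) ⟩
    2 ^ (2 * E) * (Q ^ (k * (2 * E)) * μ ^ (2 * E))   ≤⟨ *-mono-≤ (^-monoʳ {2} (s≤s z≤n) 2E≤nd) (*-monoʳ-≤ (Q ^ (k * (2 * E))) μ-power) ⟩
    Z * (Q ^ (k * (2 * E)) * (N ^ (n * E) * Z))       ≡⟨ lemma Z (Q ^ (k * (2 * E))) (N ^ (n * E)) ⟩
    Z * Z * N ^ (n * E) * Q ^ (k * (2 * E))           ∎
    where
    lemma : ∀ z x y → z * (x * (y * z)) ≡ z * z * y * x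
    lemma = solve-∀
    2E≤nd : 2 * E ≤ n * d
    2E≤nd = ≤-trans (≤-reflexive (lemma′ d (g * L))) (*-monoˡ-≤ d n-large)
      where
      lemma′ : ∀ d x → 2 * (d * x) ≡ 2 * x * d
      lemma′ = solve-∀
  core : T ^ (2 * E) * Z ≤ N ^ (n * E)
  core = *-cancelʳ-≤ _ _ (Z * Z * suc Q ^ (k * (2 * E))) {{m*n≢0 _ _ {{m*n≢0 Z Z {{Z≢0}} {{Z≢0}}}} {{m^n≢0 (suc Q) (k * (2 * E))}}}} (begin
    T ^ (2 * E) * Z * (Z * Z * suc Q ^ (k * (2 * E)))     ≡⟨ lemma (T ^ (2 * E)) Z (suc Q ^ (k * (2 * E))) ⟩
    Z * (Z * Z) * (T ^ (2 * E) * suc Q ^ (k * (2 * E)))   ≤⟨ *-mono-≤ 8≤9 T-power ⟩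
    9 ^ (n * d) * (Z * Z * N ^ (n * E) * Q ^ (k * (2 * E))) ≡⟨ lemma′ (9 ^ (n * d)) (Z * Z) (N ^ (n * E)) (Q ^ (k * (2 * E))) ⟩
    N ^ (n * E) * (Z * Z * (9 ^ (n * d) * Q ^ (k * (2 * E)))) ≤⟨ *-monoʳ-≤ (N ^ (n * E)) (*-monoʳ-≤ (Z * Z) Q-power) ⟩
    N ^ (n * E) * (Z * Z * suc Q ^ (k * (2 * E)))         ∎)
    where
    Z≢0 : NonZero Z
    Z≢0 = m^n≢0 2 (n * d)
    8≤9 : Z * (Z * Z) ≤ 9 ^ (n * d)
    8≤9 = ≤-trans (≤-reflexive (≡-sym (trans (^-distribʳ-* 2 4 (n * d)) (cong (Z *_) (^-distribʳ-* 2 2 (n * d)))))) (^-monoˡ-≤ (n * d) (n≤1+n 8))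
    lemma : ∀ t z x → t * z * (z * z * x) ≡ z * (z * z) * (t * x)
    lemma = solve-∀
    lemma′ : ∀ a z n x → a * (z * n * x) ≡ n * (z * (a * x))
    lemma′ = solve-∀

-- The case in which disjoint leaves dominate. At the power e, the number of leaves and the cost of
-- sparsification are at most 2^n each, and the small colour classes save (1 + 1/h)^(qn) ≥ 4^n.
independence-saving : ∀ {T B N n k e q h t} .{{_ : NonZero e}} .{{_ : NonZero h}} →
  T ≤ 2 ^ suc k * B → B ^ (2 * e) * suc h ^ (q * n) ≤ N ^ (n * e) * h ^ (q * n) → 4 * h ^ q ≤ suc h ^ q →
  suc k * (2 * e) ≤ n → suc t ^ (2 * (q * e)) ≤ 2 * t ^ (2 * (q * e)) →
  T ^ 2 * suc t ^ (2 * (q * n)) ≤ N ^ n * t ^ (2 * (q * n))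
independence-saving {T} {B} {N} {n} {k} {e} {q} {h} {t} T≤ B≤ h-growth k-small t-growth = ^-cancelʳ-≤ e (begin
    (T ^ 2 * suc t ^ (2 * (q * n))) ^ e               ≡⟨ ^-distribʳ-* (T ^ 2) _ e ⟩
    (T ^ 2) ^ e * (suc t ^ (2 * (q * n))) ^ e         ≡⟨ cong₂ _*_ (^-*-assoc T 2 e) (regroup (suc t)) ⟩
    T ^ (2 * e) * (suc t ^ (2 * (q * e))) ^ n         ≤⟨ *-monoʳ-≤ (T ^ (2 * e)) (^-monoˡ-≤ n t-growth) ⟩
    T ^ (2 * e) * (2 * t ^ (2 * (q * e))) ^ n         ≡⟨ cong (T ^ (2 * e) *_) (trans (^-distribʳ-* 2 _ n) (cong (2 ^ n *_) (≡-sym (regroup t)))) ⟩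
    T ^ (2 * e) * (2 ^ n * (t ^ (2 * (q * n))) ^ e)   ≡⟨ *-assoc (T ^ (2 * e)) _ _ ⟨
    T ^ (2 * e) * 2 ^ n * (t ^ (2 * (q * n))) ^ e     ≤⟨ *-monoˡ-≤ _ core ⟩
    N ^ (n * e) * (t ^ (2 * (q * n))) ^ e             ≡⟨ cong (_* (t ^ (2 * (q * n))) ^ e) (^-*-assoc N n e) ⟨
    (N ^ n) ^ e * (t ^ (2 * (q * n))) ^ e             ≡⟨ ^-distribʳ-* (N ^ n) _ e ⟨
    (N ^ n * t ^ (2 * (q * n))) ^ e                   ∎)
  where
  open ≤-Reasoning
  regroup : ∀ x → (x ^ (2 * (q * n))) ^ e ≡ (x ^ (2 * (q * e))) ^ n
  regroup x = trans (^-normalize x (2 * (q * n)) e _ (lemma q n e)) (≡-sym (^-*-assoc x (2 * (q * e)) n))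
    where
    lemma : ∀ q n e → 2 * (q * n) * e ≡ 2 * (q * e) * n
    lemma = solve-∀
  core : T ^ (2 * e) * 2 ^ n ≤ N ^ (n * e)
  core = *-cancelʳ-≤ _ _ (h ^ (q * n)) {{m^n≢0 h (q * n)}} (begin
    T ^ (2 * e) * 2 ^ n * h ^ (q * n)                         ≤⟨ *-monoˡ-≤ _ (*-monoˡ-≤ (2 ^ n) (^-monoˡ-≤ (2 * e) T≤)) ⟩
    (2 ^ suc k * B) ^ (2 * e) * 2 ^ n * h ^ (q * n)           ≡⟨ cong (λ x → x * 2 ^ n * h ^ (q * n)) (trans (^-distribʳ-* (2 ^ suc k) B (2 * e)) (cong (_* B ^ (2 * e)) (^-*-assoc 2 (suc k) (2 * e)))) ⟩
    2 ^ (suc k * (2 * e)) * B ^ (2 * e) * 2 ^ n * h ^ (q * n) ≤⟨ *-monoˡ-≤ _ (*-monoˡ-≤ (2 ^ n) (*-monoˡ-≤ (B ^ (2 * e)) (^-monoʳ {2} (s≤s z≤n) k-small))) ⟩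
    2 ^ n * B ^ (2 * e) * 2 ^ n * h ^ (q * n)                 ≡⟨ lemma (2 ^ n) (B ^ (2 * e)) (h ^ (q * n)) ⟩
    B ^ (2 * e) * (2 ^ n * 2 ^ n * h ^ (q * n))               ≡⟨ cong₂ (λ x y → B ^ (2 * e) * (x * y)) (^-distribʳ-* 2 2 n) (^-*-assoc h q n) ⟨
    B ^ (2 * e) * (4 ^ n * (h ^ q) ^ n)                       ≡⟨ cong (B ^ (2 * e) *_) (^-distribʳ-* 4 (h ^ q) n) ⟨
    B ^ (2 * e) * (4 * h ^ q) ^ n                             ≤⟨ *-monoʳ-≤ (B ^ (2 * e)) (^-monoˡ-≤ n h-growth) ⟩
    B ^ (2 * e) * (suc h ^ q) ^ n                             ≡⟨ cong (B ^ (2 * e) *_) (^-*-assoc (suc h) q n) ⟩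
    B ^ (2 * e) * suc h ^ (q * n)                             ≤⟨ B≤ ⟩
    N ^ (n * e) * h ^ (q * n)                                 ∎)
    where
    lemma : ∀ z b x → z * b * z * x ≡ b * (z * z * x)
    lemma = solve-∀

-- Choice of the error term

all-colours : ∀ q (G : Graph n) → ColourLists q G
all-colours q G v x = true

module _ {n : ℕ} (q : ℕ) (G : Graph n) where

  listSize-all : ∀ v → listSize q G (all-colours q G) v ≡ q
  listSize-all v = trans (∑-const (allFin q) 1) (trans (*-identityʳ _) (length-allFin q))

  c≡listColourings : c q G ≡ listColourings q G (all-colours q G)
  c≡listColourings = trans (length-filterᵇ (isProper G) (allColourings q n)) (∑-cong (allColourings q n) λ f →
    trans (≡-sym (*-identityʳ _)) (cong (ind (isProper G f) *_) (≡-sym (∏-allFin-≡1 n _ λ _ → refl))))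

  sizeSum-all : sizeSum q G (all-colours q G) ≡ q * n
  sizeSum-all = trans (∑-cong (allFin n) listSize-all) (trans (∑-const (allFin n) q)
    (trans (cong (_* q) (length-allFin n)) (*-comm n q)))

  c≤q^n : c q G ≤ q ^ n
  c≤q^n = ≤-trans (≤-reflexive c≡listColourings) (≤-trans (listColourings≤sizeProduct q G _)
    (≤-reflexive (trans (∏-cong (allFin n) listSize-all) (trans (∏-const (allFin n) q) (cong (q ^_) (length-allFin n))))))

n≤2^n : ∀ n → n ≤ 2 ^ n
n≤2^n zero    = z≤n
n≤2^n (suc n) = ≤-trans (+-mono-≤ (1≤^ {2} n (s≤s z≤n)) (n≤2^n n)) (≤-reflexive (cong (2 ^ n +_) (≡-sym (+-identityʳ _))))

module _ {q : ℕ} (3≤q : 3 ≤ q) where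

  private
    1≤m : 1 ≤ m q
    1≤m = ≤-trans (s≤s z≤n) (2≤m 3≤q)
    1≤η : 1 ≤ η q
    1≤η = ≤-trans (s≤s z≤n) (2≤η 3≤q)
    Q : ℕ
    Q = q * q ∸ 1
    1≤q : 1 ≤ q
    1≤q = ≤-trans (s≤s z≤n) 3≤q
    q²≡ : q * q ≡ suc Q
    q²≡ = ≡-sym (m+[n∸m]≡n {1} (*-mono-≤ 1≤q 1≤q))
    instance
      q≢0 : NonZero q
      q≢0 = >-nonZero 1≤q
      Q≢0 : NonZero Q
      Q≢0 = >-nonZero (m+n≤o⇒m≤o∸n 1 {1} (*-mono-≤ (≤-trans (s≤s (s≤s z≤n)) 3≤q) 1≤q))

  module _ (e : ℕ) .{{_ : NonZero e}} where

    private
      -- About n/g branchings are made: g = 4e keeps the leaf count raised to 2e below 2^n. L = 4Q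
      -- gives (1 + 1/Q)^(2L) ≥ 9. The value of t gives (1 + 1/t)^(2qgL) ≤ 2. Finally φ - 1 = t²,
      -- since (1 + 1/t)^(t²) ≥ t is the growth condition of `sparsify`.
      g L t φ : ℕ
      g = 4 * e
      L = 4 * Q
      t = 4 * (q * (g * L))
      φ = suc (t * t)
      instance
        g≢0 : NonZero g
        g≢0 = m*n≢0 4 e
        L≢0 : NonZero L
        L≢0 = m*n≢0 4 Q
        gL≢0 : NonZero (g * L)
        gL≢0 = m*n≢0 g L
        qgL≢0 : NonZero (q * (g * L))
        qgL≢0 = m*n≢0 q (g * L)
        t≢0 : NonZero t
        t≢0 = m*n≢0 4 (q * (g * L))

    -- From this degree on, the loss 2^(qnφ) from sparse lists, at the power gL, is at most 2^(nd).
    -- Together with d ≤ n it also forces n ≥ 2gL.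
    sparseThreshold : ℕ
    sparseThreshold = q * φ * (g * L)

    -- The bound carries no error term: sparsification is paid for in advance out of the exponential
    -- savings.
    few-independent : ∀ {n d} (G : Graph n) → Regular d G → sparseThreshold ≤ d → d ≤ n →
      (∀ I → Independent G I → 2 * e * count I (allFin n) + n < e * n) → c q G ^ 2 ≤ η q ^ n
    few-independent {n} {d} G reg d-large d≤n small =
      *-cancelʳ-≤ _ _ (t ^ (q * n * 2)) {{m^n≢0 t (q * n * 2)}} (begin
        c q G ^ 2 * t ^ (q * n * 2)              ≡⟨ cong (c q G ^ 2 *_) (^-*-assoc t (q * n) 2) ⟨
        c q G ^ 2 * (t ^ (q * n)) ^ 2            ≡⟨ ^-distribʳ-* (c q G) _ 2 ⟨
        (c q G * t ^ (q * n)) ^ 2                ≤⟨ ^-monoˡ-≤ 2 c≤B₁ ⟩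
        (suc t ^ (q * n) * B₁) ^ 2               ≡⟨ trans (^-distribʳ-* (suc t ^ (q * n)) B₁ 2) (trans (*-comm _ (B₁ ^ 2)) (cong (B₁ ^ 2 *_) (^-normalize (suc t) (q * n) 2 _ (*-comm (q * n) 2)))) ⟩
        B₁ ^ 2 * suc t ^ (2 * (q * n))           ≤⟨ proj₁ (proj₂ root₁) ⟩
        η q ^ n * t ^ (2 * (q * n))              ≡⟨ cong (λ k → η q ^ n * t ^ k) (*-comm 2 (q * n)) ⟩
        η q ^ n * t ^ (q * n * 2)                ∎)
      where
      open ≤-Reasoning
      h : ℕ
      h = q / 2
      instance
        h≢0 : NonZero h
        h≢0 = >-nonZero (1≤q/2 3≤q)
        double-e≢0 : NonZero (2 * e)
        double-e≢0 = m*n≢0 2 e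
        d≢0 : NonZero d
        d≢0 = >-nonZero (≤-trans (>-nonZero⁻¹ sparseThreshold {{m*n≢0 (q * φ) (g * L) {{m*n≢0 q φ}}}}) d-large)
      gL≤ : 2 * (g * L) ≤ n
      gL≤ = ≤-trans (*-monoˡ-≤ (g * L) (*-mono-≤ (≤-trans (s≤s (s≤s z≤n)) 3≤q) (s≤s {n = t * t} z≤n))) (≤-trans d-large d≤n)
      -- `B₁` is η^(n/2) already divided by the sparsification cost (1 + 1/t)^(qn). Below, `B₂` is
      -- the bound for disjoint lists.
      root₁ = integer-root 2 (η q ^ n * t ^ (2 * (q * n))) (suc t ^ (2 * (q * n))) {{_}} {{m^n≢0 (suc t) (2 * (q * n))}}
      B₁ = proj₁ root₁
      root₂ = integer-root (2 * e) (η q ^ (n * e) * h ^ (q * n)) (suc h ^ (q * n)) {{double-e≢0}} {{m^n≢0 (suc h) (q * n)}}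
      B₂ = proj₁ root₂
      disjoint≤ : ∀ A → Disjoint q G A → listColourings q G A ≤ B₂
      disjoint≤ A disjoint = ≤-trans (listColourings≤sizeProduct q G A)
        (proj₂ (proj₂ root₂) (sizeProduct q G A) (disjoint⇒sizeProduct≤ 3≤q G e small A disjoint))
      k = suc (n / g)
      n≤kg : n ≤ k * g
      n≤kg = ≤-trans (≤-reflexive (m≡m%n+[m/n]*n n g)) (+-monoˡ-≤ (n / g * g) (<⇒≤ (m%n<n n g)))
      k-small : suc k * (2 * e) ≤ n
      k-small = *-cancelˡ-≤ 2 (begin
        2 * (suc k * (2 * e))          ≡⟨ lemma (n / g) e ⟩
        n / g * g + 2 * g              ≤⟨ +-mono-≤ (m/n*n≤m n g) (≤-trans (*-monoʳ-≤ 2 (m≤m*n g L)) gL≤) ⟩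
        n + n                          ≡⟨ cong (n +_) (+-identityʳ n) ⟨
        2 * n                          ∎)
        where
        lemma : ∀ x e → 2 * ((2 + x) * (2 * e)) ≡ x * (4 * e) + 2 * (4 * e)
        lemma = solve-∀
      sparse≤ : ∀ A → Sparse q G φ A → listColourings q G A ≤ B₁
      sparse≤ A sparse = proj₂ (proj₂ root₁) (listColourings q G A)
        (by-dominant-term (≤-total (2 ^ k * (suc Q ^ k * B₂)) (Q ^ k * sizeProduct q G A)))
        where
        T = listColourings q G A
        both : T * suc Q ^ k ≤ Q ^ k * sizeProduct q G A + 2 ^ k * (suc Q ^ k * B₂)
        both = disjointify q G Q q²≡ B₂ disjoint≤ k A
        twice : ∀ x → x + x ≡ 2 * x
        twice x = cong (x +_) (≡-sym (+-identityʳ x))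
        -- The sum of two terms is at most twice the larger, so each case has to exploit one saving
        -- only, at the price of a factor 2.
        by-dominant-term : _ ⊎ _ → T ^ 2 * suc t ^ (2 * (q * n)) ≤ η q ^ n * t ^ (2 * (q * n))
        by-dominant-term (inj₁ le) = conflict-saving {T = T} {N = η q} {n = n} {d = d} {k = k} {g = g} {L = L} {q = q} {φ = φ} {t = t} {Q = Q}
          (≤-trans both (≤-trans (+-monoʳ-≤ (Q ^ k * sizeProduct q G A) le) (≤-reflexive (twice (Q ^ k * sizeProduct q G A)))))
          (sparse⇒sizeProduct≤ 3≤q G reg A sparse) n≤kg gL≤ d-large
          (power-growth Q (2 * L) 9 (≤-reflexive (lemma Q)))
          (power-growth≤2 t (2 * (q * (g * L))) (≤-reflexive (lemma′ (q * (g * L)))))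
          where
          lemma : ∀ Q → 9 * Q ≡ Q + 2 * (4 * Q)
          lemma = solve-∀
          lemma′ : ∀ x → 2 * (2 * x) ≡ 4 * x
          lemma′ = solve-∀
        by-dominant-term (inj₂ le) = independence-saving {T = T} {B = B₂} {N = η q} {n = n} {k = k} {e = e} {q = q} {h = h} {t = t}
          (*-cancelʳ-≤ _ _ (suc Q ^ k) {{m^n≢0 (suc Q) k}} (≤-trans both
            (≤-trans (+-monoˡ-≤ (2 ^ k * (suc Q ^ k * B₂)) le) (≤-reflexive (lemma (2 ^ k) (suc Q ^ k) B₂)))))
          (proj₁ (proj₂ root₂)) (4*[q/2]^q≤ 3≤q) k-small
          (power-growth≤2 t (2 * (q * e)) (≤-trans (≤-reflexive (lemma′ (q * e))) (*-monoʳ-≤ 4 (*-monoʳ-≤ q (≤-trans (m≤n*m e 4) (m≤m*n g L))))))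
          where
          lemma : ∀ x y b → x * (y * b) + x * (y * b) ≡ 2 * x * b * y
          lemma = solve-∀
          lemma′ : ∀ x → 2 * (2 * x) ≡ 4 * x
          lemma′ = solve-∀
      c≤B₁ : c q G * t ^ (q * n) ≤ suc t ^ (q * n) * B₁
      c≤B₁ = subst₂ (λ x s → x * t ^ s ≤ suc t ^ s * B₁) (≡-sym (c≡listColourings q G)) (sizeSum-all q G)
        (sparsify q G t (t * t) B₁ (power-growth t (t * t) t (m≤n+m (t * t) t)) sparse≤ (all-colours q G))

  -- Degrees from which the error term ε = 1 / (k + 1) is admissible.
  admissibleFrom : ℕ → ℕ
  admissibleFrom k = 2 * threshold 3≤q (4 * suc k) + sparseThreshold (gap 3≤q (suc k)) {{m*n≢0 (4 * suc k) (suc q)}} + 1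

  -- The case split is on the target inequality itself, not on the existence of a large independent
  -- set: if the target fails, `large-independent-set` shows that every independent set is small.
  admissible-bound : ∀ k {n d} (G : Graph n) → Regular d G → admissibleFrom k ≤ d → d ≤ n →
    c q G ^ (2 * d * suc k) ≤ η q ^ (n * d * suc k) * m q ^ (n * suc (suc k))
  admissible-bound k {n} {d} G reg D≤d d≤n with c q G ^ (2 * d * suc k) ≤? η q ^ (n * d * suc k) * m q ^ (n * suc (suc k))
  ... | yes le = le
  ... | no ¬le = begin
    c q G ^ (2 * d * suc k)              ≡⟨ ^-normalize (c q G) 2 (d * suc k) _ (≡-sym (*-assoc 2 d (suc k))) ⟨
    (c q G ^ 2) ^ (d * suc k)            ≤⟨ ^-monoˡ-≤ (d * suc k) (few-independent (gap 3≤q (suc k)) {{e≢0}} G reg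
                                              (≤-trans (≤-trans (m≤n+m _ _) (m≤m+n _ 1)) D≤d) d≤n small) ⟩
    (η q ^ n) ^ (d * suc k)              ≡⟨ ^-normalize (η q) n (d * suc k) _ (≡-sym (*-assoc n d (suc k))) ⟩
    η q ^ (n * d * suc k)                ≤⟨ m≤m*n _ (m q ^ (n * suc (suc k))) {{>-nonZero (1≤^ (n * suc (suc k)) 1≤m)}} ⟩
    η q ^ (n * d * suc k) * m q ^ (n * suc (suc k)) ∎
    where
    open ≤-Reasoning
    e≢0 : NonZero (gap 3≤q (suc k))
    e≢0 = m*n≢0 (4 * suc k) (suc q)
    small : ∀ I → Independent G I → 2 * gap 3≤q (suc k) * count I (allFin n) + n < gap 3≤q (suc k) * n
    small I indep = ≰⇒> λ large → ¬le (large-independent-set 3≤q (suc k) d {{>-nonZero (≤-trans (m≤n+m 1 _) D≤d)}} G reg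
      (≤-trans (≤-trans (m≤m+n _ _) (m≤m+n _ 1)) D≤d) I indep large)

  -- From c ≤ q^n and q ≤ 2^q ≤ m^q, the error term 2qd always works; it covers the degrees at which
  -- nothing better is known.
  trivial-bound : ∀ {n} d (G : Graph n) → c q G ^ (2 * d * 1) ≤ η q ^ (n * d * 1) * m q ^ (n * (1 + 2 * q * d))
  trivial-bound {n} d G = begin
    c q G ^ (2 * d * 1)                  ≤⟨ ^-monoˡ-≤ (2 * d * 1) (≤-trans (c≤q^n q G) (^-monoˡ-≤ n (≤-trans (n≤2^n q) (^-monoˡ-≤ q (2≤m 3≤q))))) ⟩
    ((m q ^ q) ^ n) ^ (2 * d * 1)        ≡⟨ trans (cong (_^ (2 * d * 1)) (^-*-assoc (m q) q n)) (^-normalize (m q) (q * n) (2 * d * 1) _ (lemma q n d)) ⟩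
    m q ^ (n * (2 * q * d))              ≤⟨ ^-monoʳ 1≤m (*-monoʳ-≤ n (n≤1+n (2 * q * d))) ⟩
    m q ^ (n * (1 + 2 * q * d))          ≤⟨ m≤n*m _ (η q ^ (n * d * 1)) {{>-nonZero (1≤^ (n * d * 1) 1≤η)}} ⟩
    η q ^ (n * d * 1) * m q ^ (n * (1 + 2 * q * d)) ∎
    where
    open ≤-Reasoning
    lemma : ∀ q n d → q * n * (2 * d * 1) ≡ n * (2 * q * d)
    lemma = solve-∀

  unit : ℕ → ℚ
  unit k = mkℚ (ℤ.+ 1) k (1-coprimeTo (suc k))

  natural : ℕ → ℚ
  natural a = mkℚ (ℤ.+ a) 0 (Coprimality.sym (1-coprimeTo a))

  -- Downward search for the largest admissible index below the second argument, with the error of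
  -- `trivial-bound` as default. The theorem takes `d` for both arguments, which keeps the search
  -- finite while its range grows.
  errorUpTo : ℕ → ℕ → ℚ
  errorUpTo d zero = natural (2 * q * d)
  errorUpTo d (suc k) with admissibleFrom k ≤? d
  ... | yes _ = unit k
  ... | no  _ = errorUpTo d k

  errorUpTo-bound : ∀ {n d} (G : Graph n) → Regular d G → d ≤ n → ∀ k → Bound q d n (c q G) (errorUpTo d k)
  errorUpTo-bound {n} {d} G reg d≤n zero = trivial-bound d G
  errorUpTo-bound {n} {d} G reg d≤n (suc k) with admissibleFrom k ≤? d
  ... | yes D≤d = subst (λ s → c q G ^ (2 * d * suc k) ≤ η q ^ (n * d * suc k) * m q ^ (n * s)) (+-comm 1 (suc k))
                    (admissible-bound k G reg D≤d d≤n)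
  ... | no _    = errorUpTo-bound G reg d≤n k

  unit-antitone : ∀ {j k} → j ≤ k → unit k ≤ℚ unit j
  unit-antitone j≤k = *≤* (ℤ.*-monoˡ-≤-nonNeg (ℤ.+ 1) (ℤ.+≤+ (s≤s j≤k)))

  -- As `j` is admissible and lies in the range, the search stops at `j` or at a larger index.
  errorUpTo-small : ∀ d j → admissibleFrom j ≤ d → ∀ k → j < k → ∣ errorUpTo d k ∣ ≤ℚ unit j
  errorUpTo-small d j D≤d (suc k) (s≤s j≤k) with admissibleFrom k ≤? d
  ... | yes _ = unit-antitone j≤k
  ... | no ¬D with m≤n⇒m<n∨m≡n j≤k
  ...   | inj₁ j<k  = errorUpTo-small d j D≤d k j<k
  ...   | inj₂ refl = ⊥-elim (¬D D≤d)

  unit≤positive : ∀ δ → 0ℚ <ℚ δ → ∃ λ j → unit j ≤ℚ δ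
  unit≤positive (mkℚ (ℤ.+ suc a) j _) _ = j , *≤* (ℤ.*-monoʳ-≤-nonNeg (ℤ.+ suc j) (ℤ.+≤+ {1} {suc a} (s≤s z≤n)))
  unit≤positive (mkℚ (ℤ.+ zero) j _) (*<* (ℤ.+<+ ()))
  unit≤positive (mkℚ ℤ.-[1+ a ] j _) (*<* ())

theorem1p3 : (q : ℕ) → 3 ≤ q →
    Σ (ℕ → ℚ) λ ε →
    ((δ : ℚ) → 0ℚ <ℚ δ → ∃ λ D → (d : ℕ) → D ≤ d → ∣ ε d ∣ ≤ℚ δ)
    × ((d n : ℕ) → 2 ≤ d → d + 1 ≤ n → (G : Graph n) → Regular d G →
    Bound q d n (c q G) (ε d))
theorem1p3 q 3≤q = (λ d → errorUpTo 3≤q d d) , tends-to-0 , λ d n 2≤d d<n G reg →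
    errorUpTo-bound 3≤q G reg (≤-trans (m≤m+n d 1) d<n) d
  where
  tends-to-0 : (δ : ℚ) → 0ℚ <ℚ δ → ∃ λ D → (d : ℕ) → D ≤ d → ∣ errorUpTo 3≤q d d ∣ ≤ℚ δ
  tends-to-0 δ 0<δ with unit≤positive 3≤q δ 0<δ
  -- The summand `suc j` ensures j < d, so that the search range of `errorUpTo` contains `j`.
  ... | j , unit≤δ = admissibleFrom 3≤q j + suc j , λ d D≤d →
    ℚ.≤-trans (errorUpTo-small 3≤q d j (≤-trans (m≤m+n _ _) D≤d) d (≤-trans (m≤n+m _ _) D≤d)) unit≤δ
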